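{- Let $k$ be a positive integer. Then $(k+\sqrt{k^2+4})/2$ belongs to the $(2k-1)$-th derived set of $S_{\operatorname{graph}}$, and $k+1$ belongs to the $(2k)$-th derived set of $S_{\operatorname{graph}}$.
   Context: Graphs are finite simple graphs; eigenvalues are those of the adjacency matrix. A graph $G$ is a Salem graph if either it is nonbipartite, has exactly one eigenvalue $\lambda>2$ and none in $(-\infty,-2)$; or it is bipartite, has exactly one eigenvalue $\lambda>2$ and only $-\lambda$ in $(-\infty,-2)$. It is trivial if nonbipartite with $\lambda\in\mathbb Z$ or bipartite with $\lambda^2\in\mathbb Z$. For nontrivial $G$, $\tau(G)$ is the larger root of $z+1/z=\lambda$ (nonbipartite) or of $\sqrt z+1/\sqrt z=\lambda$ (bipartite). $T_{\operatorname{graph}}$ is the set of all such $\tau(G)$, and $S_{\operatorname{graph}}$ is the set of limit points of $T_{\operatorname{graph}}$ (a set of Pisot numbers). The first derived set of a real set is its set of limit points; for $j\ge2$ the $j$-th derived set is the set of limit points of the $(j-1)$-th derived set. -}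

module Defs where

open import Data.Bool.Base using (Bool; true; false; if_then_else_)
open import Data.Fin.Base using (Fin)
open import Data.Integer.Base as ℤ using (ℤ)
open import Data.Nat.Base as ℕ using (ℕ; zero; suc; _⊔_)
import Data.Nat.Properties as ℕ
open import Data.Product.Base using (∃; ∃-syntax; _×_; _,_)
open import Data.Rational.Base as ℚ using (ℚ; 0ℚ; 1ℚ; ½; ∣_∣)
import Data.Rational.Properties as ℚ
import Data.Rational.Solver as ℚ
open import Data.Sum.Base using (_⊎_)
open import Data.Vec.Functional using (Vector)
open import Level using (0ℓ)
open import Relation.Binary.PropositionalEquality
  using (_≡_; _≢_; refl; sym; cong; subst; module ≡-Reasoning)
open import Relation.Nullary using (¬_)
open import Relation.Unary using (Pred)

import Algebra.Definitions.RawMonoid as Sum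
open import Algebra.Bundles.Raw using (RawRing)

Eventually : Pred ℕ 0ℓ → Set
Eventually P = ∃[ N ] ∀ n → N ℕ.≤ n → P n

Cauchy : (ℕ → ℚ) → Set
Cauchy x = ∀ ε → 0ℚ ℚ.< ε →
  ∃[ N ] ∀ m n → N ℕ.≤ m → N ℕ.≤ n → ∣ x m ℚ.- x n ∣ ℚ.< ε

private
  ⊔≤⇒ˡ : ∀ M N {o} → M ⊔ N ℕ.≤ o → M ℕ.≤ o
  ⊔≤⇒ˡ M N p = ℕ.≤-trans (ℕ.m≤m⊔n M N) p

  ⊔≤⇒ʳ : ∀ M N {o} → M ⊔ N ℕ.≤ o → N ℕ.≤ o
  ⊔≤⇒ʳ M N p = ℕ.≤-trans (ℕ.m≤n⊔m M N) p

  infixl 6 _⟪+⟫_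
  _⟪+⟫_ : ∀ {p q r s} → p ℚ.< q → r ℚ.< s → p ℚ.+ r ℚ.< q ℚ.+ s
  _⟪+⟫_ = ℚ.+-mono-<

  *½-pos : ∀ {p} → 0ℚ ℚ.< p → 0ℚ ℚ.< p ℚ.* ½
  *½-pos {p} 0<p = ℚ.positive⁻¹ (p ℚ.* ½)
    {{ℚ.pos*pos⇒pos p {{ℚ.positive 0<p}} ½}}

  half+half : ∀ p → p ℚ.* ½ ℚ.+ p ℚ.* ½ ≡ p
  half+half p = begin
    p ℚ.* ½ ℚ.+ p ℚ.* ½ ≡⟨ ℚ.*-distribˡ-+ p ½ ½ ⟨
    p ℚ.* 1ℚ            ≡⟨ ℚ.*-identityʳ p ⟩
    p                   ∎
    where open ≡-Reasoning

const-cauchy : ∀ q → Cauchy (λ _ → q)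
const-cauchy q ε 0<ε = 0 , λ _ _ _ _ →
  subst (ℚ._< ε) (sym (cong ∣_∣ (ℚ.+-inverseʳ q))) 0<ε

neg-cauchy : ∀ x → Cauchy x → Cauchy (λ n → ℚ.- x n)
neg-cauchy x cx ε 0<ε with cx ε 0<ε
... | N , close = N , λ m n N≤m N≤n →
  subst (ℚ._< ε) (sym (flip m n)) (close m n N≤m N≤n)
  where
  flip : ∀ m n → ∣ ℚ.- x m ℚ.- ℚ.- x n ∣ ≡ ∣ x m ℚ.- x n ∣
  flip m n rewrite sym (ℚ.neg-distrib-+ (x m) (ℚ.- x n)) =
    ℚ.∣-p∣≡∣p∣ (x m ℚ.- x n)

+-cauchy : ∀ x y → Cauchy x → Cauchy y → Cauchy (λ n → x n ℚ.+ y n)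
+-cauchy x y cx cy ε 0<ε
  with cx (ε ℚ.* ½) (*½-pos 0<ε) | cy (ε ℚ.* ½) (*½-pos 0<ε)
... | M , closeˣ | N , closeʸ = M ⊔ N , λ m n ≤m ≤n → begin-strict
  ∣ x m ℚ.+ y m ℚ.- (x n ℚ.+ y n) ∣
    ≡⟨ cong ∣_∣ (regroup (x m) (y m) (x n) (y n)) ⟩
  ∣ (x m ℚ.- x n) ℚ.+ (y m ℚ.- y n) ∣
    ≤⟨ ℚ.∣p+q∣≤∣p∣+∣q∣ (x m ℚ.- x n) (y m ℚ.- y n) ⟩
  ∣ x m ℚ.- x n ∣ ℚ.+ ∣ y m ℚ.- y n ∣
    <⟨ closeˣ m n (⊔≤⇒ˡ M N ≤m) (⊔≤⇒ˡ M N ≤n)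
       ⟪+⟫ closeʸ m n (⊔≤⇒ʳ M N ≤m) (⊔≤⇒ʳ M N ≤n) ⟩
  ε ℚ.* ½ ℚ.+ ε ℚ.* ½
    ≡⟨ half+half ε ⟩
  ε ∎
  where
  open ℚ.≤-Reasoning
  open ℚ.+-*-Solver
  regroup : ∀ a b c d → a ℚ.+ b ℚ.- (c ℚ.+ d) ≡ (a ℚ.- c) ℚ.+ (b ℚ.- d)
  regroup = solve 4 (λ a b c d →
    a :+ b :- (c :+ d) := (a :- c) :+ (b :- d)) refl

bounded : ∀ x → Cauchy x → ∃[ K ] Eventually (λ n → ∣ x n ∣ ℚ.< K)
bounded x cx with cx 1ℚ (ℚ.positive⁻¹ 1ℚ)
... | N , close = 1ℚ ℚ.+ ∣ x N ∣ , N , λ n N≤n → begin-strict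
  ∣ x n ∣                       ≡⟨ cong ∣_∣ (regroup (x n) (x N)) ⟩
  ∣ (x n ℚ.- x N) ℚ.+ x N ∣     ≤⟨ ℚ.∣p+q∣≤∣p∣+∣q∣ (x n ℚ.- x N) (x N) ⟩
  ∣ x n ℚ.- x N ∣ ℚ.+ ∣ x N ∣   <⟨ ℚ.+-monoˡ-< ∣ x N ∣ (close n N N≤n ℕ.≤-refl) ⟩
  1ℚ ℚ.+ ∣ x N ∣                ∎
  where
  open ℚ.≤-Reasoning
  open ℚ.+-*-Solver
  regroup : ∀ a b → a ≡ (a ℚ.- b) ℚ.+ b
  regroup = solve 2 (λ a b → a := (a :- b) :+ b) refl

private
  product-close : ∀ {K δ} ε .{{_ : ℚ.Positive K}} → K ℚ.* δ ≡ ε → ∀ a b →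
                  ∣ a ∣ ℚ.< K → ∣ b ∣ ℚ.< δ → ∣ a ℚ.* b ∣ ℚ.< ε
  product-close {K} {δ} ε Kδ≡ε a b a<K b<δ = begin-strict
    ∣ a ℚ.* b ∣       ≡⟨ ℚ.∣p*q∣≡∣p∣*∣q∣ a b ⟩
    ∣ a ∣ ℚ.* ∣ b ∣   ≤⟨ ℚ.*-monoʳ-≤-nonNeg ∣ b ∣ {{ℚ.∣-∣-nonNeg b}} (ℚ.<⇒≤ a<K) ⟩
    K ℚ.* ∣ b ∣       <⟨ ℚ.*-monoʳ-<-pos K b<δ ⟩
    K ℚ.* δ           ≡⟨ Kδ≡ε ⟩
    ε                 ∎
    where open ℚ.≤-Reasoning

  tolerance : ∀ ε K → 0ℚ ℚ.< ε → .{{_ : ℚ.Positive K}} →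
              ∃[ δ ] 0ℚ ℚ.< δ × K ℚ.* δ ≡ ε
  tolerance ε K 0<ε = K⁻¹ ℚ.* ε , 0<δ , (begin
    K ℚ.* (K⁻¹ ℚ.* ε)   ≡⟨ ℚ.*-assoc K K⁻¹ ε ⟨
    K ℚ.* K⁻¹ ℚ.* ε     ≡⟨ cong (ℚ._* ε) (ℚ.*-inverseʳ K {{K≢0}}) ⟩
    1ℚ ℚ.* ε            ≡⟨ ℚ.*-identityˡ ε ⟩
    ε                   ∎)
    where
    open ≡-Reasoning
    K≢0 : ℚ.NonZero K
    K≢0 = ℚ.pos⇒nonZero K
    K⁻¹ : ℚ
    K⁻¹ = (ℚ.1/ K) {{K≢0}}
    0<δ : 0ℚ ℚ.< K⁻¹ ℚ.* ε
    0<δ = ℚ.positive⁻¹ (K⁻¹ ℚ.* ε)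
      {{ℚ.pos*pos⇒pos K⁻¹ {{ℚ.1/pos⇒pos K}} ε {{ℚ.positive 0<ε}}}}

  split : ∀ a b c d → a ℚ.* b ℚ.- c ℚ.* d ≡ a ℚ.* (b ℚ.- d) ℚ.+ d ℚ.* (a ℚ.- c)
  split = solve 4 (λ a b c d →
    a :* b :- c :* d := a :* (b :- d) :+ d :* (a :- c)) refl
    where open ℚ.+-*-Solver

  bound-pos : ∀ (x : ℕ → ℚ) {K} N → (∀ n → N ℕ.≤ n → ∣ x n ∣ ℚ.< K) → ℚ.Positive K
  bound-pos x N x<K = ℚ.positive
    (ℚ.≤-<-trans (ℚ.0≤∣p∣ (x N)) (x<K N ℕ.≤-refl))

*-cauchy : ∀ x y → Cauchy x → Cauchy y → Cauchy (λ n → x n ℚ.* y n)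
*-cauchy x y cx cy ε 0<ε =
  let K , A , x<K = bounded x cx
      L , B , y<L = bounded y cy
      K>0 = bound-pos x A x<K
      L>0 = bound-pos y B y<L
      η = ε ℚ.* ½
      0<η = *½-pos 0<ε
      δ , 0<δ , Kδ≡η = tolerance η K 0<η {{K>0}}
      γ , 0<γ , Lγ≡η = tolerance η L 0<η {{L>0}}
      C , closeˣ = cx γ 0<γ
      D , closeʸ = cy δ 0<δ
      A≤ : ∀ {o} → (A ⊔ B) ⊔ (C ⊔ D) ℕ.≤ o → A ℕ.≤ o
      A≤ p = ⊔≤⇒ˡ A B (⊔≤⇒ˡ (A ⊔ B) (C ⊔ D) p)
      B≤ : ∀ {o} → (A ⊔ B) ⊔ (C ⊔ D) ℕ.≤ o → B ℕ.≤ o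
      B≤ p = ⊔≤⇒ʳ A B (⊔≤⇒ˡ (A ⊔ B) (C ⊔ D) p)
      C≤ : ∀ {o} → (A ⊔ B) ⊔ (C ⊔ D) ℕ.≤ o → C ℕ.≤ o
      C≤ p = ⊔≤⇒ˡ C D (⊔≤⇒ʳ (A ⊔ B) (C ⊔ D) p)
      D≤ : ∀ {o} → (A ⊔ B) ⊔ (C ⊔ D) ℕ.≤ o → D ℕ.≤ o
      D≤ p = ⊔≤⇒ʳ C D (⊔≤⇒ʳ (A ⊔ B) (C ⊔ D) p)
  in (A ⊔ B) ⊔ (C ⊔ D) , λ m n ≤m ≤n → begin-strict
    ∣ x m ℚ.* y m ℚ.- x n ℚ.* y n ∣
      ≡⟨ cong ∣_∣ (split (x m) (y m) (x n) (y n)) ⟩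
    ∣ x m ℚ.* (y m ℚ.- y n) ℚ.+ y n ℚ.* (x m ℚ.- x n) ∣
      ≤⟨ ℚ.∣p+q∣≤∣p∣+∣q∣ (x m ℚ.* (y m ℚ.- y n)) (y n ℚ.* (x m ℚ.- x n)) ⟩
    ∣ x m ℚ.* (y m ℚ.- y n) ∣ ℚ.+ ∣ y n ℚ.* (x m ℚ.- x n) ∣
      <⟨ product-close η {{K>0}} Kδ≡η (x m) (y m ℚ.- y n)
           (x<K m (A≤ ≤m)) (closeʸ m n (D≤ ≤m) (D≤ ≤n))
         ⟪+⟫
         product-close η {{L>0}} Lγ≡η (y n) (x m ℚ.- x n)
           (y<L n (B≤ ≤n)) (closeˣ m n (C≤ ≤m) (C≤ ≤n)) ⟩
    η ℚ.+ η
      ≡⟨ half+half ε ⟩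
    ε ∎
  where open ℚ.≤-Reasoning

-- Real numbers: Cauchy sequences of rationals, with arithmetic
-- performed termwise and `_≈_` as the equality.

record ℝ : Set where
  constructor mkℝ
  field
    seq    : ℕ → ℚ
    cauchy : Cauchy seq

open ℝ public

fromℚ : ℚ → ℝ
fromℚ q = mkℝ (λ _ → q) (const-cauchy q)

fromℤ : ℤ → ℝ
fromℤ i = fromℚ (i ℚ./ 1)

fromℕ : ℕ → ℝ
fromℕ n = fromℤ (ℤ.+ n)

module Real where

  infix  4 _≈_ _<_ _≤_ _#_
  infixl 6 _+_ _-_
  infixl 7 _*_
  infix  8 -_

  _+_ : ℝ → ℝ → ℝ
  x + y = mkℝ (λ n → seq x n ℚ.+ seq y n) (+-cauchy (seq x) (seq y) (cauchy x) (cauchy y))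

  _*_ : ℝ → ℝ → ℝ
  x * y = mkℝ (λ n → seq x n ℚ.* seq y n) (*-cauchy (seq x) (seq y) (cauchy x) (cauchy y))

  -_ : ℝ → ℝ
  - x = mkℝ (λ n → ℚ.- seq x n) (neg-cauchy (seq x) (cauchy x))

  _-_ : ℝ → ℝ → ℝ
  x - y = x + (- y)

  _≈_ : ℝ → ℝ → Set
  x ≈ y = ∀ ε → 0ℚ ℚ.< ε → Eventually (λ n → ∣ seq x n ℚ.- seq y n ∣ ℚ.< ε)

  -- The gap ε must not depend on n: termwise `<` only gives `≤` in the limit.
  _<_ : ℝ → ℝ → Set
  x < y = ∃[ ε ] 0ℚ ℚ.< ε × Eventually (λ n → seq x n ℚ.+ ε ℚ.< seq y n)

  _≤_ : ℝ → ℝ → Set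
  x ≤ y = ¬ (y < x)

  -- Apartness, the constructive form of x ≠ y; its negation amounts to x ≈ y.
  _#_ : ℝ → ℝ → Set
  x # y = x < y ⊎ y < x

  rawRing : RawRing 0ℓ 0ℓ
  rawRing = record
    { Carrier = ℝ ; _≈_ = _≈_ ; _+_ = _+_ ; _*_ = _*_ ; -_ = -_
    ; 0# = fromℚ 0ℚ ; 1# = fromℚ 1ℚ }

  open Sum (RawRing.+-rawMonoid rawRing) public using (sum)

open Real

IsInteger : Pred ℝ 0ℓ
IsInteger x = ∃[ i ] x ≈ fromℤ i

infix 4 _IsSquareRootOf_ _HasTau_

_IsSquareRootOf_ : ℝ → ℝ → Set
s IsSquareRootOf x = fromℕ 0 ≤ s × s * s ≈ x

IsLargest : ∀ {ℓ} → Pred ℝ ℓ → Pred ℝ ℓ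
IsLargest P x = P x × (∀ y → P y → y ≤ x)

LimitPoint : ∀ {ℓ} → Pred ℝ ℓ → Pred ℝ ℓ
LimitPoint S x = ∀ ε → fromℕ 0 < ε →
  ∃[ y ] S y × y # x × x - ε < y × y < x + ε

-- The usual convention that the 0-th derived set is the set itself.
derived : ∀ {ℓ} → ℕ → Pred ℝ ℓ → Pred ℝ ℓ
derived zero    S = S
derived (suc j) S = LimitPoint (derived j S)

Matrix : ℕ → Set
Matrix n = Fin n → Fin n → ℝ

infixr 7 _*ᵥ_
_*ᵥ_ : ∀ {n} → Matrix n → Vector ℝ n → Vector ℝ n
(A *ᵥ v) i = sum (λ j → A i j * v j)

InEigenspace : ∀ {n} → Matrix n → ℝ → Pred (Vector ℝ n) 0ℓ
InEigenspace A μ v = ∀ i → (A *ᵥ v) i ≈ μ * v i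

IsEigenvector : ∀ {n} → Matrix n → ℝ → Pred (Vector ℝ n) 0ℓ
IsEigenvector A μ v = (∃[ i ] v i # fromℕ 0) × InEigenspace A μ v

-- Only real eigenvectors are considered: all matrices below are symmetric.
IsEigenvalue : ∀ {n} → Matrix n → Pred ℝ 0ℓ
IsEigenvalue A μ = ∃[ v ] IsEigenvector A μ v

-- For a symmetric matrix the multiplicity of an eigenvalue is the dimension
-- of its eigenspace.
IsSimpleEigenvalue : ∀ {n} → Matrix n → Pred ℝ 0ℓ
IsSimpleEigenvalue A μ = ∃[ v ] IsEigenvector A μ v ×
  (∀ w → InEigenspace A μ w → ∃[ c ] ∀ i → w i ≈ c * v i)

-- With multiplicity counted, μ is the one and only eigenvalue satisfying P.
IsOnlyEigenvalueIn : ∀ {n} → Matrix n → Pred ℝ 0ℓ → Pred ℝ 0ℓ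
IsOnlyEigenvalueIn A P μ =
  P μ × IsSimpleEigenvalue A μ × (∀ ν → P ν → IsEigenvalue A ν → ν ≈ μ)

record Graph : Set where
  field
    order       : ℕ
    adjacent    : Fin order → Fin order → Bool
    symmetric   : ∀ i j → adjacent i j ≡ adjacent j i
    irreflexive : ∀ i → adjacent i i ≡ false

open Graph

adjacencyMatrix : (G : Graph) → Matrix (order G)
adjacencyMatrix G i j = if adjacent G i j then fromℕ 1 else fromℕ 0

Bipartite : Pred Graph 0ℓ
Bipartite G = ∃ λ (side : Fin (order G) → Bool) →
  ∀ i j → adjacent G i j ≡ true → side i ≢ side j

Above2 : Pred ℝ 0ℓ
Above2 x = fromℕ 2 < x

Below-2 : Pred ℝ 0ℓ
Below-2 x = x < - fromℕ 2

NonbipartiteSalem : Graph → Pred ℝ 0ℓ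
NonbipartiteSalem G θ =
  ¬ Bipartite G ×
  IsOnlyEigenvalueIn (adjacencyMatrix G) Above2 θ ×
  (∀ ν → Below-2 ν → ¬ IsEigenvalue (adjacencyMatrix G) ν)

BipartiteSalem : Graph → Pred ℝ 0ℓ
BipartiteSalem G θ =
  Bipartite G ×
  IsOnlyEigenvalueIn (adjacencyMatrix G) Above2 θ ×
  IsOnlyEigenvalueIn (adjacencyMatrix G) Below-2 (- θ)

-- z + 1/z = θ
ReciprocalRoot : ℝ → Pred ℝ 0ℓ
ReciprocalRoot θ z = ∃[ w ] z * w ≈ fromℕ 1 × z + w ≈ θ

-- √z + 1/√z = θ
SqrtReciprocalRoot : ℝ → Pred ℝ 0ℓ
SqrtReciprocalRoot θ z = ∃[ s ] s IsSquareRootOf z × ReciprocalRoot θ s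

-- G is a nontrivial Salem graph and τ = τ(G)
_HasTau_ : Graph → ℝ → Set
G HasTau τ =
  (∃[ θ ] NonbipartiteSalem G θ × ¬ IsInteger θ ×
          IsLargest (ReciprocalRoot θ) τ)
  ⊎
  (∃[ θ ] BipartiteSalem G θ × ¬ IsInteger (θ * θ) ×
          IsLargest (SqrtReciprocalRoot θ) τ)

T-graph : Pred ℝ 0ℓ
T-graph τ = ∃[ G ] G HasTau τ

S-graph : Pred ℝ 0ℓ
S-graph = LimitPoint T-graph

module Submission where

-- Write λ = t + 1/t and τ = t². The graphs are trees: k branches, each a path
-- joined by an inner vertex to a common centre, and possibly one more path
-- starting at the centre. Eliminating the vertices of A − λ from the leaves
-- inwards, a path of length a contributes r_a, where r_0 = 0 and
-- r_{a+1} = 1/(λ − r_a), with limit r_∞ = 1/t. A number λ > 2 is an eigenvalue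
-- exactly when f(λ) = λ − r_c − Σ 1/(λ − r_a − r_b) vanishes, c being the central
-- arm and (a, b) running over the branches. As f increases with slope at least 1,
-- there is exactly one such λ; it is simple, and −λ is its mirror image because
-- trees are bipartite.
--
-- The equation f = 0 also makes sense for infinite arms. If all branch arms are
-- infinite it reads t² − 1/t² = k without a central arm, and t² = k + 1 with an
-- infinite one. Replacing an infinite arm by a finite arm of length n lowers τ by
-- a nonzero amount of order 1/n. Hence a root with j infinite arms and long
-- finite ones is in the j-th derived set of T-graph, which is the (j−1)-th
-- derived set of S-graph; here j is 2k or 2k + 1. Long arms also keep λ² off the
-- integers. Roots are obtained by bisection.

open import Algebra.Bundles using (CommutativeRing)
import Algebra.Definitions.RawMonoid as RawMonoid
import Algebra.Solver.Ring as RingSolver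
import Algebra.Solver.Ring.AlmostCommutativeRing as ACR
open import Data.Bool.Base using (Bool; T; true; false; not; if_then_else_)
open import Data.Bool.Properties using (not-¬; not-involutive)
open import Data.Empty using (⊥-elim)
open import Data.Fin.Base using (Fin; zero; suc)
open import Data.Fin.Properties using (_≟_)
open import Data.Integer.Base as ℤ using (ℤ; +0; +[1+_]; -[1+_])
import Data.Integer.Properties as ℤ
open import Data.Maybe.Base using (just; nothing)
open import Data.Nat as ℕ using (ℕ; zero; suc; _⊔_)
import Data.Nat.Properties as ℕ
open import Data.Product using (_×_; ∃-syntax; _,_; proj₁; proj₂)
open import Data.Rational as ℚ using (½; ℚ; 0ℚ; 1ℚ; mkℚ; ∣_∣)
import Data.Rational.Properties as ℚ
import Data.Rational.Unnormalised.Base as ℚᵘ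
import Data.Rational.Unnormalised.Properties as ℚᵘ
open import Data.Sum using (_⊎_; inj₁; inj₂; [_,_]′)
open import Data.Unit using (⊤; tt)
open import Function.Base using (_∘_)
open import Level using (0ℓ)
open import Relation.Binary using (Rel; WeaklyDecidable; tri<; tri≈; tri>)
import Relation.Binary.PropositionalEquality as ≡
open ≡ using (_≡_; _≢_)
open import Relation.Nullary using (Dec; ¬_; yes; no)
open import Relation.Nullary.Decidable using (does; dec-true; from-yes)
open import Defs

-- The obstacle is constructive: the order of `ℝ` is undecidable, so a bisection has to read its
-- signs at rational points, while eigenvectors and limits live in `ℝ`. Hence the arithmetic of arms
-- and its estimates are done over an abstract ordered field, in which cotransitivity and tightness
-- stand in for trichotomy, and used both in `ℚ` and in `ℝ`. The parameter is t rather than λ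
-- because an infinite arm then has the value 1/t, rational at a rational point; no square root is
-- extracted. Real arithmetic being termwise, the value at a real limit is the sequence of the
-- rational values whose signs were tested. Monotonicity and continuity of f come from one source: a
-- difference of values is an exact product of the change of argument and an explicit quotient.
-- Every shortened tree needs a root of its own. The interval [6/5, k + 1] serves all of them: 6/5
-- lies below the square root of the golden ratio, the least limiting t, and keeps t away from 1,
-- where ν = t + 1/t stops depending on t to first order.

record OrderedField : Set₁ where
  infix 4 _<_
  field
    commutativeRing : CommutativeRing 0ℓ 0ℓ
  open CommutativeRing commutativeRing public
  field
    ι    : ℚ → Carrier
    ι-+  : ∀ p q → ι (p ℚ.+ q) ≈ ι p + ι q
    ι-*  : ∀ p q → ι (p ℚ.* q) ≈ ι p * ι q
    ι-‿  : ∀ p → ι (ℚ.- p) ≈ - ι p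
    ι-0  : ι 0ℚ ≈ 0#
    ι-1  : ι 1ℚ ≈ 1#

  -- Constants are images of rationals, which the ring solver recognises.
  𝟘 : Carrier
  𝟘 = ι 0ℚ
  𝟙 : Carrier
  𝟙 = ι 1ℚ

  field
    _<_          : Rel Carrier 0ℓ
    <-resp       : ∀ {x x′ y y′} → x ≈ x′ → y ≈ y′ → x < y → x′ < y′
    <-irrefl     : ∀ {x} → ¬ x < x
    <-trans      : ∀ {x y z} → x < y → y < z → x < z
    <-cotrans    : ∀ {x y} z → x < y → x < z ⊎ z < y
    <-tight      : ∀ {x y} → ¬ x < y → ¬ y < x → x ≈ y
    +-monoˡ-<    : ∀ {x y} z → x < y → x + z < y + z
    *-pos        : ∀ {x y} → 𝟘 < x → 𝟘 < y → 𝟘 < x * y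
    inv          : ∀ x → 𝟘 < x → Carrier
    inv-inverseʳ : ∀ x (0<x : 𝟘 < x) → x * inv x 0<x ≈ 𝟙
    inv-pos      : ∀ x (0<x : 𝟘 < x) → 𝟘 < inv x 0<x
    ι-mono-<     : ∀ {p q} → p ℚ.< q → ι p < ι q
    archimedean  : ∀ x → ∃[ n ] x < ι (ℤ.+ n ℚ./ 1)

-- Integers inside the rationals, and the arithmetic of inequalities

/1-+ : ∀ i j → (i ℤ.+ j) ℚ./ 1 ≡ (i ℚ./ 1) ℚ.+ (j ℚ./ 1)
/1-+ i j = ℚ.toℚᵘ-injective (begin
  ℚ.toℚᵘ (ℚ.fromℚᵘ (ℚᵘ.mkℚᵘ (i ℤ.+ j) 0))                  ≈⟨ ℚ.toℚᵘ-fromℚᵘ _ ⟩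
  ℚᵘ.mkℚᵘ (i ℤ.+ j) 0                                      ≈⟨ ℚᵘ.*≡* (≡.cong (ℤ._* ℤ.1ℤ)
    (≡.cong₂ ℤ._+_ (≡.sym (ℤ.*-identityʳ i)) (≡.sym (ℤ.*-identityʳ j)))) ⟩
  ℚᵘ.mkℚᵘ i 0 ℚᵘ.+ ℚᵘ.mkℚᵘ j 0
    ≈⟨ ℚᵘ.+-cong {x = ℚ.toℚᵘ (i ℚ./ 1)} {u = ℚ.toℚᵘ (j ℚ./ 1)}
         (ℚ.toℚᵘ-fromℚᵘ (ℚᵘ.mkℚᵘ i 0)) (ℚ.toℚᵘ-fromℚᵘ (ℚᵘ.mkℚᵘ j 0)) ⟨
  ℚ.toℚᵘ (i ℚ./ 1) ℚᵘ.+ ℚ.toℚᵘ (j ℚ./ 1)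
    ≈⟨ ℚ.toℚᵘ-homo-+ (i ℚ./ 1) (j ℚ./ 1) ⟨
  ℚ.toℚᵘ ((i ℚ./ 1) ℚ.+ (j ℚ./ 1))                         ∎)
  where open ℚᵘ.≃-Reasoning

/1-* : ∀ i j → (i ℤ.* j) ℚ./ 1 ≡ (i ℚ./ 1) ℚ.* (j ℚ./ 1)
/1-* i j = ℚ.toℚᵘ-injective (begin
  ℚ.toℚᵘ (ℚ.fromℚᵘ (ℚᵘ.mkℚᵘ (i ℤ.* j) 0))                  ≈⟨ ℚ.toℚᵘ-fromℚᵘ _ ⟩
  ℚᵘ.mkℚᵘ i 0 ℚᵘ.* ℚᵘ.mkℚᵘ j 0
    ≈⟨ ℚᵘ.*-cong {x = ℚ.toℚᵘ (i ℚ./ 1)} {u = ℚ.toℚᵘ (j ℚ./ 1)}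
         (ℚ.toℚᵘ-fromℚᵘ (ℚᵘ.mkℚᵘ i 0)) (ℚ.toℚᵘ-fromℚᵘ (ℚᵘ.mkℚᵘ j 0)) ⟨
  ℚ.toℚᵘ (i ℚ./ 1) ℚᵘ.* ℚ.toℚᵘ (j ℚ./ 1)
    ≈⟨ ℚ.toℚᵘ-homo-* (i ℚ./ 1) (j ℚ./ 1) ⟨
  ℚ.toℚᵘ ((i ℚ./ 1) ℚ.* (j ℚ./ 1))                         ∎)
  where open ℚᵘ.≃-Reasoning

/1-cancel-< : ∀ {i j} → i ℚ./ 1 ℚ.< j ℚ./ 1 → i ℤ.< j
/1-cancel-< {i} {j} p = ≡.subst₂ ℤ._<_ (ℤ.*-identityʳ i) (ℤ.*-identityʳ j) (ℚᵘ.drop-*<*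
  (ℚᵘ.<-respˡ-≃ (ℚ.toℚᵘ-fromℚᵘ (ℚᵘ.mkℚᵘ i 0)) (ℚᵘ.<-respʳ-≃ (ℚ.toℚᵘ-fromℚᵘ (ℚᵘ.mkℚᵘ j 0)) (ℚ.toℚᵘ-mono-< p))))

module OrderedFieldProperties (𝔽 : OrderedField) where
  open OrderedField 𝔽

  private
    R : ACR.AlmostCommutativeRing 0ℓ 0ℓ
    R = ACR.fromCommutativeRing commutativeRing

    morphism : ℚ.+-*-rawRing ACR.-Raw-AlmostCommutative⟶ R
    morphism = record { ⟦_⟧ = ι ; +-homo = ι-+ ; *-homo = ι-* ; -‿homo = ι-‿
                      ; 0-homo = ι-0 ; 1-homo = ι-1 }

    _coeff≟_ : WeaklyDecidable (ACR.Induced-equivalence morphism)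
    p coeff≟ q with p ℚ.≟ q
    ... | yes ≡.refl = just refl
    ... | no _       = nothing

  module Solver = RingSolver ℚ.+-*-rawRing R morphism _coeff≟_
  open Solver public
  open import Relation.Binary.Reasoning.Setoid setoid

  infix 4 _≤_ _♯_
  _≤_ : Rel Carrier 0ℓ
  x ≤ y = ¬ y < x

  _♯_ : Rel Carrier 0ℓ
  x ♯ y = x < y ⊎ y < x

  :0 :1 :2 : ∀ {n} → Polynomial n
  :0 = con 0ℚ
  :1 = con 1ℚ
  :2 = con (ℤ.+ 2 ℚ./ 1)

  -- Inequalities are proved by certificates: a visibly positive `s` is exhibited and the identity
  -- `s ≈ y - x` is left to the ring solver, modulo equational hypotheses when it goes through
  -- `combine₁` to `combine₃`.
  <-by : ∀ {s x y} → 𝟘 < s → s ≈ y - x → x < y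
  <-by {s} {x} {y} 0<s s≈ = <-resp
    (solve 1 (λ x → :0 :+ x := x) refl x)
    (trans (+-congʳ s≈) (solve 2 (λ x y → y :- x :+ x := y) refl x y))
    (+-monoˡ-< x 0<s)

  <⇒0< : ∀ {x y} → x < y → 𝟘 < y - x
  <⇒0< {x} {y} x<y = <-resp (solve 1 (λ x → x :- x := :0) refl x) refl (+-monoˡ-< (- x) x<y)

  <-respʳ : ∀ {x y y′} → y ≈ y′ → x < y → x < y′
  <-respʳ = <-resp refl

  <-respˡ : ∀ {x x′ y} → x ≈ x′ → x < y → x′ < y
  <-respˡ e = <-resp e refl

  ≤-resp : ∀ {x x′ y y′} → x ≈ x′ → y ≈ y′ → x ≤ y → x′ ≤ y′
  ≤-resp e e′ x≤y y′<x′ = x≤y (<-resp (sym e′) (sym e) y′<x′)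

  ≤-respʳ : ∀ {x y y′} → y ≈ y′ → x ≤ y → x ≤ y′
  ≤-respʳ = ≤-resp refl

  ≤-by : ∀ {s x y} → 𝟘 ≤ s → s ≈ y - x → x ≤ y
  ≤-by {s} {x} {y} 0≤s s≈ y<x = 0≤s (<-by (<⇒0< y<x)
    (trans (solve 2 (λ x y → x :- y := :0 :- (y :- x)) refl x y) (+-congˡ (-‿cong (sym s≈)))))

  ≤⇒0≤ : ∀ {x y} → x ≤ y → 𝟘 ≤ y - x
  ≤⇒0≤ {x} {y} x≤y y-x<0 = x≤y
    (<-by (<⇒0< y-x<0) (solve 2 (λ x y → :0 :- (y :- x) := x :- y) refl x y))

  <⇒≤ : ∀ {x y} → x < y → x ≤ y
  <⇒≤ x<y y<x = <-irrefl (<-trans x<y y<x)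

  ≈⇒≤ : ∀ {x y} → x ≈ y → x ≤ y
  ≈⇒≤ x≈y y<x = <-irrefl (<-respʳ x≈y y<x)

  ≤-refl : ∀ {x} → x ≤ x
  ≤-refl = <-irrefl

  ≤-antisym : ∀ {x y} → x ≤ y → y ≤ x → x ≈ y
  ≤-antisym x≤y y≤x = <-tight y≤x x≤y

  <-≤-trans : ∀ {x y z} → x < y → y ≤ z → x < z
  <-≤-trans {z = z} x<y y≤z with <-cotrans z x<y
  ... | inj₁ x<z = x<z
  ... | inj₂ z<y = ⊥-elim (y≤z z<y)

  ≤-<-trans : ∀ {x y z} → x ≤ y → y < z → x < z
  ≤-<-trans {x = x} x≤y y<z with <-cotrans x y<z
  ... | inj₁ y<x = ⊥-elim (x≤y y<x)
  ... | inj₂ x<z = x<z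

  ≤-trans : ∀ {x y z} → x ≤ y → y ≤ z → x ≤ z
  ≤-trans x≤y y≤z z<x = x≤y (≤-<-trans y≤z z<x)

  +-mono-≤ : ∀ {x y u v} → x ≤ y → u ≤ v → x + u ≤ y + v
  +-mono-≤ {x} {y} {u} {v} x≤y u≤v y+v<x+u with <-cotrans (y + u) y+v<x+u
  ... | inj₁ p = u≤v (<-by (<⇒0< p) (solve 3 (λ y u v → y :+ u :- (y :+ v) := u :- v) refl y u v))
  ... | inj₂ p = x≤y (<-by (<⇒0< p) (solve 3 (λ x y u → x :+ u :- (y :+ u) := x :- y) refl x y u))

  +-mono-<-≤ : ∀ {x y u v} → x < y → u ≤ v → x + u < y + v
  +-mono-<-≤ {x} {y} {u} {v} x<y u≤v = <-≤-trans (+-monoˡ-< u x<y) (+-mono-≤ ≤-refl u≤v)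

  0+0 : 𝟘 + 𝟘 ≈ 𝟘
  0+0 = solve 0 (:0 :+ :0 := :0) refl

  +-pos-≥0 : ∀ {x y} → 𝟘 < x → 𝟘 ≤ y → 𝟘 < x + y
  +-pos-≥0 0<x 0≤y = <-respˡ 0+0 (+-mono-<-≤ 0<x 0≤y)

  +-≥0 : ∀ {x y} → 𝟘 ≤ x → 𝟘 ≤ y → 𝟘 ≤ x + y
  +-≥0 0≤x 0≤y = ≤-resp 0+0 refl (+-mono-≤ 0≤x 0≤y)

  +-pos : ∀ {x y} → 𝟘 < x → 𝟘 < y → 𝟘 < x + y
  +-pos 0<x 0<y = +-pos-≥0 0<x (<⇒≤ 0<y)

  -- The factors cannot be compared with zero. If the product were negative, a positive `x` would
  -- force `y ≈ 𝟘` by tightness, and an `x` that is not positive would satisfy `x ≈ 𝟘`; either way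
  -- the product vanishes.
  *-≥0 : ∀ {x y} → 𝟘 ≤ x → 𝟘 ≤ y → 𝟘 ≤ x * y
  *-≥0 {x} {y} 0≤x 0≤y xy<0 = ¬0<x 0<x
    where
    vanish : ∀ {u v} → u ≈ 𝟘 → 𝟘 ≤ u * v
    vanish {u} {v} u≈0 = ≈⇒≤ (sym (trans (*-congʳ u≈0) (solve 1 (λ v → :0 :* v := :0) refl v)))
    ¬0<x : ¬ 𝟘 < x
    ¬0<x 0<x = vanish (<-tight (λ y<0 → 0≤y y<0) (λ 0<y → <-irrefl (<-trans xy<0 (*-pos 0<x 0<y))))
      (<-respˡ (*-comm x y) xy<0)
    0<x : 𝟘 < x
    0<x = ⊥-elim (vanish (<-tight 0≤x ¬0<x) xy<0)

  0<1 : 𝟘 < 𝟙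
  0<1 = ι-mono-< (ℚ.positive⁻¹ 1ℚ)

  ι-pos : ∀ q → .{{ℚ.Positive q}} → 𝟘 < ι q
  ι-pos q = ι-mono-< (ℚ.positive⁻¹ q)

  inv-inverseˡ : ∀ x (0<x : 𝟘 < x) → inv x 0<x * x ≈ 𝟙
  inv-inverseˡ x 0<x = trans (*-comm _ _) (inv-inverseʳ x 0<x)

  inv-cancel : ∀ {x} (0<x : 𝟘 < x) y → inv x 0<x * (x * y) ≈ y
  inv-cancel {x} 0<x y = begin
    inv x 0<x * (x * y) ≈⟨ *-assoc _ _ _ ⟨
    inv x 0<x * x * y   ≈⟨ *-congʳ (inv-inverseˡ x 0<x) ⟩
    𝟙 * y               ≈⟨ solve 1 (λ y → :1 :* y := y) refl y ⟩
    y                   ∎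

  pos-cancelˡ : ∀ {x y} → 𝟘 < x → 𝟘 < x * y → 𝟘 < y
  pos-cancelˡ {x} {y} 0<x 0<xy = <-respʳ (inv-cancel 0<x y) (*-pos (inv-pos x 0<x) 0<xy)

  ≥0-cancelˡ : ∀ {x y} → 𝟘 < x → 𝟘 ≤ x * y → 𝟘 ≤ y
  ≥0-cancelˡ {x} {y} 0<x 0≤xy = ≤-respʳ (inv-cancel 0<x y) (*-≥0 (<⇒≤ (inv-pos x 0<x)) 0≤xy)

  pos-cancelʳ : ∀ {x y} → 𝟘 < y → 𝟘 < x * y → 𝟘 < x
  pos-cancelʳ 0<y 0<xy = pos-cancelˡ 0<y (<-respʳ (*-comm _ _) 0<xy)

  ≥0-cancelʳ : ∀ {x y} → 𝟘 < y → 𝟘 ≤ x * y → 𝟘 ≤ x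
  ≥0-cancelʳ 0<y 0≤xy = ≥0-cancelˡ 0<y (≤-respʳ (*-comm _ _) 0≤xy)

  zero-cancelʳ : ∀ {x y} → y ♯ 𝟘 → x * y ≈ 𝟘 → x ≈ 𝟘
  zero-cancelʳ {x} {y} (inj₂ 0<y) xy≈0 = ≤-antisym
    (≤-by (≥0-cancelʳ {𝟘 - x} 0<y (≈⇒≤ (sym xy≈0′))) refl)
    (≥0-cancelʳ 0<y (≈⇒≤ (sym xy≈0)))
    where
    xy≈0′ : (𝟘 - x) * y ≈ 𝟘
    xy≈0′ = trans (solve 2 (λ x y → (:0 :- x) :* y := :0 :- x :* y) refl x y)
      (trans (+-congˡ (-‿cong xy≈0)) (solve 0 (:0 :- :0 := :0) refl))
  zero-cancelʳ {x} {y} (inj₁ y<0) xy≈0 = zero-cancelʳ (inj₂ (<⇒0< y<0))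
    (trans (solve 2 (λ x y → x :* (:0 :- y) := :0 :- x :* y) refl x y)
      (trans (+-congˡ (-‿cong xy≈0)) (solve 0 (:0 :- :0 := :0) refl)))

  x-y≈0⇒x≈y : ∀ {x y} → x - y ≈ 𝟘 → x ≈ y
  x-y≈0⇒x≈y {x} {y} e = begin
    x         ≈⟨ solve 2 (λ x y → x := x :- y :+ y) refl x y ⟩
    x - y + y ≈⟨ +-congʳ e ⟩
    𝟘 + y     ≈⟨ solve 1 (λ y → :0 :+ y := y) refl y ⟩
    y         ∎

  x≈y⇒x-y≈0 : ∀ {x y} → x ≈ y → x - y ≈ 𝟘
  x≈y⇒x-y≈0 {x} {y} e = trans (+-congʳ e) (solve 1 (λ y → y :- y := :0) refl y)

  ♯-respˡ : ∀ {x y z} → x ≈ y → x ♯ z → y ♯ z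
  ♯-respˡ e (inj₁ p) = inj₁ (<-respˡ e p)
  ♯-respˡ e (inj₂ p) = inj₂ (<-respʳ e p)

  -- To prove l ≈ r from hypotheses aᵢ ≈ bᵢ, exhibit l − r as a combination of
  -- the differences aᵢ − bᵢ; the remaining identity is left to the ring solver.
  combine₁ : ∀ {l r a b} c → a ≈ b → l - r ≈ c * (a - b) → l ≈ r
  combine₁ c e id = x-y≈0⇒x≈y (trans id
    (trans (*-congˡ (x≈y⇒x-y≈0 e)) (solve 1 (λ c → c :* :0 := :0) refl c)))

  combine₂ : ∀ {l r a b a′ b′} c c′ → a ≈ b → a′ ≈ b′ →
             l - r ≈ c * (a - b) + c′ * (a′ - b′) → l ≈ r
  combine₂ c c′ e e′ id = x-y≈0⇒x≈y (trans id
    (trans (+-cong (*-congˡ (x≈y⇒x-y≈0 e)) (*-congˡ (x≈y⇒x-y≈0 e′)))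
      (solve 2 (λ c c′ → c :* :0 :+ c′ :* :0 := :0) refl c c′)))

  combine₃ : ∀ {l r a b a′ b′ a″ b″} c c′ c″ → a ≈ b → a′ ≈ b′ → a″ ≈ b″ →
             l - r ≈ c * (a - b) + c′ * (a′ - b′) + c″ * (a″ - b″) → l ≈ r
  combine₃ c c′ c″ e e′ e″ id = x-y≈0⇒x≈y (trans id
    (trans (+-cong (+-cong (*-congˡ (x≈y⇒x-y≈0 e)) (*-congˡ (x≈y⇒x-y≈0 e′))) (*-congˡ (x≈y⇒x-y≈0 e″)))
      (solve 3 (λ c c′ c″ → c :* :0 :+ c′ :* :0 :+ c″ :* :0 := :0) refl c c′ c″)))

  ♯-resp : ∀ {x y z} → y ≈ z → x ♯ y → x ♯ z
  ♯-resp e (inj₁ p) = inj₁ (<-respʳ e p)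
  ♯-resp e (inj₂ p) = inj₂ (<-respˡ e p)

  ∑ : ℕ → (ℕ → Carrier) → Carrier
  ∑ zero f    = 𝟘
  ∑ (suc n) f = ∑ n f + f n

  ∑-cong : ∀ n {f g} → (∀ i → f i ≈ g i) → ∑ n f ≈ ∑ n g
  ∑-cong zero e    = refl
  ∑-cong (suc n) e = +-cong (∑-cong n e) (e n)

  ∑-+ : ∀ n f g → ∑ n (λ i → f i + g i) ≈ ∑ n f + ∑ n g
  ∑-+ zero f g = sym 0+0
  ∑-+ (suc n) f g = trans (+-congʳ (∑-+ n f g))
    (solve 4 (λ a b c d → a :+ b :+ (c :+ d) := a :+ c :+ (b :+ d)) refl (∑ n f) (∑ n g) (f n) (g n))

  ∑-*ʳ : ∀ n f c → ∑ n (λ i → f i * c) ≈ ∑ n f * c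
  ∑-*ʳ zero f c = solve 1 (λ c → :0 := :0 :* c) refl c
  ∑-*ʳ (suc n) f c = trans (+-congʳ (∑-*ʳ n f c)) (sym (distribʳ c _ _))

  ∑-difference : ∀ n {f g d} δ → (∀ i → f i - g i ≈ δ * d i) → ∑ n f - ∑ n g ≈ δ * ∑ n d
  ∑-difference zero δ e    = solve 1 (λ δ → :0 :- :0 := δ :* :0) refl δ
  ∑-difference (suc n) {f} {g} {d} δ e = combine₂ 𝟙 𝟙 (∑-difference n δ e) (e n)
    (solve 7 (λ F G f g D d δ → F :+ f :- (G :+ g) :- δ :* (D :+ d) :=
        :1 :* (F :- G :- δ :* D) :+ :1 :* (f :- g :- δ :* d))
      refl (∑ n f) (∑ n g) (f n) (g n) (∑ n d) (d n) δ)

  ∑-mono-≤ : ∀ n {f g} → (∀ i → i ℕ.< n → f i ≤ g i) → ∑ n f ≤ ∑ n g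
  ∑-mono-≤ zero f≤g    = ≤-refl
  ∑-mono-≤ (suc n) f≤g = +-mono-≤
    (∑-mono-≤ n (λ i i<n → f≤g i (ℕ.m<n⇒m<1+n i<n))) (f≤g n ℕ.≤-refl)

  ∑-≥0 : ∀ n {f} → (∀ i → 𝟘 ≤ f i) → 𝟘 ≤ ∑ n f
  ∑-≥0 zero 0≤f    = ≤-refl
  ∑-≥0 (suc n) 0≤f = +-≥0 (∑-≥0 n 0≤f) (0≤f n)

  term≤∑ : ∀ {n i f} → (∀ i → 𝟘 ≤ f i) → i ℕ.< n → f i ≤ ∑ n f
  term≤∑ {suc n} {i} {f} 0≤f i<1+n with ℕ.m≤n⇒m<n∨m≡n (ℕ.s≤s⁻¹ i<1+n)
  ... | inj₁ i<n    = ≤-trans (term≤∑ {n} 0≤f i<n)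
    (≤-by (0≤f n) (solve 2 (λ a b → b := a :+ b :- a) refl (∑ n f) (f n)))
  ... | inj₂ ≡.refl = ≤-by (∑-≥0 n 0≤f) (solve 2 (λ a b → a := a :+ b :- b) refl (∑ n f) (f n))

  fromNat : ℕ → Carrier
  fromNat n = ι (ℤ.+ n ℚ./ 1)

  fromNat-suc : ∀ n → fromNat (suc n) ≈ fromNat n + 𝟙
  fromNat-suc n = trans (reflexive (≡.cong (λ m → ι (ℤ.+ m ℚ./ 1)) (ℕ.+-comm 1 n)))
    (trans (reflexive (≡.cong ι (/1-+ (ℤ.+ n) ℤ.1ℤ))) (ι-+ _ _))

  ∑-const : ∀ n c → ∑ n (λ _ → c) ≈ fromNat n * c
  ∑-const zero c    = solve 1 (λ c → :0 := :0 :* c) refl c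
  ∑-const (suc n) c = trans (+-congʳ (∑-const n c))
    (trans (solve 2 (λ m c → m :* c :+ c := (m :+ :1) :* c) refl (fromNat n) c)
           (*-congʳ (sym (fromNat-suc n))))

  fromNat-+ : ∀ m n → fromNat (m ℕ.+ n) ≈ fromNat m + fromNat n
  fromNat-+ m n = trans (reflexive (≡.cong ι (/1-+ (ℤ.+ m) (ℤ.+ n)))) (ι-+ _ _)

  fromNat-* : ∀ m n → fromNat (m ℕ.* n) ≈ fromNat m * fromNat n
  fromNat-* m n = trans
    (reflexive (≡.cong ι (≡.trans (≡.cong (ℚ._/ 1) (ℤ.pos-* m n)) (/1-* (ℤ.+ m) (ℤ.+ n))))) (ι-* _ _)

  fromNat-≥0 : ∀ n → 𝟘 ≤ fromNat n
  fromNat-≥0 zero    = ≤-refl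
  fromNat-≥0 (suc n) = ≤-respʳ (sym (fromNat-suc n)) (+-≥0 (fromNat-≥0 n) (<⇒≤ 0<1))

  fromNat-mono-≤ : ∀ {m n} → m ℕ.≤ n → fromNat m ≤ fromNat n
  fromNat-mono-≤ {n = n} ℕ.z≤n = fromNat-≥0 n
  fromNat-mono-≤ (ℕ.s≤s {m} {n} m≤n) = ≤-resp (sym (fromNat-suc m)) (sym (fromNat-suc n))
    (+-mono-≤ (fromNat-mono-≤ m≤n) ≤-refl)

  *-monoʳ-≤ : ∀ {x y z} → 𝟘 ≤ z → x ≤ y → x * z ≤ y * z
  *-monoʳ-≤ {x} {y} {z} 0≤z x≤y = ≤-by (*-≥0 (≤⇒0≤ x≤y) 0≤z)
    (solve 3 (λ x y z → (y :- x) :* z := y :* z :- x :* z) refl x y z)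

  *-monoˡ-≤ : ∀ {x y z} → 𝟘 ≤ z → x ≤ y → z * x ≤ z * y
  *-monoˡ-≤ 0≤z x≤y = ≤-resp (*-comm _ _) (*-comm _ _) (*-monoʳ-≤ 0≤z x≤y)

  ι-cancel-< : ∀ {p q} → ι p < ι q → p ℚ.< q
  ι-cancel-< {p} {q} ιp<ιq with ℚ.<-cmp p q
  ... | tri< p<q _ _    = p<q
  ... | tri≈ _ ≡.refl _ = ⊥-elim (<-irrefl ιp<ιq)
  ... | tri> _ _ q<p    = ⊥-elim (<-irrefl (<-trans ιp<ιq (ι-mono-< q<p)))

  no-integer-between : ∀ n {x} → fromNat n < x → x < fromNat (suc n) → ∀ i → ¬ x ≈ ι (i ℚ./ 1)
  no-integer-between n n<x x<1+n i x≈i = ℤ.<-irrefl ≡.refl (ℤ.<-≤-trans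
    (/1-cancel-< {i} {ℤ.+ suc n} (ι-cancel-< (<-respˡ x≈i x<1+n)))
    (ℤ.i<j⇒suc[i]≤j (/1-cancel-< {ℤ.+ n} {i} (ι-cancel-< (<-respʳ x≈i n<x)))))

  fromNat-suc-pos : ∀ n → 𝟘 < fromNat (suc n)
  fromNat-suc-pos n = <-respʳ (trans (+-comm _ _) (sym (fromNat-suc n))) (+-pos-≥0 0<1 (fromNat-≥0 n))

  O[1/n]⇒small : ∀ W ε → 𝟘 < ε → ∃[ n ] (∀ {w} → fromNat (suc n) * w ≤ W → w < ε)
  O[1/n]⇒small W ε 0<ε with archimedean (W * inv ε 0<ε)
  -- With `N₁ = N + 1`, the certificate is `N₁ (ε - w) = ε (N - W/ε) + ε + (W - N₁ w)`.
  ... | n , W/ε<n = n , λ {w} nw≤W → <-by (pos-cancelˡ (fromNat-suc-pos n) (<-respʳ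
    (combine₂ (- W) (- ε) (inv-inverseʳ ε 0<ε) (fromNat-suc n) (solve 6 (λ W ε i N N₁ w →
      ε :* (N :- W :* i) :+ ε :+ (W :- N₁ :* w) :- N₁ :* (ε :- w) :=
      (:- W) :* (ε :* i :- :1) :+ (:- ε) :* (N₁ :- (N :+ :1)))
      refl W ε (inv ε 0<ε) (fromNat n) (fromNat (suc n)) w))
    (+-pos-≥0 (+-pos (*-pos 0<ε (<⇒0< W/ε<n)) 0<ε) (≤⇒0≤ nw≤W)))) refl

-- Finite and infinite arms, and the function whose root is sought

data Length : Set where
  fin : ℕ → Length
  ∞   : Length

AtLeast : ℕ → Length → Set
AtLeast N (fin a) = N ℕ.≤ a
AtLeast N ∞       = ⊤

module Branches (𝔽 : OrderedField) where
  open OrderedField 𝔽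
  open OrderedFieldProperties 𝔽

  𝟚 : Carrier
  𝟚 = fromNat 2

  -- The contribution of a pendant path to the diagonal at its base, after its
  -- vertices have been eliminated from A − ν.
  ArmVal : Carrier → Length → Carrier → Set
  ArmVal ν (fin zero)    r = r ≈ 𝟘
  ArmVal ν (fin (suc a)) r = ∃[ s ] ArmVal ν (fin a) s × r * (ν - s) ≈ 𝟙
  ArmVal ν ∞             r = 𝟘 < r × r < 𝟙 × r * (ν - r) ≈ 𝟙

  1<ν-s : ∀ {ν s} → 𝟚 < ν → s < 𝟙 → 𝟙 < ν - s
  1<ν-s {ν} {s} 2<ν s<1 = <-by (+-pos (<⇒0< 2<ν) (<⇒0< s<1))
    (solve 2 (λ ν s → ν :- :2 :+ (:1 :- s) := ν :- s :- :1) refl ν s)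

  0<ν-s : ∀ {ν s} → 𝟚 < ν → s < 𝟙 → 𝟘 < ν - s
  0<ν-s 2<ν s<1 = <-trans 0<1 (1<ν-s 2<ν s<1)

  -- Induction along the arm: `𝟚 < ν` and `s < 𝟙` give `𝟙 < ν - s`, so the inverse is again below 1.
  -- This keeps all later denominators positive.
  arm-bounds : ∀ {ν} → 𝟚 < ν → ∀ a {r} → ArmVal ν a r → 𝟘 ≤ r × r < 𝟙
  arm-bounds 2<ν (fin zero) r≈0 = ≈⇒≤ (sym r≈0) , <-respˡ (sym r≈0) 0<1
  arm-bounds {ν} 2<ν (fin (suc a)) {r} (s , armₛ , r-inv) with arm-bounds 2<ν (fin a) armₛ
  ... | _ , s<1 = <⇒≤ (pos-cancelʳ (0<ν-s 2<ν s<1) (<-respʳ (sym r-inv) 0<1)) ,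
    <-by (pos-cancelʳ (0<ν-s 2<ν s<1) (<-respʳ 1-r (<⇒0< (1<ν-s 2<ν s<1)))) refl
    where
    1-r : ν - s - 𝟙 ≈ (𝟙 - r) * (ν - s)
    1-r = combine₁ 𝟙 r-inv (solve 3 (λ ν s r →
      ν :- s :- :1 :- (:1 :- r) :* (ν :- s) := :1 :* (r :* (ν :- s) :- :1)) refl ν s r)
  arm-bounds 2<ν ∞ (0<r , r<1 , _) = <⇒≤ 0<r , r<1

  -- Two inverses satisfy `r - r′ = r r′ ((ν′ - s′) - (ν - s))`, which is `(ν′ - ν) r r′ (1 + R)`
  -- when `R` is the quotient for `s`. For an infinite arm `s` is `r` itself, and solving for the
  -- difference divides by `𝟙 - r * r′`.
  arm-difference : ∀ {ν ν′} → 𝟚 < ν → 𝟚 < ν′ → ∀ a {r r′} → ArmVal ν a r → ArmVal ν′ a r′ →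
                   ∃[ R ] 𝟘 ≤ R × r - r′ ≈ (ν′ - ν) * R
  arm-difference {ν} {ν′} 2<ν 2<ν′ (fin zero) {r} {r′} r≈0 r′≈0 = 𝟘 , ≤-refl ,
    combine₂ 𝟙 (- 𝟙) r≈0 r′≈0 (solve 4 (λ r r′ ν ν′ →
      r :- r′ :- (ν′ :- ν) :* :0 := :1 :* (r :- :0) :+ (:- :1) :* (r′ :- :0)) refl r r′ ν ν′)
  arm-difference {ν} {ν′} 2<ν 2<ν′ (fin (suc a)) {r} {r′} A@(s , armₛ , e) A′@(s′ , armₛ′ , e′)
    with arm-difference 2<ν 2<ν′ (fin a) armₛ armₛ′
  ... | R , 0≤R , d = r * r′ * (𝟙 + R) ,
    *-≥0 (*-≥0 (proj₁ (arm-bounds 2<ν (fin (suc a)) A)) (proj₁ (arm-bounds 2<ν′ (fin (suc a)) A′)))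
         (+-≥0 (<⇒≤ 0<1) 0≤R) ,
    combine₃ (- r) r′ (r * r′) e′ e d (solve 7 (λ r r′ ν ν′ s s′ R →
      r :- r′ :- (ν′ :- ν) :* (r :* r′ :* (:1 :+ R)) :=
      (:- r) :* (r′ :* (ν′ :- s′) :- :1) :+ r′ :* (r :* (ν :- s) :- :1)
        :+ r :* r′ :* (s :- s′ :- (ν′ :- ν) :* R)) refl r r′ ν ν′ s s′ R)
  arm-difference {ν} {ν′} 2<ν 2<ν′ ∞ {r} {r′} (0<r , r<1 , e) (0<r′ , r′<1 , e′) =
    r * r′ * i , <⇒≤ (*-pos (*-pos 0<r 0<r′) (inv-pos _ 0<1-rr′)) ,
    combine₃ (- (r * i)) (r′ * i) (- (r - r′)) e′ e (inv-inverseʳ _ 0<1-rr′)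
      (solve 5 (λ r r′ ν ν′ i → r :- r′ :- (ν′ :- ν) :* (r :* r′ :* i) :=
        (:- (r :* i)) :* (r′ :* (ν′ :- r′) :- :1) :+ r′ :* i :* (r :* (ν :- r) :- :1)
        :+ (:- (r :- r′)) :* ((:1 :- r :* r′) :* i :- :1)) refl r r′ ν ν′ i)
    where
    0<1-rr′ : 𝟘 < 𝟙 - r * r′
    0<1-rr′ = <-respʳ (solve 2 (λ r r′ → (:1 :- r) :+ r :* (:1 :- r′) := :1 :- r :* r′) refl r r′)
      (+-pos (<⇒0< r<1) (*-pos 0<r (<⇒0< r′<1)))
    i : Carrier
    i = inv _ 0<1-rr′

  -- Elimination data for the tree whose centre carries k branches: the i-th
  -- branch is a path of arms h i and h (k + i) joined to the centre by an inner
  -- vertex, and a last arm h (k + k) starts at the centre itself.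
  record Val (k : ℕ) (h : ℕ → Length) (ν : Carrier) : Set where
    field
      r     : ℕ → Carrier
      arm   : ∀ i → ArmVal ν (h i) (r i)
      m     : ℕ → Carrier
      m-pos : ∀ i → 𝟘 < m i
      m-inv : ∀ i → m i * (ν - r i - r (k ℕ.+ i)) ≈ 𝟙

    value : Carrier
    value = ν - r (k ℕ.+ k) - ∑ k m

  open Val

  -- One computation for two kinds of change, both proportional to `δ`: moving `ν` with the lengths
  -- fixed (`N` is 1), and shortening an arm with `ν` fixed (`N` is 0).
  value-difference : ∀ {k h h′ ν ν′} (V : Val k h ν) (V′ : Val k h′ ν′) δ {N} {R : ℕ → Carrier} →
    ν′ - ν ≈ δ * N → (∀ i → r V i - r V′ i ≈ δ * R i) →
    value V′ - value V ≈
      δ * (N + R (k ℕ.+ k) + ∑ k (λ i → m V i * m V′ i * (N + R i + R (k ℕ.+ i))))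
  value-difference {k} {ν = ν} {ν′} V V′ δ {N} {R} dν dr =
    combine₃ 𝟙 𝟙 𝟙 dν (dr (k ℕ.+ k)) (∑-difference k δ dm)
      (solve 10 (λ ν ν′ c c′ M M′ δ N C D →
        ν′ :- c′ :- M′ :- (ν :- c :- M) :- δ :* (N :+ C :+ D) :=
        :1 :* (ν′ :- ν :- δ :* N) :+ :1 :* (c :- c′ :- δ :* C) :+ :1 :* (M :- M′ :- δ :* D))
        refl ν ν′ (r V (k ℕ.+ k)) (r V′ (k ℕ.+ k)) (∑ k (m V)) (∑ k (m V′)) δ N (R (k ℕ.+ k)) _)
    where
    dm : ∀ i → m V i - m V′ i ≈ δ * (m V i * m V′ i * (N + R i + R (k ℕ.+ i)))
    dm i = combine₃ (- m V i) (m V′ i) (m V i * m V′ i) (m-inv V′ i) (m-inv V i) dX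
      (solve 6 (λ m m′ X X′ δ Y → m :- m′ :- δ :* (m :* m′ :* Y) :=
        (:- m) :* (m′ :* X′ :- :1) :+ m′ :* (m :* X :- :1) :+ m :* m′ :* (X′ :- X :- δ :* Y))
        refl (m V i) (m V′ i) X X′ δ Y)
      where
      X = ν - r V i - r V (k ℕ.+ i)
      X′ = ν′ - r V′ i - r V′ (k ℕ.+ i)
      Y = N + R i + R (k ℕ.+ i)
      dX : X′ - X ≈ δ * Y
      dX = combine₃ 𝟙 𝟙 𝟙 dν (dr i) (dr (k ℕ.+ i))
        (solve 10 (λ ν ν′ s s′ t t′ δ N S T →
          ν′ :- s′ :- t′ :- (ν :- s :- t) :- δ :* (N :+ S :+ T) :=
          :1 :* (ν′ :- ν :- δ :* N) :+ :1 :* (s :- s′ :- δ :* S) :+ :1 :* (t :- t′ :- δ :* T))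
          refl ν ν′ (r V i) (r V′ i) (r V (k ℕ.+ i)) (r V′ (k ℕ.+ i)) δ N (R i) (R (k ℕ.+ i)))

  -- An exact quotient rather than a mere inequality: `𝟙 ≤ K` separates roots, while the identity
  -- shows that equal arguments give equal values and measures how far a root moves.
  value-expands : ∀ {k h ν ν′} → 𝟚 < ν → 𝟚 < ν′ → (V : Val k h ν) (V′ : Val k h ν′) →
                  ∃[ K ] 𝟙 ≤ K × value V′ - value V ≈ (ν′ - ν) * K
  value-expands {k} {h} {ν} {ν′} 2<ν 2<ν′ V V′ =
    𝟙 + R (k ℕ.+ k) + S ,
    ≤-by (+-≥0 (0≤R _) (∑-≥0 k λ i → *-≥0 (*-≥0 (<⇒≤ (m-pos V i)) (<⇒≤ (m-pos V′ i)))
      (+-≥0 (+-≥0 (<⇒≤ 0<1) (0≤R _)) (0≤R _))))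
      (solve 2 (λ R S → R :+ S := :1 :+ R :+ S :- :1) refl (R (k ℕ.+ k)) S) ,
    value-difference V V′ (ν′ - ν) (solve 2 (λ ν ν′ → ν′ :- ν := (ν′ :- ν) :* :1) refl ν ν′)
      (λ i → proj₂ (proj₂ (D i)))
    where
    D : ∀ i → _
    D i = arm-difference 2<ν 2<ν′ (h i) (arm V i) (arm V′ i)
    R : ℕ → Carrier
    R i = proj₁ (D i)
    0≤R : ∀ i → 𝟘 ≤ R i
    0≤R i = proj₁ (proj₂ (D i))
    S : Carrier
    S = ∑ k (λ i → m V i * m V′ i * (𝟙 + R i + R (k ℕ.+ i)))

  finite-arm : ∀ {ν} → 𝟚 < ν → ∀ a → ∃[ r ] ArmVal ν (fin a) r
  finite-arm 2<ν zero    = 𝟘 , refl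
  finite-arm 2<ν (suc a) = inv _ 0<ν-s′ , proj₁ rec , proj₂ rec , inv-inverseˡ _ 0<ν-s′
    where
    rec = finite-arm 2<ν a
    0<ν-s′ = 0<ν-s 2<ν (proj₂ (arm-bounds 2<ν (fin a) (proj₂ rec)))

  denominator-pos : ∀ {ν r s} → 𝟚 < ν → r < 𝟙 → s < 𝟙 → 𝟘 < ν - r - s
  denominator-pos {ν} {r} {s} 2<ν r<1 s<1 = <-respʳ
    (solve 3 (λ ν r s → ν :- :2 :+ (:1 :- r :+ (:1 :- s)) := ν :- r :- s) refl ν r s)
    (+-pos (<⇒0< 2<ν) (+-pos (<⇒0< r<1) (<⇒0< s<1)))

  module _ {ν} (2<ν : 𝟚 < ν) (k : ℕ) (h : ℕ → Length) (arms : ∀ i → ∃[ r ] ArmVal ν (h i) r) where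
    denominator : ∀ i → 𝟘 < ν - proj₁ (arms i) - proj₁ (arms (k ℕ.+ i))
    denominator i = denominator-pos 2<ν (proj₂ (arm-bounds 2<ν (h i) (proj₂ (arms i))))
      (proj₂ (arm-bounds 2<ν (h (k ℕ.+ i)) (proj₂ (arms (k ℕ.+ i)))))

    mkVal : Val k h ν
    mkVal = record
      { r     = λ i → proj₁ (arms i)
      ; arm   = λ i → proj₂ (arms i)
      ; m     = λ i → inv _ (denominator i)
      ; m-pos = λ i → inv-pos _ (denominator i)
      ; m-inv = λ i → inv-inverseˡ _ (denominator i)
      }

  Finite : Length → Set
  Finite a = ∃[ n ] a ≡ fin n

  finite-val : ∀ {ν} → 𝟚 < ν → ∀ k h → (∀ i → Finite (h i)) → Val k h ν
  finite-val {ν} 2<ν k h finite = mkVal 2<ν k h (λ i → armOf (finite i))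
    where
    armOf : ∀ {a} → Finite a → ∃[ r ] ArmVal ν a r
    armOf (n , ≡.refl) = finite-arm 2<ν n

  -- Recovering t from ν would need a square root, so t is the datum and `ν` is derived. At a
  -- rational t everything below stays rational, infinite arms included.
  record Point : Set where
    field
      t   : Carrier
      1<t : 𝟙 < t

    0<t : 𝟘 < t
    0<t = <-trans 0<1 1<t

    q : Carrier
    q = inv t 0<t

    tq≈1 : t * q ≈ 𝟙
    tq≈1 = inv-inverseʳ t 0<t

    0<q : 𝟘 < q
    0<q = inv-pos t 0<t

    q<1 : q < 𝟙
    q<1 = <-by (*-pos 0<q (<⇒0< 1<t)) (combine₁ 𝟙 tq≈1
      (solve 2 (λ t q → q :* (t :- :1) :- (:1 :- q) := :1 :* (t :* q :- :1)) refl t q))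

    q<t : q < t
    q<t = <-trans q<1 1<t

    ν : Carrier
    ν = t + q

    2<ν : 𝟚 < ν
    2<ν = <-by (*-pos 0<q (*-pos (<⇒0< 1<t) (<⇒0< 1<t))) (combine₁ (t - 𝟚) tq≈1
      (solve 2 (λ t q → q :* ((t :- :1) :* (t :- :1)) :- (t :+ q :- :2) :=
        (t :- :2) :* (t :* q :- :1)) refl t q))

    arms : ∀ a → ∃[ r ] ArmVal ν a r
    arms (fin a) = finite-arm 2<ν a
    arms ∞       = q , 0<q , q<1 ,
      trans (solve 2 (λ t q → q :* (t :+ q :- q) := t :* q) refl t q) tq≈1

    val : ∀ k h → Val k h ν
    val k h = mkVal 2<ν k h (λ i → arms (h i))

    -- The equation `r * (ν - r) ≈ 𝟙` has the roots `q` and `t`; the bound `r < 𝟙` built into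
    -- `ArmVal` excludes `t`.
    ∞-arm : ∀ {r} → ArmVal ν ∞ r → r ≈ q
    ∞-arm {r} (0<r , r<1 , e) = x-y≈0⇒x≈y (zero-cancelʳ {y = t - r} (inj₂ (<⇒0< (<-trans r<1 1<t)))
      (combine₂ 𝟙 (- 𝟙) e tq≈1 (solve 3 (λ t q r → (r :- q) :* (t :- r) :- :0 :=
        :1 :* (r :* (t :+ q :- r) :- :1) :+ (:- :1) :* (t :* q :- :1)) refl t q r)))

    -- If `d` is the shortfall of an arm, that of the next longer arm is `q d / (t + d)`, and then
    -- `q - (A + 1) d′ = q (t - A d) / (t + d)`, nonnegative because `A d ≤ q < t`. The decay is in
    -- fact geometric, but a harmonic bound suffices.
    deficit : ∀ a {r} → ArmVal ν (fin a) r → 𝟘 < q - r × fromNat (suc a) * (q - r) ≤ q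
    deficit zero {r} r≈0 = <-respʳ q≈q-r 0<q ,
      ≈⇒≤ (trans (*-congˡ (sym q≈q-r)) (solve 1 (λ q → :1 :* q := q) refl q))
      where
      q≈q-r : q ≈ q - r
      q≈q-r = combine₁ 𝟙 r≈0 (solve 2 (λ q r → q :- (q :- r) := :1 :* (r :- :0)) refl q r)
    deficit (suc a) {r} (s , armₛ , e) with deficit a armₛ
    ... | 0<d , Ad≤q = pos-cancelʳ 0<t+d (<-respʳ (sym step) (*-pos 0<q 0<d)) ,
      ≤-by (≥0-cancelʳ 0<t+d (≤-respʳ (sym bound) (*-≥0 (<⇒≤ 0<q) (≤⇒0≤ (≤-trans Ad≤q (<⇒≤ q<t)))))) refl
      where
      A : Carrier
      A = fromNat (suc a)
      0<t+d : 𝟘 < t + (q - s)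
      0<t+d = +-pos 0<t 0<d
      step : (q - r) * (t + (q - s)) ≈ q * (q - s)
      step = combine₂ (- 𝟙) 𝟙 e tq≈1 (solve 4 (λ t q r s →
        (q :- r) :* (t :+ (q :- s)) :- q :* (q :- s) :=
        (:- :1) :* (r :* (t :+ q :- s) :- :1) :+ :1 :* (t :* q :- :1)) refl t q r s)
      bound : (q - fromNat (suc (suc a)) * (q - r)) * (t + (q - s)) ≈ q * (t - A * (q - s))
      bound = combine₂ (- ((q - r) * (t + (q - s)))) (- (A + 𝟙)) (fromNat-suc (suc a)) step
        (solve 6 (λ t q r s A B → (q :- B :* (q :- r)) :* (t :+ (q :- s)) :- q :* (t :- A :* (q :- s)) :=
          (:- ((q :- r) :* (t :+ (q :- s)))) :* (B :- (A :+ :1))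
          :+ (:- (A :+ :1)) :* ((q :- r) :* (t :+ (q :- s)) :- q :* (q :- s))) refl t q r s A (fromNat (suc (suc a))))

-- Arms of this length move λ² so little from its limit that no integer is met.
depth : ℕ → ℕ
depth k = 16 ℕ.* (suc k ℕ.* suc k ℕ.* suc k)

16≤depth : ∀ k → 16 ℕ.≤ depth k
16≤depth k = ℕ.m≤m*n 16 (suc k ℕ.* suc k ℕ.* suc k)

-- Signs at the ends of the bisection interval, and nonintegrality of λ²

module Bounds (𝔽 : OrderedField) where
  open OrderedField 𝔽
  open OrderedFieldProperties 𝔽
  open Branches 𝔽
  open Val

  fromNat-depth : ∀ k → fromNat (depth k) ≈ ι (ℤ.+ 16 ℚ./ 1) * (fromNat (suc k) * fromNat (suc k) * fromNat (suc k))
  fromNat-depth k = trans (fromNat-* 16 (suc k ℕ.* suc k ℕ.* suc k)) (*-congˡ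
    (trans (fromNat-* (suc k ℕ.* suc k) (suc k)) (*-congʳ (fromNat-* (suc k) (suc k)))))

  module AtPoint (P : Point) where
    open Point P

    finite-deficit : ∀ {a r} → Finite a → ArmVal ν a r → 𝟘 < q - r
    finite-deficit (a , ≡.refl) arm = proj₁ (deficit a arm)

    deficit-≥0 : ∀ a {r} → ArmVal ν a r → 𝟘 ≤ q - r
    deficit-≥0 (fin a) A = <⇒≤ (proj₁ (deficit a A))
    deficit-≥0 ∞ A       = ≈⇒≤ (sym (x≈y⇒x-y≈0 (sym (∞-arm A))))

    deficit-≤ : ∀ N a {r} → AtLeast N a → ArmVal ν a r → fromNat N * (q - r) ≤ 𝟙
    deficit-≤ N (fin a) N≤a A = ≤-trans
      (*-monoʳ-≤ (deficit-≥0 (fin a) A) (fromNat-mono-≤ (ℕ.m≤n⇒m≤1+n N≤a)))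
      (≤-trans (proj₂ (deficit a A)) (<⇒≤ q<1))
    deficit-≤ N ∞ {r} N≤a A = ≤-trans (≈⇒≤ (trans (*-congˡ (x≈y⇒x-y≈0 (sym (∞-arm A))))
      (solve 1 (λ N → N :* :0 := :0) refl (fromNat N)))) (<⇒≤ 0<1)

    module _ {k h} (V : Val k h ν) where
      private
        K κ : Carrier
        K = fromNat k
        κ = fromNat (suc k)

        κ≈ : κ ≈ K + 𝟙
        κ≈ = fromNat-suc k

        0≤K : 𝟘 ≤ K
        0≤K = fromNat-≥0 k

        1≤κ : 𝟙 ≤ κ
        1≤κ = fromNat-mono-≤ {1} {suc k} (ℕ.s≤s ℕ.z≤n)

        0<κ : 𝟘 < κ
        0<κ = <-≤-trans 0<1 1≤κ

        e : ℕ → Carrier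
        e i = q - r V i

        0≤e : ∀ i → 𝟘 ≤ e i
        0≤e i = deficit-≥0 (h i) (arm V i)

        c : Carrier
        c = r V (k ℕ.+ k)

      -- E measures the shortfall from infinite arms: without it, balance is the
      -- equation satisfied by the limit.
      E : Carrier
      E = ∑ k (λ i → m V i * (e i + e (k ℕ.+ i)))

      -- Each denominator splits as `(t - q)` plus the shortfalls of its two arms; summing the k
      -- identities `m-inv` gives the claim.
      balance : ∑ k (m V) * (t - q) + E ≈ K
      balance = begin
        ∑ k (m V) * (t - q) + E
          ≈⟨ +-congʳ (∑-*ʳ k (m V) (t - q)) ⟨
        ∑ k (λ i → m V i * (t - q)) + E
          ≈⟨ ∑-+ k (λ i → m V i * (t - q)) (λ i → m V i * (e i + e (k ℕ.+ i))) ⟨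
        ∑ k (λ i → m V i * (t - q) + m V i * (e i + e (k ℕ.+ i)))
          ≈⟨ ∑-cong k (λ i → trans (solve 5 (λ t q m a b →
               m :* (t :- q) :+ m :* (q :- a :+ (q :- b)) := m :* (t :+ q :- a :- b))
               refl t q (m V i) (r V i) (r V (k ℕ.+ i))) (m-inv V i)) ⟩
        ∑ k (λ i → 𝟙)
          ≈⟨ ∑-const k 𝟙 ⟩
        K * 𝟙
          ≈⟨ solve 1 (λ K → K :* :1 := K) refl K ⟩
        K ∎
        where open import Relation.Binary.Reasoning.Setoid setoid

      E-≥0 : 𝟘 ≤ E
      E-≥0 = ∑-≥0 k (λ i → *-≥0 (<⇒≤ (m-pos V i)) (+-≥0 (0≤e i) (0≤e (k ℕ.+ i))))

      E-pos : 0 ℕ.< k → (∀ i → Finite (h i)) → 𝟘 < E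
      E-pos 0<k finite = <-≤-trans
        (*-pos (m-pos V 0) (+-pos (finite-deficit (finite 0) (arm V 0))
          (finite-deficit (finite (k ℕ.+ 0)) (arm V (k ℕ.+ 0)))))
        (term≤∑ (λ i → *-≥0 (<⇒≤ (m-pos V i)) (+-≥0 (0≤e i) (0≤e (k ℕ.+ i)))) 0<k)

      E-≤ : ∀ N → (∀ i → i ℕ.< k ℕ.+ k → AtLeast N (h i)) → fromNat N * E ≤ ∑ k (m V) * 𝟚
      E-≤ N deep = ≤-resp (trans (∑-*ʳ k _ (fromNat N)) (*-comm _ _)) (∑-*ʳ k (m V) 𝟚)
        (∑-mono-≤ k (λ i i<k → ≤-by
          (*-≥0 (<⇒≤ (m-pos V i)) (+-≥0
            (≤⇒0≤ (deficit-≤ N (h i) (deep i (ℕ.<-≤-trans i<k (ℕ.m≤m+n k k))) (arm V i)))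
            (≤⇒0≤ (deficit-≤ N (h (k ℕ.+ i)) (deep (k ℕ.+ i) (ℕ.+-monoʳ-< k i<k)) (arm V (k ℕ.+ i))))))
          (solve 4 (λ m a b N → m :* (:1 :- N :* a :+ (:1 :- N :* b)) := m :* :2 :- m :* (a :+ b) :* N)
            refl (m V i) (e i) (e (k ℕ.+ i)) (fromNat N))))

      -- By `balance`, the value times `t - q` is `E + (q - c) * (t - q) + (t * t - κ)`, and
      -- `t ≥ κ ≥ 1` makes the last bracket nonnegative.
      value-≥0 : κ ≤ t → 𝟘 ≤ value V
      value-≥0 κ≤t = ≥0-cancelʳ (<⇒0< q<t) (≤-respʳ eq (+-≥0 E-≥0
        (+-≥0 (*-≥0 (0≤e (k ℕ.+ k)) (≤⇒0≤ (<⇒≤ q<t)))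
          (+-≥0 (*-≥0 (≤⇒0≤ κ≤t) (+-≥0 (<⇒≤ 0<t) (<⇒≤ 0<κ)))
             (*-≥0 0≤K (<⇒≤ 0<κ))))))
        where
        eq : E + ((q - c) * (t - q) + ((t - κ) * (t + κ) + K * κ)) ≈ value V * (t - q)
        eq = combine₃ 𝟙 𝟙 (- (κ + 𝟙)) balance tq≈1 κ≈
          (solve 7 (λ E q c t κ K M →
            E :+ ((q :- c) :* (t :- q) :+ ((t :- κ) :* (t :+ κ) :+ K :* κ)) :- (t :+ q :- c :- M) :* (t :- q) :=
            :1 :* (M :* (t :- q) :+ E :- K) :+ :1 :* (t :* q :- :1) :+ (:- (κ :+ :1)) :* (κ :- (K :+ :1)))
            refl E q c t κ K (∑ k (m V)))

      -- At t = 6/5, ν (t − q + 1/8) = 3599/3600 still lies below 1.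
      value-≤0 : t ≈ ι (ℤ.+ 6 ℚ./ 5) → 0 ℕ.< k → (∀ i → i ℕ.< k ℕ.+ k → AtLeast 16 (h i)) → value V ≤ 𝟘
      value-≤0 t≈ 0<k deep = ≤-by (+-≥0 (+-≥0
          (≥0-cancelʳ (denominator-pos 2<ν (proj₂ (arm-bounds 2<ν (h 0) (arm V 0)))
                                           (proj₂ (arm-bounds 2<ν (h (k ℕ.+ 0)) (arm V (k ℕ.+ 0)))))
            (≤-respʳ (sym gap) (+-≥0 (+-≥0 (*-≥0 (*-≥0 0≤ν (<⇒≤ (ι-pos (ℤ.+ 1 ℚ./ 16)))) (≤⇒0≤ (e≤ 0 0<k+k)))
              (*-≥0 (*-≥0 0≤ν (<⇒≤ (ι-pos (ℤ.+ 1 ℚ./ 16)))) (≤⇒0≤ (e≤ (k ℕ.+ 0) (ℕ.+-monoʳ-< k 0<k)))))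
              (≤-respʳ (sym slack) (<⇒≤ (ι-pos (ℤ.+ 1 ℚ./ 3600)))))))
          (≤⇒0≤ (term≤∑ {i = 0} (λ i → <⇒≤ (m-pos V i)) 0<k)))
          (proj₁ (arm-bounds 2<ν (h (k ℕ.+ k)) (arm V (k ℕ.+ k)))))
        (solve 4 (λ ν c m M → m :- ν :+ (M :- m) :+ c := :0 :- (ν :- c :- M)) refl ν c (m V 0) (∑ k (m V)))
        where
        0<k+k : 0 ℕ.< k ℕ.+ k
        0<k+k = ℕ.<-≤-trans 0<k (ℕ.m≤m+n k k)
        0≤ν : 𝟘 ≤ ν
        0≤ν = <⇒≤ (<-trans (ι-pos (ℤ.+ 2 ℚ./ 1)) 2<ν)
        e≤ : ∀ i → i ℕ.< k ℕ.+ k → fromNat 16 * e i ≤ 𝟙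
        e≤ i i<2k = deficit-≤ 16 (h i) (deep i i<2k) (arm V i)
        :16 :1/16 :1/8 :5/6 :6/5 : ∀ {n} → Polynomial n
        :16   = con (ℤ.+ 16 ℚ./ 1)
        :1/16 = con (ℤ.+ 1 ℚ./ 16)
        :1/8  = con (ℤ.+ 1 ℚ./ 8)
        :5/6  = con (ℤ.+ 5 ℚ./ 6)
        :6/5  = con (ℤ.+ 6 ℚ./ 5)
        -- Branch 0 alone decides the sign, as the value is at most `ν - m V 0`. Its two shortfalls
        -- are at most 1/16 each, so its denominator is at most `t - q` plus 1/8.
        gap : (m V 0 - ν) * (ν - r V 0 - r V (k ℕ.+ 0)) ≈
          ν * ι (ℤ.+ 1 ℚ./ 16) * (𝟙 - fromNat 16 * e 0) +
          ν * ι (ℤ.+ 1 ℚ./ 16) * (𝟙 - fromNat 16 * e (k ℕ.+ 0)) +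
          (𝟙 - ν * (t - q) - ν * ι (ℤ.+ 1 ℚ./ 8))
        gap = combine₁ 𝟙 (m-inv V 0) (solve 5 (λ t q m a b →
          (m :- (t :+ q)) :* (t :+ q :- a :- b) :- ((t :+ q) :* :1/16 :* (:1 :- :16 :* (q :- a))
           :+ (t :+ q) :* :1/16 :* (:1 :- :16 :* (q :- b)) :+ (:1 :- (t :+ q) :* (t :- q) :- (t :+ q) :* :1/8)) :=
          :1 :* (m :* (t :+ q :- a :- b) :- :1)) refl t q (m V 0) (r V 0) (r V (k ℕ.+ 0)))
        q≈ : q ≈ ι (ℤ.+ 5 ℚ./ 6)
        q≈ = combine₂ (ι (ℤ.+ 5 ℚ./ 6)) (- (ι (ℤ.+ 5 ℚ./ 6) * q)) tq≈1 t≈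
          (solve 2 (λ t q → q :- :5/6 := :5/6 :* (t :* q :- :1) :+ (:- (:5/6 :* q)) :* (t :- :6/5)) refl t q)
        slack : 𝟙 - ν * (t - q) - ν * ι (ℤ.+ 1 ℚ./ 8) ≈ ι (ℤ.+ 1 ℚ./ 3600)
        slack = trans
          (+-cong (+-congˡ (-‿cong (*-cong (+-cong t≈ q≈) (+-cong t≈ (-‿cong q≈)))))
                  (-‿cong (*-congʳ (+-cong t≈ q≈))))
          (solve 0 (:1 :- (:6/5 :+ :5/6) :* (:6/5 :- :5/6) :- (:6/5 :+ :5/6) :* :1/8 := con (ℤ.+ 1 ℚ./ 3600)) refl)

      module _ (root : value V ≈ 𝟘) where

        private
          :16 :3 : ∀ {n} → Polynomial n
          :16 = con (ℤ.+ 16 ℚ./ 1)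
          :3  = con (ℤ.+ 3 ℚ./ 1)
          𝟛 : Carrier
          𝟛 = fromNat 3
          :4 : ∀ {n} → Polynomial n
          :4 = con (ℤ.+ 4 ℚ./ 1)

        S≈ : ν - c ≈ ∑ k (m V)
        S≈ = x-y≈0⇒x≈y root

        root-balance : (ν - c) * (t - q) + E ≈ K
        root-balance = trans (+-congʳ (*-congʳ S≈)) balance

        root-E-≤ : ∀ N → (∀ i → i ℕ.< k ℕ.+ k → AtLeast N (h i)) → fromNat N * E ≤ (ν - c) * 𝟚
        root-E-≤ N deep = ≤-respʳ (*-congʳ (sym S≈)) (E-≤ N deep)

        module _ (0<k : 0 ℕ.< k) (finite : ∀ i → Finite (h i))
                 (deep : ∀ i → i ℕ.< k ℕ.+ k → AtLeast (depth k) (h i)) (t≤κ : t ≤ κ) where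
          private
            κ³ : Carrier
            κ³ = κ * κ * κ
            0<E : 𝟘 < E
            0<E = E-pos 0<k finite
            0≤2 : 𝟘 ≤ 𝟚
            0≤2 = <⇒≤ (ι-pos (ℤ.+ 2 ℚ./ 1))
            0≤c : 𝟘 ≤ c
            0≤c = proj₁ (arm-bounds 2<ν (h (k ℕ.+ k)) (arm V (k ℕ.+ k)))
            κE≤ : ι (ℤ.+ 16 ℚ./ 1) * κ³ * E ≤ (ν - c) * 𝟚
            κE≤ = ≤-resp (*-congʳ (fromNat-depth k)) refl (root-E-≤ (depth k) deep)

          -- With z = t², no integer is z + 1/z = ν² − 2, since its square lies
          -- strictly between k² + 3 and k² + 4.
          nonintegral₀ : c ≈ 𝟘 → ¬ (∃[ i ] ν * ν ≈ ι (i ℚ./ 1))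
          nonintegral₀ c≈0 (i , ν²≈i) =
            no-integer-between (k ℕ.* k ℕ.+ 3) lower upper ((i ℤ.- ℤ.+ 2) ℤ.* (i ℤ.- ℤ.+ 2)) i-2²
            where
            D : Carrier
            D = (t + q) * (t - q)
            0<D : 𝟘 < D
            0<D = *-pos (+-pos 0<t 0<q) (<⇒0< q<t)
            D+E : D + E ≈ K
            D+E = combine₂ 𝟙 (t - q) root-balance c≈0 (solve 5 (λ t q c E K →
              (t :+ q) :* (t :- q) :+ E :- K :=
              :1 :* ((t :+ q :- c) :* (t :- q) :+ E :- K) :+ (t :- q) :* (c :- :0)) refl t q c E K)
            ι-i-2 : ι ((i ℤ.- ℤ.+ 2) ℚ./ 1) ≈ ι (i ℚ./ 1) - 𝟚
            ι-i-2 = trans (reflexive (≡.cong ι (/1-+ i (ℤ.- ℤ.+ 2))))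
              (trans (ι-+ _ _) (+-congˡ (ι-‿ (ℤ.+ 2 ℚ./ 1))))
            -- For z = t² this is (z - 1/z)² + 4 = (z + 1/z)².
            square : D * D + fromNat 4 ≈ (ν * ν - 𝟚) * (ν * ν - 𝟚)
            square = combine₁ (- (fromNat 8 * (t * q) + fromNat 4 * (t * t + q * q))) tq≈1
              (solve 2 (λ t q → (t :+ q) :* (t :- q) :* ((t :+ q) :* (t :- q)) :+ :4
                  :- ((t :+ q) :* (t :+ q) :- :2) :* ((t :+ q) :* (t :+ q) :- :2) :=
                (:- (con (ℤ.+ 8 ℚ./ 1) :* (t :* q) :+ :4 :* (t :* t :+ q :* q))) :* (t :* q :- :1)) refl t q)
            i-2² : D * D + fromNat 4 ≈ ι (((i ℤ.- ℤ.+ 2) ℤ.* (i ℤ.- ℤ.+ 2)) ℚ./ 1)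
            i-2² = trans square (trans (*-cong ν²-2 ν²-2) (sym
              (trans (reflexive (≡.cong ι (/1-* (i ℤ.- ℤ.+ 2) (i ℤ.- ℤ.+ 2)))) (ι-* _ _))))
              where
              ν²-2 : ν * ν - 𝟚 ≈ ι ((i ℤ.- ℤ.+ 2) ℚ./ 1)
              ν²-2 = trans (+-congʳ ν²≈i) (sym ι-i-2)
            -- Since `D = K - E`, the square of `D` is `K² - 2 K E + E²`; this bound keeps it above
            -- `K² - 1`.
            2KE<1 : 𝟘 < 𝟙 - 𝟚 * K * E
            2KE<1 = <-respʳ
              (combine₁ (- (𝟚 * E)) κ≈ (solve 3 (λ K κ E →
                E :* (:2 :* κ :* (κ :- :1) :+ :2 :* κ :* κ :+ :2)
                  :+ con (ℤ.+ 1 ℚ./ 4) :* (:4 :- :16 :* κ :* κ :* E) :- (:1 :- :2 :* K :* E) :=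
                (:- (:2 :* E)) :* (κ :- (K :+ :1))) refl K κ E))
              (+-pos-≥0 (*-pos 0<E (≤-<-trans
                  (+-≥0 (*-≥0 (*-≥0 0≤2 (<⇒≤ 0<κ)) (≤⇒0≤ 1≤κ)) (*-≥0 (*-≥0 0≤2 (<⇒≤ 0<κ)) (<⇒≤ 0<κ)))
                  (<-by (ι-pos (ℤ.+ 2 ℚ./ 1)) (solve 1 (λ x → :2 := x :+ :2 :- x) refl _))))
                (*-≥0 (<⇒≤ (ι-pos (ℤ.+ 1 ℚ./ 4))) 16κ²E≤4))
              where
              -- `16 κ³ E ≤ 2 (ν - c)` and `ν - c ≤ κ + 1 ≤ 2 κ` give `E ≤ 1/(4 κ²)`. This is where
              -- the cube in `depth` is spent: one power on the size of `ν`, two on the margin.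
              16κ²E≤4 : 𝟘 ≤ fromNat 4 - fromNat 16 * κ * κ * E
              16κ²E≤4 = ≥0-cancelˡ 0<κ (≤-respʳ
                (solve 5 (λ t q c κ E →
                  (t :+ q :- c) :* :2 :- :16 :* (κ :* κ :* κ) :* E :+ :2 :* ((κ :- t) :+ (κ :- :1) :+ (:1 :- q) :+ c) :=
                  κ :* (:4 :- :16 :* κ :* κ :* E)) refl t q c κ E)
                (+-≥0 (≤⇒0≤ κE≤) (*-≥0 0≤2 (+-≥0 (+-≥0 (+-≥0 (≤⇒0≤ t≤κ) (≤⇒0≤ 1≤κ)) (≤⇒0≤ (<⇒≤ q<1))) 0≤c))))
            K²+3 : fromNat (k ℕ.* k ℕ.+ 3) ≈ K * K + 𝟛
            K²+3 = trans (fromNat-+ (k ℕ.* k) 3) (+-congʳ (fromNat-* k k))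
            lower : fromNat (k ℕ.* k ℕ.+ 3) < D * D + fromNat 4
            lower = <-respˡ (sym K²+3) (<-by (+-pos-≥0 2KE<1 (*-≥0 (<⇒≤ 0<E) (<⇒≤ 0<E)))
              (combine₁ (- (D + K - E)) D+E (solve 3 (λ D E K →
                :1 :- :2 :* K :* E :+ E :* E :- (D :* D :+ :4 :- (K :* K :+ :3)) :=
                (:- (D :+ K :- E)) :* (D :+ E :- K)) refl D E K)))
            upper : D * D + fromNat 4 < fromNat (suc (k ℕ.* k ℕ.+ 3))
            upper = <-respʳ (sym (trans (fromNat-suc (k ℕ.* k ℕ.+ 3)) (+-congʳ K²+3)))
              (<-by (*-pos 0<E (+-pos-≥0 0<D 0≤K)) (combine₁ (K + D) D+E (solve 3 (λ D E K →
                E :* (D :+ K) :- (K :* K :+ :3 :+ :1 :- (D :* D :+ :4)) := (K :+ D) :* (D :+ E :- K)) refl D E K)))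

          -- Here ν² itself lies strictly between k + 3 and k + 4.
          nonintegral₁ : AtLeast (depth k) (h (k ℕ.+ k)) → ¬ (∃[ i ] ν * ν ≈ ι (i ℚ./ 1))
          nonintegral₁ deep-c (i , ν²≈i) = no-integer-between (k ℕ.+ 3) lower upper i ν²≈i
            where
            ε : Carrier
            ε = q - c
            0<ε : 𝟘 < ε
            0<ε = finite-deficit (finite (k ℕ.+ k)) (arm V (k ℕ.+ k))
            E′ : Carrier
            E′ = ε * (t - q) + E
            0<E′ : 𝟘 < E′
            0<E′ = +-pos (*-pos 0<ε (<⇒0< q<t)) 0<E
            z+E′ : t * t + E′ ≈ κ
            z+E′ = combine₃ 𝟙 𝟙 (- 𝟙) root-balance tq≈1 κ≈ (solve 6 (λ t q c E K κ →
              t :* t :+ ((q :- c) :* (t :- q) :+ E) :- κ :=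
              :1 :* ((t :+ q :- c) :* (t :- q) :+ E :- K) :+ :1 :* (t :* q :- :1) :+ (:- :1) :* (κ :- (K :+ :1)))
              refl t q c E K κ)
            -- `t ≤ κ` means `q ≥ 1/κ`, while `E′ ≤ 1/(4 κ²)`.
            E′<q² : E′ < q * q
            E′<q² = <-by (pos-cancelˡ (*-pos (*-pos (ι-pos (ℤ.+ 16 ℚ./ 1)) 0<κ) 0<κ) (<-respʳ
                (combine₁ (- (fromNat 16 * (κ * q + 𝟙))) tq≈1 (solve 4 (λ t q κ E →
                  con (ℤ.+ 12 ℚ./ 1) :+ (:16 :* ((κ :- t) :* q :* (κ :* q :+ :1)) :+ (:4 :- :16 :* κ :* κ :* E))
                    :- :16 :* κ :* κ :* (q :* q :- E) :=
                  (:- (:16 :* (κ :* q :+ :1))) :* (t :* q :- :1)) refl t q κ E′))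
                (+-pos-≥0 (ι-pos (ℤ.+ 12 ℚ./ 1)) (+-≥0
                  (*-≥0 (<⇒≤ (ι-pos (ℤ.+ 16 ℚ./ 1))) (*-≥0 (*-≥0 (≤⇒0≤ t≤κ) (<⇒≤ 0<q))
                    (+-≥0 (*-≥0 (<⇒≤ 0<κ) (<⇒≤ 0<q)) (<⇒≤ 0<1))))
                  16κ²E′≤4)))) refl
              where
              16κ²E′≤4 : 𝟘 ≤ fromNat 4 - fromNat 16 * κ * κ * E′
              16κ²E′≤4 = ≥0-cancelˡ 0<κ (≤-respʳ
                (solve 5 (λ t q c κ E →
                  (:1 :- :16 :* (κ :* κ :* κ) :* (q :- c)) :* (t :- q)
                  :+ ((t :+ q :- c) :* :2 :- :16 :* (κ :* κ :* κ) :* E)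
                  :+ (:3 :* (κ :- t) :+ (κ :- :1) :+ (:1 :- q) :+ :2 :* c) :=
                  κ :* (:4 :- :16 :* κ :* κ :* ((q :- c) :* (t :- q) :+ E))) refl t q c κ E)
                (+-≥0 (+-≥0
                  (*-≥0 (≤⇒0≤ (≤-resp (*-congʳ (fromNat-depth k)) refl
                     (deficit-≤ (depth k) (h (k ℕ.+ k)) deep-c (arm V (k ℕ.+ k))))) (≤⇒0≤ (<⇒≤ q<t)))
                  (≤⇒0≤ κE≤))
                  (+-≥0 (+-≥0 (+-≥0 (*-≥0 (<⇒≤ (ι-pos (ℤ.+ 3 ℚ./ 1))) (≤⇒0≤ t≤κ)) (≤⇒0≤ 1≤κ)) (≤⇒0≤ (<⇒≤ q<1)))
                    (*-≥0 0≤2 0≤c))))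
            K+3 : fromNat (k ℕ.+ 3) ≈ K + 𝟛
            K+3 = fromNat-+ k 3
            -- `t * t = κ - E′` turns `ν²` into `k + 3 + (q² - E′)`, and the bracket lies strictly
            -- between 0 and 1.
            lower : fromNat (k ℕ.+ 3) < ν * ν
            lower = <-respˡ (sym K+3) (<-by (<⇒0< E′<q²) (combine₃ (- 𝟙) (- 𝟚) (- 𝟙) z+E′ tq≈1 κ≈
              (solve 5 (λ t q E′ K κ → q :* q :- E′ :- ((t :+ q) :* (t :+ q) :- (K :+ :3)) :=
                (:- :1) :* (t :* t :+ E′ :- κ) :+ (:- :2) :* (t :* q :- :1) :+ (:- :1) :* (κ :- (K :+ :1)))
                refl t q E′ K κ)))
            upper : ν * ν < fromNat (suc (k ℕ.+ 3))
            upper = <-respʳ (sym (trans (fromNat-suc (k ℕ.+ 3)) (+-congʳ K+3)))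
              (<-by (+-pos 0<E′ (*-pos (<⇒0< q<1) (+-pos 0<1 0<q)))
                (combine₃ 𝟙 𝟚 𝟙 z+E′ tq≈1 κ≈
                (solve 5 (λ t q E′ K κ → E′ :+ (:1 :- q) :* (:1 :+ q) :- (K :+ :3 :+ :1 :- (t :+ q) :* (t :+ q)) :=
                :1 :* (t :* t :+ E′ :- κ) :+ :2 :* (t :* q :- :1) :+ :1 :* (κ :- (K :+ :1)))
                refl t q E′ K κ)))

-- Shortening one infinite arm, and the roots when all branch arms are infinite

_[_≔_] : (ℕ → Length) → ℕ → Length → ℕ → Length
(h [ j ≔ a ]) i = if i ℕ.≡ᵇ j then a else h i

module Convergence (𝔽 : OrderedField) where
  open OrderedField 𝔽
  open OrderedFieldProperties 𝔽
  open Branches 𝔽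
  open Bounds 𝔽
  open Val

  module _ (P : Point) {k h} (V : Val k h (Point.ν P)) (root : value V ≈ 𝟘)
           {j} (h[j]≡∞ : h j ≡ ∞) (j≤2k : j ℕ.≤ k ℕ.+ k) where
    open Point P
    open AtPoint P

    private
      -- The comparison of the two roots goes through an intermediate state: arm `j` is already cut
      -- to length n, but `ν` is still the old root. Cutting the arm raises the value; moving `ν` to
      -- the new root brings it back to zero.
      module Shortened (n : ℕ) where
        rₙ : Carrier
        rₙ = proj₁ (finite-arm 2<ν n)

        armₙ : ArmVal ν (fin n) rₙ
        armₙ = proj₂ (finite-arm 2<ν n)

        e : Carrier
        e = q - rₙ

        0<e : 𝟘 < e
        0<e = proj₁ (deficit n armₙ)

        armOf : ∀ b i → ∃[ r ] ArmVal ν (if b then fin n else h i) r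
        armOf true i  = rₙ , armₙ
        armOf false i = r V i , arm V i

        Vₙ : Val k (h [ j ≔ fin n ]) ν
        Vₙ = mkVal 2<ν k _ (λ i → armOf (i ℕ.≡ᵇ j) i)

        R : ℕ → Carrier
        R i = if i ℕ.≡ᵇ j then 𝟙 else 𝟘

        0≤R : ∀ i → 𝟘 ≤ R i
        0≤R i with i ℕ.≡ᵇ j
        ... | true  = <⇒≤ 0<1
        ... | false = ≤-refl

        R≤1 : ∀ i → R i ≤ 𝟙
        R≤1 i with i ℕ.≡ᵇ j
        ... | true  = ≤-refl
        ... | false = <⇒≤ 0<1

        R[_] : ∀ {i} → i ≡ j → R i ≈ 𝟙
        R[ i≡j ] = reflexive (≡.cong (if_then 𝟙 else 𝟘) (dec-true (_ ℕ.≟ j) i≡j))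

        shortening′ : ∀ b i → (b ≡ true → h i ≡ ∞) →
                      r V i - proj₁ (armOf b i) ≈ e * (if b then 𝟙 else 𝟘)
        shortening′ true i h[i]≡∞ = combine₁ 𝟙
          (∞-arm (≡.subst (λ a → ArmVal ν a (r V i)) (h[i]≡∞ ≡.refl) (arm V i)))
          (solve 3 (λ q s t → t :- s :- (q :- s) :* :1 := :1 :* (t :- q)) refl q rₙ (r V i))
        shortening′ false i _ = solve 2 (λ r e → r :- r := e :* :0) refl (r V i) e

        shortening : ∀ i → r V i - r Vₙ i ≈ e * R i
        shortening i = shortening′ (i ℕ.≡ᵇ j) i (λ i≡ᵇj →
          ≡.trans (≡.cong h (ℕ.≡ᵇ⇒≡ i j (≡.subst T (≡.sym i≡ᵇj) tt))) h[j]≡∞)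

        term : ℕ → Carrier
        term i = m V i * m Vₙ i * (𝟘 + R i + R (k ℕ.+ i))

        0≤0+R+R : ∀ i → 𝟘 ≤ 𝟘 + R i + R (k ℕ.+ i)
        0≤0+R+R i = +-≥0 (+-≥0 ≤-refl (0≤R i)) (0≤R (k ℕ.+ i))

        0≤mm : ∀ i → 𝟘 ≤ m V i * m Vₙ i
        0≤mm i = *-≥0 (<⇒≤ (m-pos V i)) (<⇒≤ (m-pos Vₙ i))

        0≤term : ∀ i → 𝟘 ≤ term i
        0≤term i = *-≥0 (0≤mm i) (0≤0+R+R i)

        mₙ≤m : ∀ i → m Vₙ i ≤ m V i
        mₙ≤m i = ≤-by (≥0-cancelʳ (denominator-pos 2<ν (proj₂ (arm-bounds 2<ν (h i) (arm V i)))
                                                 (proj₂ (arm-bounds 2<ν (h (k ℕ.+ i)) (arm V (k ℕ.+ i)))))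
          (≤-respʳ
            (combine₂ 𝟙 (- 𝟙) (m-inv Vₙ i) (m-inv V i) (solve 7 (λ ν m m′ r s r′ s′ →
              m′ :* ((r :- r′) :+ (s :- s′)) :- (m :- m′) :* (ν :- r :- s) :=
              :1 :* (m′ :* (ν :- r′ :- s′) :- :1) :+ (:- :1) :* (m :* (ν :- r :- s) :- :1))
              refl ν (m V i) (m Vₙ i) (r V i) (r V (k ℕ.+ i)) (r Vₙ i) (r Vₙ (k ℕ.+ i))))
            (*-≥0 (<⇒≤ (m-pos Vₙ i)) (+-≥0 (r-mono i) (r-mono (k ℕ.+ i)))))) refl
          where
          r-mono : ∀ i → 𝟘 ≤ r V i - r Vₙ i
          r-mono i = ≤-respʳ (sym (shortening i)) (*-≥0 (<⇒≤ 0<e) (0≤R i))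

        G : Carrier
        G = 𝟘 + R (k ℕ.+ k) + ∑ k term

        value-Vₙ : value Vₙ - value V ≈ e * G
        value-Vₙ = value-difference V Vₙ e
          (solve 2 (λ ν e → ν :- ν := e :* :0) refl ν e) shortening

        0<term : ∀ i → 𝟘 < 𝟘 + R i + R (k ℕ.+ i) → i ℕ.< k → 𝟘 < ∑ k term
        0<term i 0<R i<k = <-≤-trans (*-pos (*-pos (m-pos V i) (m-pos Vₙ i)) 0<R) (term≤∑ 0≤term i<k)

        0<∑ : j ℕ.< k ℕ.+ k → Dec (j ℕ.< k) → 𝟘 < ∑ k term
        0<∑ j<2k (yes j<k) = 0<term j
          (+-pos-≥0 (<-respʳ (trans (solve 0 (:1 := :0 :+ :1) refl) (+-congˡ (sym R[ ≡.refl ]))) 0<1)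
            (0≤R (k ℕ.+ j))) j<k
        0<∑ j<2k (no j≮k) = 0<term i
          (<-respʳ (trans (+-comm _ _) (+-congˡ (sym R[ k+i≡j ]))) (+-pos-≥0 0<1 (+-≥0 ≤-refl (0≤R i))))
          (ℕ.+-cancelˡ-< k i k (≡.subst (ℕ._< k ℕ.+ k) (≡.sym k+i≡j) j<2k))
          where
          i : ℕ
          i = j ℕ.∸ k
          k+i≡j : k ℕ.+ i ≡ j
          k+i≡j = ℕ.m+[n∸m]≡n (ℕ.≮⇒≥ j≮k)

        -- Arm `j` is the first or the second arm of a branch, or the central arm, and in each case
        -- contributes a positive summand. Positivity is what makes the new root differ from the old
        -- one.
        0<G : 𝟘 < G
        0<G = [ (λ j<2k → <-respʳ (+-comm _ _) (+-pos-≥0 (0<∑ j<2k (j ℕ.<? k)) (+-≥0 ≤-refl (0≤R (k ℕ.+ k)))))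
              , (λ j≡2k → +-pos-≥0 (<-respʳ (trans (solve 0 (:1 := :0 :+ :1) refl)
                  (+-congˡ (sym R[ ≡.sym j≡2k ]))) 0<1) (∑-≥0 k 0≤term)) ]′
              (ℕ.m≤n⇒m<n∨m≡n j≤2k)

      C : Carrier
      C = 𝟙 + ∑ k (λ i → m V i * m V i * 𝟚)

      -- A shorter arm has a smaller `r`, so no `m` grows (`mₙ≤m`). The bound can therefore be
      -- written with the `m` of the uncut tree, independently of `n`, which leaves the shortfall
      -- `e` as the only factor depending on the length.
      G≤C : ∀ n → Shortened.G n ≤ C
      G≤C n = +-mono-≤ (≤-respˡ′ (R≤1 (k ℕ.+ k)))
        (∑-mono-≤ k (λ i _ → ≤-trans
          (*-monoʳ-≤ (0≤0+R+R i) (*-monoˡ-≤ (<⇒≤ (m-pos V i)) (mₙ≤m i)))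
          (*-monoˡ-≤ (*-≥0 (<⇒≤ (m-pos V i)) (<⇒≤ (m-pos V i)))
            (≤-respʳ (solve 0 (:0 :+ :1 :+ :1 := :2) refl) (+-mono-≤ (+-mono-≤ ≤-refl (R≤1 i)) (R≤1 (k ℕ.+ i)))))))
        where
        open Shortened n
        ≤-respˡ′ : ∀ {x y} → x ≤ y → 𝟘 + x ≤ y
        ≤-respˡ′ {x} = ≤-resp (solve 1 (λ x → x := :0 :+ x) refl x) refl

      0≤C : 𝟘 ≤ C
      0≤C = +-≥0 (<⇒≤ 0<1) (∑-≥0 k (λ i → *-≥0 (*-≥0 (<⇒≤ (m-pos V i)) (<⇒≤ (m-pos V i))) (<⇒≤ (ι-pos (ℤ.+ 2 ℚ./ 1)))))

      module Compare (n : ℕ) (P′ : Point) (V′ : Val k (h [ j ≔ fin n ]) (Point.ν P′))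
                     (6/5≤t′ : ι (ℤ.+ 6 ℚ./ 5) ≤ Point.t P′) (root′ : value V′ ≈ 𝟘) where
        open Shortened n
        open Point P′ using () renaming
          (t to t′; q to q′; ν to ν′; 2<ν to 2<ν′; tq≈1 to t′q′≈1; 0<q to 0<q′; 0<t to 0<t′)

        -- q′ ≤ 5/6 bounds W, the slope of ν as a function of t, from below.
        1/6≤1-q′ : 𝟘 ≤ 𝟙 - q′ - ι (ℤ.+ 1 ℚ./ 6)
        1/6≤1-q′ = ≤-respʳ (combine₁ (ι (ℤ.+ 5 ℚ./ 6)) t′q′≈1 (solve 2 (λ t q →
            con (ℤ.+ 5 ℚ./ 6) :* q :* (t :- con (ℤ.+ 6 ℚ./ 5)) :- (:1 :- q :- con (ℤ.+ 1 ℚ./ 6)) :=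
            con (ℤ.+ 5 ℚ./ 6) :* (t :* q :- :1)) refl t′ q′))
          (*-≥0 (*-≥0 (<⇒≤ (ι-pos (ℤ.+ 5 ℚ./ 6))) (<⇒≤ 0<q′)) (≤⇒0≤ 6/5≤t′))

        W : Carrier
        W = 𝟙 - q * q′

        1/6≤W : ι (ℤ.+ 1 ℚ./ 6) ≤ W
        1/6≤W = ≤-by (+-≥0 1/6≤1-q′ (*-≥0 (≤⇒0≤ (<⇒≤ q<1)) (<⇒≤ 0<q′)))
          (solve 2 (λ q q′ → :1 :- q′ :- con (ℤ.+ 1 ℚ./ 6) :+ (:1 :- q) :* q′ :=
            :1 :- q :* q′ :- con (ℤ.+ 1 ℚ./ 6)) refl q q′)

        0<W : 𝟘 < W
        0<W = <-≤-trans (ι-pos (ℤ.+ 1 ℚ./ 6)) 1/6≤W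

        dν : ν - ν′ ≈ (t - t′) * W
        dν = combine₂ q′ (- q) tq≈1 t′q′≈1 (solve 4 (λ t q t′ q′ →
          t :+ q :- (t′ :+ q′) :- (t :- t′) :* (:1 :- q :* q′) :=
          q′ :* (t :* q :- :1) :+ (:- q) :* (t′ :* q′ :- :1)) refl t q t′ q′)

        lowered : ∀ {K} → 𝟙 ≤ K → value V′ - value Vₙ ≈ (ν′ - ν) * K →
                  t′ * t′ < t * t × fromNat (suc n) * (t * t - t′ * t′) ≤ fromNat 12 * C * t
        lowered {K} 1≤K dK = square< , bound
          where
          x : Carrier
          x = t - t′
          -- Both end values are zero, so the gain `e * G` from cutting the arm equals the loss
          -- `(ν - ν′) * K` from lowering `ν`, and `ν - ν′` is `x * W`.
          main : x * (W * K) ≈ e * G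
          main = trans (combine₃ (- K) 𝟙 (- 𝟙) dν dK (trans root′ (sym root))
            (solve 8 (λ x W K ν ν′ c v v′ → x :* (W :* K) :- (c :- v) :=
              (:- K) :* (ν :- ν′ :- x :* W) :+ :1 :* (v′ :- c :- (ν′ :- ν) :* K) :+ (:- :1) :* (v′ :- v))
              refl x W K ν ν′ (value Vₙ) (value V) (value V′))) value-Vₙ
          0<x : 𝟘 < x
          0<x = pos-cancelʳ (*-pos 0<W (<-≤-trans 0<1 1≤K)) (<-respʳ (sym main) (*-pos 0<e 0<G))
          square< : t′ * t′ < t * t
          square< = <-by (*-pos 0<x (+-pos 0<t 0<t′))
            (solve 2 (λ t t′ → (t :- t′) :* (t :+ t′) := t :* t :- t′ :* t′) refl t t′)
          -- x/6 ≤ x W ≤ x W K = e G ≤ e C and (n + 1) e ≤ q < 1.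
          x≤6eC : x ≤ fromNat 6 * (e * C)
          x≤6eC = ≤-by (+-≥0 (+-≥0
              (*-≥0 0≤6 (*-≥0 (<⇒≤ 0<e) (≤⇒0≤ (G≤C n))))
              (*-≥0 0≤6 (*-≥0 (*-≥0 (<⇒≤ 0<x) (<⇒≤ 0<W)) (≤⇒0≤ 1≤K))))
              (*-≥0 0≤6 (*-≥0 (<⇒≤ 0<x) (≤⇒0≤ 1/6≤W))))
            (combine₁ (fromNat 6) main (solve 6 (λ x W K e G C →
              :6 :* (e :* (C :- G)) :+ :6 :* (x :* W :* (K :- :1)) :+ :6 :* (x :* (W :- con (ℤ.+ 1 ℚ./ 6)))
                :- (:6 :* (e :* C) :- x) := :6 :* (x :* (W :* K) :- e :* G)) refl x W K e G C))
            where
            :6 : ∀ {n} → Polynomial n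
            :6 = con (ℤ.+ 6 ℚ./ 1)
            0≤6 : 𝟘 ≤ fromNat 6
            0≤6 = fromNat-≥0 6
          bound : fromNat (suc n) * (t * t - t′ * t′) ≤ fromNat 12 * C * t
          bound = ≤-by (+-≥0 (+-≥0
              (*-≥0 (*-≥0 (fromNat-≥0 (suc n)) (≤⇒0≤ x≤6eC)) (+-≥0 (<⇒≤ 0<t) (<⇒≤ 0<t′)))
              (*-≥0 (*-≥0 (*-≥0 (fromNat-≥0 6) 0≤C) (+-≥0 (<⇒≤ 0<t) (<⇒≤ 0<t′)))
                (≤⇒0≤ (≤-trans (proj₂ (deficit n armₙ)) (<⇒≤ q<1)))))
              (*-≥0 (*-≥0 (fromNat-≥0 6) 0≤C) (<⇒≤ 0<x)))
            (solve 5 (λ N t t′ e C →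
              N :* (:6 :* (e :* C) :- (t :- t′)) :* (t :+ t′) :+ :6 :* C :* (t :+ t′) :* (:1 :- N :* e)
                :+ :6 :* C :* (t :- t′) :=
              con (ℤ.+ 12 ℚ./ 1) :* C :* t :- N :* (t :* t :- t′ :* t′)) refl (fromNat (suc n)) t t′ e C)
            where
            :6 : ∀ {n} → Polynomial n
            :6 = con (ℤ.+ 6 ℚ./ 1)

    -- Replacing the infinite arm j by one of length n lowers t² by O(1/n).
    approach : ∃[ B ] ∀ n (P′ : Point) (V′ : Val k (h [ j ≔ fin n ]) (Point.ν P′)) →
      ι (ℤ.+ 6 ℚ./ 5) ≤ Point.t P′ → value V′ ≈ 𝟘 →
      Point.t P′ * Point.t P′ < t * t ×
      fromNat (suc n) * (t * t - Point.t P′ * Point.t P′) ≤ B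
    approach = fromNat 12 * C * t , λ n P′ V′ 6/5≤t′ root′ →
      let _ , 1≤K , dK = value-expands (Point.2<ν P) (Point.2<ν P′) (Shortened.Vₙ n) V′
      in Compare.lowered n P′ V′ 6/5≤t′ root′ 1≤K dK

  module _ (P : Point) {k h} (V : Val k h (Point.ν P)) (root : value V ≈ 𝟘)
           (h≡∞ : ∀ i → i ℕ.< k ℕ.+ k → h i ≡ ∞) where
    open Point P
    open AtPoint P

    private
      ∞-deficit : ∀ {i} → h i ≡ ∞ → q - r V i ≈ 𝟘
      ∞-deficit {i} h[i]≡∞ = x≈y⇒x-y≈0 (sym (∞-arm (≡.subst (λ a → ArmVal ν a (r V i)) h[i]≡∞ (arm V i))))

      E≈0 : E V ≈ 𝟘
      E≈0 = ≤-antisym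
        (≤-respʳ (trans (∑-const k 𝟘) (solve 1 (λ n → n :* :0 := :0) refl (fromNat k)))
          (∑-mono-≤ k (λ i i<k → ≈⇒≤ (trans
            (*-congˡ (+-cong (∞-deficit (h≡∞ i (ℕ.<-≤-trans i<k (ℕ.m≤m+n k k))))
                             (∞-deficit (h≡∞ (k ℕ.+ i) (ℕ.+-monoʳ-< k i<k)))))
            (solve 1 (λ m → m :* (:0 :+ :0) := :0) refl (m V i))))))
        (E-≥0 V)

    no-central-arm : h (k ℕ.+ k) ≡ fin 0 → t * t - q * q ≈ fromNat k
    no-central-arm h[2k]≡0 = combine₃ 𝟙 (- 𝟙) (t - q) (root-balance V root) E≈0
      (≡.subst (λ a → ArmVal ν a (r V (k ℕ.+ k))) h[2k]≡0 (arm V (k ℕ.+ k)))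
      (solve 5 (λ t q c E K → t :* t :- q :* q :- K :=
        :1 :* ((t :+ q :- c) :* (t :- q) :+ E :- K) :+ (:- :1) :* (E :- :0) :+ (t :- q) :* (c :- :0))
        refl t q (r V (k ℕ.+ k)) (E V) (fromNat k))

    infinite-central-arm : h (k ℕ.+ k) ≡ ∞ → t * t ≈ fromNat k + 𝟙
    infinite-central-arm h[2k]≡∞ = x-y≈0⇒x≈y (trans
      (combine₃ 𝟙 (- 𝟙) 𝟙 (root-balance V root) E≈0 tq≈1
        (solve 5 (λ t q c E K → t :* t :- (K :+ :1) :- (:0 :- (q :- c) :* (t :- q)) :=
          :1 :* ((t :+ q :- c) :* (t :- q) :+ E :- K) :+ (:- :1) :* (E :- :0) :+ :1 :* (t :* q :- :1))
          refl t q (r V (k ℕ.+ k)) (E V) (fromNat k)))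
      (trans (+-congˡ (-‿cong (*-congʳ (∞-deficit h[2k]≡∞))))
        (solve 1 (λ x → :0 :- :0 :* x := :0) refl (t - q))))

  -- Here `value-expands` acts as continuity: values at equal points agree, whichever arm values
  -- were chosen. So a sign known only for the lower approximation and a sign known only for the
  -- upper one meet in zero.
  squeeze : (P P′ : Point) → Point.t P ≈ Point.t P′ → ∀ {k h} (V : Val k h (Point.ν P)) (V′ : Val k h (Point.ν P′)) →
            value V ≤ 𝟘 → 𝟘 ≤ value V′ → value V ≈ 𝟘
  squeeze P P′ t≈t′ V V′ V≤0 0≤V′ = ≤-antisym V≤0 (≤-respʳ (sym V≈V′) 0≤V′)
    where
    open Point P
    open Point P′ using () renaming (t to t′; q to q′; ν to ν′; tq≈1 to t′q′≈1)
    ν≈ν′ : ν′ - ν ≈ 𝟘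
    ν≈ν′ = combine₃ (q * q′ - 𝟙) (- q′) q t≈t′ tq≈1 t′q′≈1 (solve 4 (λ t q t′ q′ →
      t′ :+ q′ :- (t :+ q) :- :0 :=
      (q :* q′ :- :1) :* (t :- t′) :+ (:- q′) :* (t :* q :- :1) :+ q :* (t′ :* q′ :- :1)) refl t q t′ q′)
    V≈V′ : value V ≈ value V′
    V≈V′ = let K , _ , dK = value-expands 2<ν (Point.2<ν P′) V V′ in
      sym (x-y≈0⇒x≈y (trans dK (trans (*-congʳ ν≈ν′) (solve 1 (λ K → :0 :* K := :0) refl K))))

-- Trees grown leaf by leaf, and the graphs of the theorem

data Tree : ℕ → Set where
  leaf   : Tree 1
  -- The new vertex is `zero` and is a leaf, so eliminating vertices from the leaves inwards is
  -- structural recursion.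
  attach : ∀ {n} → Tree n → Fin n → Tree (suc n)

adj : ∀ {n} → Tree n → Fin n → Fin n → Bool
adj leaf         _       _       = false
adj (attach T u) zero    zero    = false
adj (attach T u) zero    (suc j) = does (j ≟ u)
adj (attach T u) (suc i) zero    = does (i ≟ u)
adj (attach T u) (suc i) (suc j) = adj T i j

adj-sym : ∀ {n} (T : Tree n) i j → adj T i j ≡ adj T j i
adj-sym leaf         i       j       = ≡.refl
adj-sym (attach T u) zero    zero    = ≡.refl
adj-sym (attach T u) zero    (suc j) = ≡.refl
adj-sym (attach T u) (suc i) zero    = ≡.refl
adj-sym (attach T u) (suc i) (suc j) = adj-sym T i j

adj-irrefl : ∀ {n} (T : Tree n) i → adj T i i ≡ false
adj-irrefl leaf         i       = ≡.refl
adj-irrefl (attach T u) zero    = ≡.refl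
adj-irrefl (attach T u) (suc i) = adj-irrefl T i

graph : ∀ {n} → Tree n → Graph
graph {n} T = record
  { order = n ; adjacent = adj T ; symmetric = adj-sym T ; irreflexive = adj-irrefl T }

side : ∀ {n} → Tree n → Fin n → Bool
side leaf         _       = true
side (attach T u) zero    = not (side T u)
side (attach T u) (suc i) = side T i

does-true : ∀ {n} (i j : Fin n) → does (i ≟ j) ≡ true → i ≡ j
does-true i j e with i ≟ j
... | yes i≡j = i≡j

adj⇒sides-differ : ∀ {n} (T : Tree n) i j → adj T i j ≡ true → side T i ≡ not (side T j)
adj⇒sides-differ (attach T u) zero    (suc j) e = ≡.cong (not ∘ side T) (≡.sym (does-true j u e))
adj⇒sides-differ (attach T u) (suc i) zero    e = ≡.trans (≡.cong (side T) (does-true i u e))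
  (≡.sym (not-involutive (side T u)))
adj⇒sides-differ (attach T u) (suc i) (suc j) e = adj⇒sides-differ T i j e

graph-bipartite : ∀ {n} (T : Tree n) → Bipartite (graph T)
graph-bipartite T = side T , λ i j e same → not-¬ ≡.refl (≡.trans (≡.sym same) (adj⇒sides-differ T i j e))

base : ∀ {n} → Tree n → Fin n
base leaf         = zero
base (attach T u) = suc (base T)

-- A path is grown from its base, so each new vertex joins the graph carrying
-- the rest of the path.
infixr 6 _⊞_
_⊞_ : ℕ → ℕ → ℕ
zero  ⊞ n = n
suc a ⊞ n = a ⊞ suc n

addPath : ∀ {n} → Tree n → Fin n → ∀ a → Tree (a ⊞ n)
addPath T u zero    = T
addPath T u (suc a) = addPath (attach T u) zero a

lift : ∀ {n} a → Fin n → Fin (a ⊞ n)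
lift zero    i = i
lift (suc a) i = lift a (suc i)

record Rooted : Set where
  constructor rooted
  field
    {size} : ℕ
    tree   : Tree size
    root   : Fin size

addBranch : Rooted → ℕ → ℕ → Rooted
addBranch (rooted T u) a b =
  rooted (addPath (addPath (attach T u) zero a) (lift a zero) b) (lift b (lift a (suc u)))

branches : (f g : ℕ → ℕ) → ℕ → Rooted
branches f g zero    = rooted leaf zero
branches f g (suc l) = addBranch (branches f g l) (f l) (g l)

caterpillar : ∀ k → (ℕ → ℕ) → Rooted
caterpillar k h = let rooted T u = branches h (λ i → h (k ℕ.+ i)) k
  in rooted (addPath T u (h (k ℕ.+ k))) (lift (h (k ℕ.+ k)) u)

-- Spectrum of a tree by elimination of leaves

module Elimination (𝔽 : OrderedField) where
  open OrderedField 𝔽 hiding (zero)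
  open OrderedFieldProperties 𝔽
  open Branches 𝔽
  open Val
  open RawMonoid +-rawMonoid using (sum)

  matrix : ∀ {n} → Tree n → Fin n → Fin n → Carrier
  matrix T i j = if adj T i j then 𝟙 else 𝟘

  -- The kernel of A - diag d. The diagonal is arbitrary because eliminating a leaf alters the entry
  -- of its neighbour; eigenvectors are the case of constant `d`.
  Kernel : ∀ {n} → Tree n → (Fin n → Carrier) → (Fin n → Carrier) → Set
  Kernel T d w = ∀ i → sum (λ j → matrix T i j * w j) ≈ d i * w i

  reduce : ∀ {n} → Fin n → Carrier → (Fin n → Carrier) → Fin n → Carrier
  reduce u c d i = d i - (if does (i ≟ u) then c else 𝟘)

  -- Successive elimination of the vertices turns A − diag d into the 1 × 1
  -- matrix (− f) at the base vertex.
  Elim : ∀ {n} → Tree n → (Fin n → Carrier) → Carrier → Set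
  Elim leaf         d f = f ≈ d zero
  Elim (attach T u) d f = ∃[ c ] c * d zero ≈ 𝟙 × Elim T (reduce u c (d ∘ suc)) f

  1*x≈x : ∀ x → 𝟙 * x ≈ x
  1*x≈x = solve 1 (λ x → :1 :* x := x) refl

  0*x≈0 : ∀ x → 𝟘 * x ≈ 𝟘
  0*x≈0 = solve 1 (λ x → :0 :* x := :0) refl

  0+x≈x : ∀ x → 𝟘 + x ≈ x
  0+x≈x = solve 1 (λ x → :0 :+ x := x) refl

  x+0≈x : ∀ x → x + 𝟘 ≈ x
  x+0≈x = solve 1 (λ x → x :+ :0 := x) refl

  x-0≈x : ∀ x → x - 𝟘 ≈ x
  x-0≈x = solve 1 (λ x → x :- :0 := x) refl

  sum-cong : ∀ {n} {f g : Fin n → Carrier} → (∀ i → f i ≈ g i) → sum f ≈ sum g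
  sum-cong {zero}  e = refl
  sum-cong {suc n} e = +-cong (e zero) (sum-cong (e ∘ suc))

  sum-zero : ∀ {n} (w : Fin n → Carrier) → sum (λ j → 𝟘 * w j) ≈ 𝟘
  sum-zero {zero}  w = sym ι-0
  sum-zero {suc n} w = trans (+-cong (0*x≈0 (w zero)) (sum-zero (w ∘ suc))) 0+0

  sum-select : ∀ {n} (u : Fin n) (w : Fin n → Carrier) →
               sum (λ j → (if does (j ≟ u) then 𝟙 else 𝟘) * w j) ≈ w u
  sum-select {suc n} zero    w = trans (+-cong (1*x≈x (w zero)) (sum-zero (w ∘ suc))) (x+0≈x (w zero))
  sum-select {suc n} (suc u) w = trans (+-cong (0*x≈0 (w zero)) (sum-select u (w ∘ suc))) (0+x≈x (w (suc u)))

  sum-*ˡ : ∀ {n} c (f : Fin n → Carrier) → sum (λ j → c * f j) ≈ c * sum f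
  sum-*ˡ {zero}  c f = sym (zeroʳ c)
  sum-*ˡ {suc n} c f = trans (+-congˡ (sum-*ˡ c (f ∘ suc))) (sym (distribˡ c _ _))

  module _ {n} (T : Tree n) (u : Fin n) {d : Fin (suc n) → Carrier} {c} (c-inv : c * d zero ≈ 𝟙)
           {w : Fin (suc n) → Carrier} where

    leaf-row : Kernel (attach T u) d w → w zero ≈ c * w (suc u)
    leaf-row ker = combine₂ (- w zero) (- c) c-inv (trans (sym row) (ker zero))
      (solve 4 (λ w₀ wᵤ c d → w₀ :- c :* wᵤ :=
        (:- w₀) :* (c :* d :- :1) :+ (:- c) :* (wᵤ :- d :* w₀)) refl (w zero) (w (suc u)) c (d zero))
      where
      row : sum (λ j → matrix (attach T u) zero j * w j) ≈ w (suc u)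
      row = trans (+-cong (0*x≈0 (w zero)) (sum-select u (w ∘ suc))) (0+x≈x (w (suc u)))

    row-coefficient : w zero ≈ c * w (suc u) → ∀ i →
      (if does (i ≟ u) then 𝟙 else 𝟘) * w zero ≈ (if does (i ≟ u) then c else 𝟘) * w (suc i)
    row-coefficient w₀ i = by (does (i ≟ u)) (does-true i u)
      where
      by : ∀ b → (b ≡ true → i ≡ u) → (if b then 𝟙 else 𝟘) * w zero ≈ (if b then c else 𝟘) * w (suc i)
      by true i≡u = trans (1*x≈x (w zero)) (trans w₀ (reflexive (≡.cong (λ j → c * w (suc j)) (≡.sym (i≡u ≡.refl)))))
      by false _  = trans (0*x≈0 (w zero)) (sym (0*x≈0 (w (suc i))))

    -- The row of the leaf gives `w zero = c * w (suc u)`. Substituted into the row of `u`, it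
    -- lowers the diagonal entry there by `c` and leaves the other rows alone.
    kernel-restrict : Kernel (attach T u) d w → Kernel T (reduce u c (d ∘ suc)) (w ∘ suc)
    kernel-restrict ker i = combine₂ 𝟙 (- 𝟙) (ker (suc i)) (row-coefficient (leaf-row ker) i)
      (solve 5 (λ S x y w d → S :- (d :- y) :* w := :1 :* (x :+ S :- d :* w) :+ (:- :1) :* (x :- y :* w))
        refl _ _ (if does (i ≟ u) then c else 𝟘) (w (suc i)) (d (suc i)))

    kernel-extend : w zero ≈ c * w (suc u) → Kernel T (reduce u c (d ∘ suc)) (w ∘ suc) →
                    Kernel (attach T u) d w
    kernel-extend w₀ ker zero = trans (+-cong (0*x≈0 (w zero)) (sum-select u (w ∘ suc)))
      (combine₂ (- w (suc u)) (- d zero) c-inv w₀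
        (solve 4 (λ w₀ wᵤ c d → :0 :+ wᵤ :- d :* w₀ :=
          (:- wᵤ) :* (c :* d :- :1) :+ (:- d) :* (w₀ :- c :* wᵤ)) refl (w zero) (w (suc u)) c (d zero)))
    kernel-extend w₀ ker (suc i) = combine₂ 𝟙 𝟙 (ker i) (row-coefficient w₀ i)
      (solve 5 (λ S x y w d → x :+ S :- d :* w := :1 :* (S :- (d :- y) :* w) :+ :1 :* (x :- y :* w))
        refl _ _ (if does (i ≟ u) then c else 𝟘) (w (suc i)) (d (suc i)))

  -- Back substitution starting from the entry 1 at the base. Every kernel vector is a multiple of
  -- it (`kernel-coord`), which is why an eigenvalue reached by elimination is simple.
  coord : ∀ {n} (T : Tree n) {d f} → Elim T d f → Fin n → Carrier
  coord leaf         e           _       = 𝟙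
  coord (attach T u) (c , _ , e) zero    = c * coord T e u
  coord (attach T u) (_ , _ , e) (suc i) = coord T e i

  coord-base : ∀ {n} (T : Tree n) {d f} (e : Elim T d f) → coord T e (base T) ≈ 𝟙
  coord-base leaf         e           = refl
  coord-base (attach T u) (_ , _ , e) = coord-base T e

  kernel-coord : ∀ {n} (T : Tree n) {d f w} (e : Elim T d f) → Kernel T d w →
                 ∀ i → w i ≈ w (base T) * coord T e i
  kernel-coord leaf {w = w} e ker zero = solve 1 (λ x → x := x :* :1) refl (w zero)
  kernel-coord (attach T u) (_ , c-inv , e) ker (suc i) =
    kernel-coord T e (kernel-restrict T u c-inv ker) i
  kernel-coord (attach T u) {w = w} (c , c-inv , e) ker zero = trans (leaf-row T u c-inv ker)
    (trans (*-congˡ (kernel-coord T e (kernel-restrict T u c-inv ker) u))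
      (solve 3 (λ x y z → x :* (y :* z) := y :* (x :* z)) refl c _ (coord T e u)))

  kernel-value : ∀ {n} (T : Tree n) {d f w} → Elim T d f → Kernel T d w → f * w (base T) ≈ 𝟘
  kernel-value leaf {w = w} e ker = trans (*-congʳ e)
    (trans (sym (ker zero)) (trans (+-cong (0*x≈0 (w zero)) (sym ι-0)) 0+0))
  kernel-value (attach T u) (c , c-inv , e) ker = kernel-value T e (kernel-restrict T u c-inv ker)

  coord-kernel : ∀ {n} (T : Tree n) {d f} (e : Elim T d f) → f ≈ 𝟘 → Kernel T d (coord T e)
  coord-kernel leaf {d} e f≈0 zero = trans (+-cong (0*x≈0 𝟙) (sym ι-0))
    (trans 0+0 (sym (trans (*-congʳ (trans (sym e) f≈0)) (0*x≈0 𝟙))))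
  coord-kernel (attach T u) (c , c-inv , e) f≈0 = kernel-extend T u c-inv refl (coord-kernel T e f≈0)

  Elim-cong : ∀ {n} (T : Tree n) {d d′ f f′} → (∀ i → d i ≈ d′ i) → f ≈ f′ → Elim T d f → Elim T d′ f′
  Elim-cong leaf         d≈ f≈ e = trans (sym f≈) (trans e (d≈ zero))
  Elim-cong (attach T u) d≈ f≈ (c , c-inv , e) =
    c , trans (*-congˡ (sym (d≈ zero))) c-inv , Elim-cong T (λ i → +-congʳ (d≈ (suc i))) f≈ e

  module _ (ν : Carrier) where
    infixr 5 ν∷_
    ν∷_ : ∀ {n} → (Fin n → Carrier) → Fin (suc n) → Carrier
    (ν∷ d) zero    = ν
    (ν∷ d) (suc i) = d i

    extend : ∀ {n} a → (Fin n → Carrier) → Fin (a ⊞ n) → Carrier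
    extend zero    d = d
    extend (suc a) d = extend a (ν∷ d)

    ν∷-cong : ∀ {n} {d d′ : Fin n → Carrier} → (∀ i → d i ≈ d′ i) → ∀ i → (ν∷ d) i ≈ (ν∷ d′) i
    ν∷-cong e zero    = refl
    ν∷-cong e (suc i) = e i

    extend-cong : ∀ {n} a {d d′ : Fin n → Carrier} → (∀ i → d i ≈ d′ i) → ∀ i → extend a d i ≈ extend a d′ i
    extend-cong zero    e = e
    extend-cong (suc a) e = extend-cong a (ν∷-cong e)

    constant : ∀ {n} → Fin n → Carrier
    constant _ = ν

    extend-constant : ∀ {n} a i → extend {n} a constant i ≈ ν
    extend-constant zero    i = refl
    extend-constant (suc a) i = trans (extend-cong a (λ { zero → refl ; (suc _) → refl }) i) (extend-constant a i)

    extend-reduce : ∀ {n} a (u : Fin n) s d i → extend a (reduce u s d) i ≈ reduce (lift a u) s (extend a d) i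
    extend-reduce zero    u s d i = refl
    extend-reduce (suc a) u s d i = trans
      (extend-cong a (λ { zero → sym (x-0≈x ν) ; (suc _) → refl }) i) (extend-reduce a (suc u) s (ν∷ d) i)

    -- The step is the recursion of `ArmVal`: once the rest of the path is gone, its first vertex
    -- has the diagonal entry `ν - s`, whose inverse `r` is then subtracted at `u`.
    path-elim : ∀ {n} a (T : Tree n) u d {f r} → ArmVal ν (fin a) r →
                Elim T (reduce u r d) f → Elim (addPath T u a) (extend a d) f
    path-elim zero T u d {r = r} r≈0 e = Elim-cong T (λ i → drop (does (i ≟ u)) i) refl e
      where
      drop : ∀ b i → d i - (if b then r else 𝟘) ≈ d i
      drop true i  = trans (+-congˡ (-‿cong r≈0)) (x-0≈x (d i))
      drop false i = x-0≈x (d i)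
    path-elim (suc a) T u d {r = r} (s , armₛ , r-inv) e = path-elim a (attach T u) zero (ν∷ d) armₛ
      (r , r-inv , Elim-cong T (λ i → +-congʳ (sym (x-0≈x (d i)))) refl e)

    branch-elim : ∀ {n} (T : Tree n) u {a b r r′ m s f} → ArmVal ν (fin a) r → ArmVal ν (fin b) r′ →
      m * (ν - r - r′) ≈ 𝟙 → Elim T (reduce u (s + m) constant) f →
      let rooted T′ u′ = addBranch (rooted T u) a b in Elim T′ (reduce u′ s constant) f
    branch-elim T u {a} {b} {r} {r′} {m} {s} armₐ arm_b m-inv e =
      Elim-cong (addPath T₂ (lift a zero) b) (constant-reduce b (lift a (suc u))) refl
      (path-elim b T₂ (lift a zero) (reduce (lift a (suc u)) s constant) arm_b
      (Elim-cong T₂ (λ i → trans (extend-reduce a zero r′ (reduce (suc u) s constant) i)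
                                 (+-congʳ (constant-reduce a (suc u) i))) refl
      (path-elim a (attach T u) zero (reduce zero r′ (reduce (suc u) s constant)) armₐ
      (m , trans (*-congˡ (solve 3 (λ ν r r′ → ν :- :0 :- r′ :- r := ν :- r :- r′) refl ν r r′)) m-inv
         , Elim-cong T (λ i → merge (does (i ≟ u))) refl e))))
      where
      T₂ = addPath (attach T u) zero a
      constant-reduce : ∀ {n} a (u : Fin n) i → extend a (reduce u s constant) i ≈ reduce (lift a u) s constant i
      constant-reduce a u i = trans (extend-reduce a u s constant i) (+-congʳ (extend-constant a i))
      merge : ∀ b → ν - (if b then s + m else 𝟘) ≈ ν - (if b then s else 𝟘) - 𝟘 - 𝟘 - (if b then m else 𝟘)
      merge true  = solve 3 (λ ν s m → ν :- (s :+ m) := ν :- s :- :0 :- :0 :- m) refl ν s m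
      merge false = solve 1 (λ ν → ν :- :0 := ν :- :0 :- :0 :- :0 :- :0) refl ν

    -- Branches are eliminated in the reverse order of their attachment; `s` is what has already
    -- been subtracted at the centre, starting with the central arm.
    branches-elim : ∀ (f g : ℕ → ℕ) (r r′ m : ℕ → Carrier) →
      (∀ i → ArmVal ν (fin (f i)) (r i)) → (∀ i → ArmVal ν (fin (g i)) (r′ i)) →
      (∀ i → m i * (ν - r i - r′ i) ≈ 𝟙) → ∀ l s →
      Elim (Rooted.tree (branches f g l)) (reduce (Rooted.root (branches f g l)) s constant) (ν - s - ∑ l m)
    branches-elim f g r r′ m arm arm′ m-inv zero s = x-0≈x (ν - s)
    branches-elim f g r r′ m arm arm′ m-inv (suc l) s =
      branch-elim (Rooted.tree (branches f g l)) (Rooted.root (branches f g l)) {f l} {g l} (arm l) (arm′ l) (m-inv l)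
      (Elim-cong (Rooted.tree (branches f g l)) (λ _ → refl)
        (solve 4 (λ ν s m M → ν :- (s :+ m) :- M := ν :- s :- (M :+ m)) refl ν s (m l) (∑ l m))
        (branches-elim f g r r′ m arm arm′ m-inv l (s + m l)))

    caterpillar-elim : ∀ k h (V : Val k (fin ∘ h) ν) →
                       Elim (Rooted.tree (caterpillar k h)) constant (value V)
    caterpillar-elim k h V = Elim-cong (Rooted.tree (caterpillar k h)) (extend-constant (h (k ℕ.+ k))) refl
      (path-elim (h (k ℕ.+ k)) (Rooted.tree B) (Rooted.root B) constant (arm V (k ℕ.+ k))
        (branches-elim h (λ i → h (k ℕ.+ i)) (r V) (λ i → r V (k ℕ.+ i)) (m V)
          (arm V) (λ i → arm V (k ℕ.+ i)) (m-inv V) k (r V (k ℕ.+ k))))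
      where
      B = branches h (λ i → h (k ℕ.+ i)) k

  IsEigenvectorᵗ : ∀ {n} → Tree n → Carrier → (Fin n → Carrier) → Set
  IsEigenvectorᵗ T μ w = (∃[ i ] w i ♯ 𝟘) × Kernel T (λ _ → μ) w

  IsSimpleᵗ : ∀ {n} → Tree n → Carrier → Set
  IsSimpleᵗ T μ = ∃[ v ] IsEigenvectorᵗ T μ v ×
    (∀ w → Kernel T (λ _ → μ) w → ∃[ c ] ∀ i → w i ≈ c * v i)

  elim⇒simple : ∀ {n} (T : Tree n) {θ f} → Elim T (λ _ → θ) f → f ≈ 𝟘 → IsSimpleᵗ T θ
  elim⇒simple T e f≈0 = coord T e , ((base T , inj₂ (<-respʳ (sym (coord-base T e)) 0<1)) , coord-kernel T e f≈0) ,
    λ w ker → w (base T) , kernel-coord T e ker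

  eigenvector⇒value≈0 : ∀ {n} (T : Tree n) {ν f w} → Elim T (λ _ → ν) f → IsEigenvectorᵗ T ν w → f ≈ 𝟘
  eigenvector⇒value≈0 T {f = f} {w} e ((i , wᵢ♯0) , ker) = zero-cancelʳ wᵢ♯0 (begin
    f * w i                            ≈⟨ *-congˡ (kernel-coord T e ker i) ⟩
    f * (w (base T) * coord T e i)     ≈⟨ *-assoc _ _ _ ⟨
    f * w (base T) * coord T e i       ≈⟨ *-congʳ (kernel-value T e ker) ⟩
    𝟘 * coord T e i                    ≈⟨ 0*x≈0 _ ⟩
    𝟘                                  ∎)
    where open import Relation.Binary.Reasoning.Setoid setoid

  caterpillar-unique : ∀ k h {θ ν w} → 𝟚 < θ → (V : Val k (fin ∘ h) θ) → value V ≈ 𝟘 →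
    𝟚 < ν → IsEigenvectorᵗ (Rooted.tree (caterpillar k h)) ν w → ν ≈ θ
  caterpillar-unique k h {θ} {ν} 2<θ V root 2<ν eig =
    let V′ = finite-val 2<ν k (fin ∘ h) (λ i → h i , ≡.refl)
        K , 1≤K , dK = value-expands 2<θ 2<ν V V′
        root′ = eigenvector⇒value≈0 (Rooted.tree (caterpillar k h)) (caterpillar-elim ν k h V′) eig
    in x-y≈0⇒x≈y (zero-cancelʳ {y = K} (inj₂ (<-≤-trans 0<1 1≤K))
      (trans (sym dK) (trans (+-cong root′ (-‿cong root)) (x-0≈x 𝟘))))

  sgn : Bool → Carrier
  sgn b = if b then 𝟙 else - 𝟙

  flip : ∀ {n} → Tree n → (Fin n → Carrier) → Fin n → Carrier
  flip T w i = sgn (side T i) * w i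

  sgn-not : ∀ b → sgn (not b) ≈ - sgn b
  sgn-not true  = refl
  sgn-not false = solve 0 (:1 := :- (:- :1)) refl

  flip-flip : ∀ {n} (T : Tree n) w i → flip T (flip T w) i ≈ w i
  flip-flip T w i = twice (side T i)
    where
    twice : ∀ b → sgn b * (sgn b * w i) ≈ w i
    twice true  = solve 1 (λ x → :1 :* (:1 :* x) := x) refl (w i)
    twice false = solve 1 (λ x → (:- :1) :* ((:- :1) :* x) := x) refl (w i)

  flip-apart : ∀ {n} (T : Tree n) w i → w i ♯ 𝟘 → flip T w i ♯ 𝟘
  flip-apart T w i = apart (side T i)
    where
    apart : ∀ b → w i ♯ 𝟘 → sgn b * w i ♯ 𝟘
    apart true  p = ♯-respˡ (sym (1*x≈x (w i))) p
    apart false (inj₁ w<0) = inj₂ (<-by (<⇒0< w<0) (solve 1 (λ x → :0 :- x := (:- :1) :* x :- :0) refl (w i)))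
    apart false (inj₂ 0<w) = inj₁ (<-by (<⇒0< 0<w) (solve 1 (λ x → x :- :0 := :0 :- (:- :1) :* x) refl (w i)))

  -- Adjacent vertices carry opposite signs, so the adjacency matrix anticommutes with the diagonal
  -- matrix of signs.
  flip-kernel : ∀ {n} (T : Tree n) {μ w} → Kernel T (λ _ → μ) w → Kernel T (λ _ → - μ) (flip T w)
  flip-kernel T {μ} {w} ker i = begin
    sum (λ j → matrix T i j * flip T w j)           ≈⟨ sum-cong (λ j → entry j (adj T i j) (adj⇒sides-differ T i j)) ⟩
    sum (λ j → (- sgn (side T i)) * (matrix T i j * w j)) ≈⟨ sum-*ˡ (- sgn (side T i)) (λ j → matrix T i j * w j) ⟩
    (- sgn (side T i)) * sum (λ j → matrix T i j * w j)   ≈⟨ *-congˡ (ker i) ⟩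
    (- sgn (side T i)) * (μ * w i)
      ≈⟨ solve 3 (λ s m x → (:- s) :* (m :* x) := (:- m) :* (s :* x)) refl (sgn (side T i)) μ (w i) ⟩
    (- μ) * flip T w i                              ∎
    where
    open import Relation.Binary.Reasoning.Setoid setoid
    entry : ∀ j b → (b ≡ true → side T i ≡ not (side T j)) →
            (if b then 𝟙 else 𝟘) * flip T w j ≈ (- sgn (side T i)) * ((if b then 𝟙 else 𝟘) * w j)
    entry j false _ = solve 3 (λ s s′ x → :0 :* (s :* x) := (:- s′) :* (:0 :* x)) refl
      (sgn (side T j)) (sgn (side T i)) (w j)
    entry j true differ = combine₁ (w j)
      (trans (reflexive (≡.cong sgn (differ ≡.refl))) (sgn-not (side T j)))
      (solve 3 (λ s s′ x → :1 :* (s :* x) :- (:- s′) :* (:1 :* x) := x :* (s′ :- (:- s))) refl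
        (sgn (side T j)) (sgn (side T i)) (w j))

  flip-eigenvector : ∀ {n} (T : Tree n) {μ w} → IsEigenvectorᵗ T μ w → IsEigenvectorᵗ T (- μ) (flip T w)
  flip-eigenvector T {w = w} ((i , wᵢ♯0) , ker) = (i , flip-apart T w i wᵢ♯0) , flip-kernel T ker

  flip-simple : ∀ {n} (T : Tree n) {μ} → IsSimpleᵗ T μ → IsSimpleᵗ T (- μ)
  flip-simple T {μ} (v , eig , span) = flip T v , flip-eigenvector T eig , λ w ker →
    let c , w≈cv = span (flip T w) (λ i → trans (flip-kernel T ker i) (*-congʳ (solve 1 (λ x → :- (:- x) := x) refl μ)))
    in c , λ i → trans (sym (flip-flip T w i)) (trans (*-congˡ (w≈cv i))
      (solve 3 (λ s c x → s :* (c :* x) := c :* (s :* x)) refl (sgn (side T i)) c (v i)))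

  caterpillar-unique⁻ : ∀ k h {θ ν w} → 𝟚 < θ → (V : Val k (fin ∘ h) θ) → value V ≈ 𝟘 →
    ν < - 𝟚 → IsEigenvectorᵗ (Rooted.tree (caterpillar k h)) ν w → ν ≈ - θ
  caterpillar-unique⁻ k h {θ} {ν} 2<θ V root ν<-2 eig = trans
    (solve 1 (λ x → x := :- (:- x)) refl ν)
    (-‿cong (caterpillar-unique k h 2<θ V root
      (<-by (<⇒0< ν<-2) (solve 1 (λ x → (:- :2) :- x := (:- x) :- :2) refl ν))
      (flip-eigenvector (Rooted.tree (caterpillar k h)) eig)))

  record Spectrum {n} (T : Tree n) (θ : Carrier) : Set where
    field
      above2  : 𝟚 < θ
      simple  : IsSimpleᵗ T θ
      unique  : ∀ μ w → 𝟚 < μ → IsEigenvectorᵗ T μ w → μ ≈ θ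
      unique⁻ : ∀ μ w → μ < - 𝟚 → IsEigenvectorᵗ T μ w → μ ≈ - θ

  caterpillar-spectrum : ∀ k h {θ} → 𝟚 < θ → (V : Val k (fin ∘ h) θ) → value V ≈ 𝟘 →
                         Spectrum (Rooted.tree (caterpillar k h)) θ
  caterpillar-spectrum k h {θ} 2<θ V root = record
    { above2  = 2<θ
    ; simple  = elim⇒simple (Rooted.tree (caterpillar k h)) (caterpillar-elim θ k h V) root
    ; unique  = λ _ _ → caterpillar-unique k h 2<θ V root
    ; unique⁻ = λ _ _ → caterpillar-unique⁻ k h 2<θ V root
    }

-- The rationals as an ordered field

invℚ : ℚ → ℚ
-- A default at zero makes inversion total: a positive real may have vanishing initial terms, and
-- its inverse is still taken term by term.
invℚ   (mkℚ +0       _ _) = 0ℚ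
invℚ p@(mkℚ +[1+ _ ] _ _) = ℚ.1/ p
invℚ p@(mkℚ -[1+ _ ] _ _) = ℚ.1/ p

invℚ-inverseʳ : ∀ p → 0ℚ ℚ.< p → p ℚ.* invℚ p ≡ 1ℚ
invℚ-inverseʳ   (mkℚ +0       _ _) 0<p = ⊥-elim (ℤ.<-irrefl ≡.refl (ℚ.drop-*<* 0<p))
invℚ-inverseʳ p@(mkℚ +[1+ _ ] _ _) 0<p = ℚ.*-inverseʳ p
invℚ-inverseʳ p@(mkℚ -[1+ _ ] _ _) 0<p = ℚ.*-inverseʳ p

invℚ-pos : ∀ p → 0ℚ ℚ.< p → 0ℚ ℚ.< invℚ p
invℚ-pos   (mkℚ +0       _ _) 0<p = ⊥-elim (ℤ.<-irrefl ≡.refl (ℚ.drop-*<* 0<p))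
invℚ-pos p@(mkℚ +[1+ _ ] _ _) 0<p = ℚ.positive⁻¹ (ℚ.1/ p) {{ℚ.1/pos⇒pos p}}
invℚ-pos p@(mkℚ -[1+ _ ] _ _) (ℚ.*<* ())

archimedeanℚ : ∀ p → ∃[ n ] p ℚ.< ℤ.+ n ℚ./ 1
archimedeanℚ p@(mkℚ n d _) = suc ℤ.∣ n ∣ , ℚ.toℚᵘ-cancel-<
  (ℚᵘ.<-respʳ-≃ (ℚᵘ.≃-sym (ℚ.toℚᵘ-fromℚᵘ (ℚᵘ.mkℚᵘ (ℤ.+ suc ℤ.∣ n ∣) 0)))
    (ℚᵘ.*<* (≡.subst (ℤ._< ℤ.+ suc ℤ.∣ n ∣ ℤ.* ℤ.+ suc d) (≡.sym (ℤ.*-identityʳ n))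
      (≡.subst (n ℤ.<_) (ℤ.pos-* (suc ℤ.∣ n ∣) (suc d)) (n< n)))))
  where
  n< : ∀ n → n ℤ.< ℤ.+ (suc ℤ.∣ n ∣ ℕ.* suc d)
  n< (ℤ.+ m)  = ℤ.+<+ (ℕ.m≤m*n (suc m) (suc d))
  n< -[1+ m ] = ℤ.-<+

ℚ-field : OrderedField
ℚ-field = record
  { commutativeRing = ℚ.+-*-commutativeRing
  ; ι = λ p → p
  ; ι-+ = λ _ _ → ≡.refl
  ; ι-* = λ _ _ → ≡.refl
  ; ι-‿ = λ _ → ≡.refl
  ; ι-0 = ≡.refl
  ; ι-1 = ≡.refl
  ; _<_ = ℚ._<_
  ; <-resp = λ { ≡.refl ≡.refl p → p }
  ; <-irrefl = ℚ.<-irrefl ≡.refl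
  ; <-trans = ℚ.<-trans
  ; <-cotrans = cotrans
  ; <-tight = tight
  ; +-monoˡ-< = λ r → ℚ.+-monoˡ-< r
  ; *-pos = λ {p} {q} 0<p 0<q → ℚ.positive⁻¹ (p ℚ.* q)
      {{ℚ.pos*pos⇒pos p {{ℚ.positive 0<p}} q {{ℚ.positive 0<q}}}}
  ; inv = λ p _ → invℚ p
  ; inv-inverseʳ = invℚ-inverseʳ
  ; inv-pos = invℚ-pos
  ; ι-mono-< = λ p → p
  ; archimedean = archimedeanℚ
  }
  where
  cotrans : ∀ {p q} r → p ℚ.< q → p ℚ.< r ⊎ r ℚ.< q
  cotrans {p} r p<q with p ℚ.<? r
  ... | yes p<r = inj₁ p<r
  ... | no p≮r  = inj₂ (ℚ.≤-<-trans (ℚ.≮⇒≥ p≮r) p<q)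
  tight : ∀ {p q} → ¬ p ℚ.< q → ¬ q ℚ.< p → p ≡ q
  tight {p} {q} p≮q q≮p with ℚ.<-cmp p q
  ... | tri< p<q _ _ = ⊥-elim (p≮q p<q)
  ... | tri≈ _ p≡q _ = p≡q
  ... | tri> _ _ q<p = ⊥-elim (q≮p q<p)

-- The Cauchy reals as an ordered field

module RealProperties where
  open OrderedFieldProperties ℚ-field
  open OrderedField ℚ-field using (*-pos)
  open Real using (_≈_; _<_; _+_; _*_; -_; _-_)

  infixr 4 _&_
  _&_ : ∀ {P Q} → Eventually P → Eventually Q → Eventually (λ n → P n × Q n)
  (M , p) & (N , q) = M ⊔ N , λ n M⊔N≤n →
    p n (ℕ.m⊔n≤o⇒m≤o M N M⊔N≤n) , q n (ℕ.m⊔n≤o⇒n≤o M N M⊔N≤n)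

  eventually-map : ∀ {P Q} → (∀ n → P n → Q n) → Eventually P → Eventually Q
  eventually-map f (N , p) = N , λ n N≤n → f n (p n N≤n)

  ∣∣<-intro : ∀ {a ε} → a ℚ.< ε → ℚ.- ε ℚ.< a → ∣ a ∣ ℚ.< ε
  ∣∣<-intro {a} {ε} a<ε -ε<a with ℚ.∣p∣≡p∨∣p∣≡-p a
  ... | inj₁ e = ≡.subst (ℚ._< ε) (≡.sym e) a<ε
  ... | inj₂ e = ≡.subst (ℚ._< ε) (≡.sym e)
    (<-by (<⇒0< -ε<a) (solve 2 (λ a ε → a :- (:- ε) := ε :- (:- a)) ≡.refl a ε))

  ∣∣<-elimʳ : ∀ {a ε} → ∣ a ∣ ℚ.< ε → a ℚ.< ε
  ∣∣<-elimʳ {a} = ℚ.≤-<-trans (p≤∣p∣ (ℚ.≤-total 0ℚ a))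
    where
    p≤∣p∣ : 0ℚ ℚ.≤ a ⊎ a ℚ.≤ 0ℚ → a ℚ.≤ ∣ a ∣
    p≤∣p∣ (inj₁ 0≤a) = ℚ.≤-reflexive (≡.sym (ℚ.0≤p⇒∣p∣≡p 0≤a))
    p≤∣p∣ (inj₂ a≤0) = ℚ.≤-trans a≤0 (ℚ.0≤∣p∣ a)

  ∣∣<-elimˡ : ∀ {a ε} → ∣ a ∣ ℚ.< ε → ℚ.- ε ℚ.< a
  ∣∣<-elimˡ {a} {ε} ∣a∣<ε = <-by
    (<⇒0< (∣∣<-elimʳ (≡.subst (ℚ._< ε) (≡.sym (ℚ.∣-p∣≡∣p∣ a)) ∣a∣<ε)))
    (solve 2 (λ a ε → ε :- (:- a) := a :- (:- ε)) ≡.refl a ε)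

  -- A bound on an absolute value, split into two linear inequalities so that certificates for the
  -- ring solver can be added up.
  record Near (ε a b : ℚ) : Set where
    constructor within
    field
      below : a ℚ.< b ℚ.+ ε
      above : b ℚ.< a ℚ.+ ε

  near : ∀ {a b ε} → ∣ a ℚ.- b ∣ ℚ.< ε → Near ε a b
  near {a} {b} {ε} p = within
    (<-by (<⇒0< (∣∣<-elimʳ p)) (solve 3 (λ a b ε → ε :- (a :- b) := b :+ ε :- a) ≡.refl a b ε))
    (<-by (<⇒0< (∣∣<-elimˡ p)) (solve 3 (λ a b ε → a :- b :- (:- ε) := a :+ ε :- b) ≡.refl a b ε))

  near⁻¹ : ∀ {a b ε} → Near ε a b → ∣ a ℚ.- b ∣ ℚ.< ε
  near⁻¹ {a} {b} {ε} (within p q) = ∣∣<-intro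
    (<-by (<⇒0< p) (solve 3 (λ a b ε → b :+ ε :- a := ε :- (a :- b)) ≡.refl a b ε))
    (<-by (<⇒0< q) (solve 3 (λ a b ε → a :+ ε :- b := a :- b :- (:- ε)) ≡.refl a b ε))

  near-sym : ∀ {a b ε} → Near ε a b → Near ε b a
  near-sym (within p q) = within q p

  near-refl : ∀ {a b ε} → 0ℚ ℚ.< ε → a ≡ b → Near ε a b
  near-refl {a} {ε = ε} 0<ε ≡.refl = within a<a+ε a<a+ε
    where
    a<a+ε : a ℚ.< a ℚ.+ ε
    a<a+ε = <-by 0<ε (solve 2 (λ a ε → ε := a :+ ε :- a) ≡.refl a ε)

  near-trans : ∀ {a b c δ ε} → Near δ a b → Near ε b c → Near (δ ℚ.+ ε) a c
  near-trans {a} {b} {c} {δ} {ε} (within p p′) (within q q′) = within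
    (<-by (ℚ.+-mono-< (<⇒0< p) (<⇒0< q)) (solve 5 (λ a b c δ ε →
      b :+ δ :- a :+ (c :+ ε :- b) := c :+ (δ :+ ε) :- a) ≡.refl a b c δ ε))
    (<-by (ℚ.+-mono-< (<⇒0< p′) (<⇒0< q′)) (solve 5 (λ a b c δ ε →
      a :+ δ :- b :+ (b :+ ε :- c) := a :+ (δ :+ ε) :- c) ≡.refl a b c δ ε))

  near-+ : ∀ {a b c d δ ε} → Near δ a b → Near ε c d → Near (δ ℚ.+ ε) (a ℚ.+ c) (b ℚ.+ d)
  near-+ {a} {b} {c} {d} {δ} {ε} (within p p′) (within q q′) = within
    (<-by (ℚ.+-mono-< (<⇒0< p) (<⇒0< q)) (solve 6 (λ a b c d δ ε →
      b :+ δ :- a :+ (d :+ ε :- c) := b :+ d :+ (δ :+ ε) :- (a :+ c)) ≡.refl a b c d δ ε))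
    (<-by (ℚ.+-mono-< (<⇒0< p′) (<⇒0< q′)) (solve 6 (λ a b c d δ ε →
      a :+ δ :- b :+ (c :+ ε :- d) := a :+ c :+ (δ :+ ε) :- (b :+ d)) ≡.refl a b c d δ ε))

  near-neg : ∀ {a b ε} → Near ε a b → Near ε (ℚ.- a) (ℚ.- b)
  near-neg {a} {b} {ε} (within p q) = within
    (<-by (<⇒0< q) (solve 3 (λ a b ε → a :+ ε :- b := :- b :+ ε :- (:- a)) ≡.refl a b ε))
    (<-by (<⇒0< p) (solve 3 (λ a b ε → b :+ ε :- a := :- a :+ ε :- (:- b)) ≡.refl a b ε))

  -- The sign of `c` is unknown. Averaging the two given bounds with the positive weights `K - c`
  -- and `K + c` treats both signs at once.
  near-* : ∀ {K a b c ε} → ∣ c ∣ ℚ.< K → Near ε a b → Near (K ℚ.* ε) (c ℚ.* a) (c ℚ.* b)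
  near-* {K} {a} {b} {c} {ε} ∣c∣<K (within p q) = within
    (<-by (*-pos 0<½ (ℚ.+-mono-< (*-pos 0<K-c (<⇒0< q)) (*-pos 0<K+c (<⇒0< p)))) (solve 5 (λ K a b c ε →
      con ½ :* ((K :- c) :* (a :+ ε :- b) :+ (c :- (:- K)) :* (b :+ ε :- a)) := c :* b :+ K :* ε :- c :* a)
      ≡.refl K a b c ε))
    (<-by (*-pos 0<½ (ℚ.+-mono-< (*-pos 0<K-c (<⇒0< p)) (*-pos 0<K+c (<⇒0< q)))) (solve 5 (λ K a b c ε →
      con ½ :* ((K :- c) :* (b :+ ε :- a) :+ (c :- (:- K)) :* (a :+ ε :- b)) := c :* a :+ K :* ε :- c :* b)
      ≡.refl K a b c ε))
    where
    0<½ = ι-pos ½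
    0<K-c = <⇒0< (∣∣<-elimʳ ∣c∣<K)
    0<K+c = <⇒0< (∣∣<-elimˡ ∣c∣<K)

  half : ∀ {ε} → 0ℚ ℚ.< ε → 0ℚ ℚ.< ε ℚ.* ½
  half 0<ε = *-pos 0<ε (ι-pos ½)

  half+half : ∀ ε → ε ℚ.* ½ ℚ.+ ε ℚ.* ½ ≡ ε
  half+half = solve 1 (λ ε → ε :* con ½ :+ ε :* con ½ := ε) ≡.refl

  near-halves : ∀ {ε a b} → Near (ε ℚ.* ½ ℚ.+ ε ℚ.* ½) a b → Near ε a b
  near-halves {ε} {a} {b} = ≡.subst (λ δ → Near δ a b) (half+half ε)

  eighth : ∀ {ε} → 0ℚ ℚ.< ε → 0ℚ ℚ.< ε ℚ.* (ℤ.+ 1 ℚ./ 8)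
  eighth 0<ε = *-pos 0<ε (ι-pos (ℤ.+ 1 ℚ./ 8))

  infix 4 _∼_
  _∼_ : (x y : ℕ → ℚ) → Set
  x ∼ y = ∀ ε → 0ℚ ℚ.< ε → Eventually (λ n → Near ε (x n) (y n))

  ≈⇒∼ : ∀ x y → x ≈ y → seq x ∼ seq y
  ≈⇒∼ _ _ x≈y ε 0<ε = eventually-map (λ _ → near) (x≈y ε 0<ε)

  ∼⇒≈ : ∀ x y → seq x ∼ seq y → x ≈ y
  ∼⇒≈ _ _ x∼y ε 0<ε = eventually-map (λ _ → near⁻¹) (x∼y ε 0<ε)

  pointwise : ∀ x y → (∀ n → seq x n ≡ seq y n) → x ≈ y
  pointwise x y e = ∼⇒≈ x y λ ε 0<ε → 0 , λ n _ → near-refl 0<ε (e n)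

  ≈-sym : ∀ x y → x ≈ y → y ≈ x
  ≈-sym x y x≈y = ∼⇒≈ y x λ ε 0<ε → eventually-map (λ _ → near-sym) (≈⇒∼ x y x≈y ε 0<ε)

  ≈-trans : ∀ x y z → x ≈ y → y ≈ z → x ≈ z
  ≈-trans x y z x≈y y≈z = ∼⇒≈ x z λ ε 0<ε → eventually-map (λ _ (p , q) → near-halves (near-trans p q))
    (≈⇒∼ x y x≈y _ (half 0<ε) & ≈⇒∼ y z y≈z _ (half 0<ε))

  +-cong : ∀ x x′ y y′ → x ≈ x′ → y ≈ y′ → x + y ≈ x′ + y′
  +-cong x x′ y y′ x≈x′ y≈y′ = ∼⇒≈ (x + y) (x′ + y′) λ ε 0<ε →
    eventually-map (λ _ (p , q) → near-halves (near-+ p q))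
      (≈⇒∼ x x′ x≈x′ _ (half 0<ε) & ≈⇒∼ y y′ y≈y′ _ (half 0<ε))

  neg-cong : ∀ x y → x ≈ y → - x ≈ - y
  neg-cong x y x≈y = ∼⇒≈ (- x) (- y) λ ε 0<ε → eventually-map (λ _ → near-neg) (≈⇒∼ x y x≈y ε 0<ε)

  eventually-bounded : ∀ x → ∃[ K ] 0ℚ ℚ.< K × Eventually (λ n → ∣ seq x n ∣ ℚ.< K)
  eventually-bounded x =
    let K , N , x<K = bounded (seq x) (cauchy x)
    in K , ℚ.≤-<-trans (ℚ.0≤∣p∣ (seq x N)) (x<K N ℕ.≤-refl) , N , x<K

  *-congˡ : ∀ x y z → x ≈ y → z * x ≈ z * y
  *-congˡ x y z x≈y = ∼⇒≈ (z * x) (z * y) λ ε 0<ε →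
    let K , 0<K , bound = eventually-bounded z
    in eventually-map (λ n (p , q) →
         ≡.subst (λ δ → Near δ (seq z n ℚ.* seq x n) (seq z n ℚ.* seq y n))
           (cancel K (invℚ K) ε (invℚ-inverseʳ K 0<K)) (near-* p q))
       (bound & ≈⇒∼ x y x≈y _ (*-pos 0<ε (invℚ-pos K 0<K)))
    where
    cancel : ∀ K i ε → K ℚ.* i ≡ 1ℚ → K ℚ.* (ε ℚ.* i) ≡ ε
    cancel K i ε e = combine₁ ε e
      (solve 3 (λ K i ε → K :* (ε :* i) :- ε := ε :* (K :* i :- :1)) ≡.refl K i ε)

  *-comm : ∀ x y → x * y ≈ y * x
  *-comm x y = pointwise (x * y) (y * x) λ n → ℚ.*-comm (seq x n) (seq y n)

  *-cong : ∀ x x′ y y′ → x ≈ x′ → y ≈ y′ → x * y ≈ x′ * y′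
  *-cong x x′ y y′ x≈x′ y≈y′ = ≈-trans (x * y) (x * y′) (x′ * y′)
    (*-congˡ y y′ x y≈y′) (≈-trans (x * y′) (y′ * x) (x′ * y′) (*-comm x y′)
    (≈-trans (y′ * x) (y′ * x′) (x′ * y′) (*-congˡ x x′ y′ x≈x′) (*-comm y′ x′)))

  commutativeRing : CommutativeRing 0ℓ 0ℓ
  commutativeRing = record
    { Carrier = ℝ ; _≈_ = _≈_ ; _+_ = Real._+_ ; _*_ = Real._*_ ; -_ = Real.-_
    ; 0# = fromℚ 0ℚ ; 1# = fromℚ 1ℚ
    ; isCommutativeRing = record
      { isRing = record
        { +-isAbelianGroup = record
          { isGroup = record
            { isMonoid = record
              { isSemigroup = record
                { isMagma = record
                  { isEquivalence = record
                    { refl  = λ {x} → pointwise x x (λ _ → ≡.refl)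
                    ; sym   = λ {x} {y} → ≈-sym x y
                    ; trans = λ {x} {y} {z} → ≈-trans x y z
                    }
                  ; ∙-cong = λ {x} {x′} {y} {y′} → +-cong x x′ y y′
                  }
                ; assoc = λ x y z → pointwise (x + y + z) (x + (y + z)) λ n → ℚ.+-assoc (seq x n) (seq y n) (seq z n)
                }
              ; identity = (λ x → pointwise (fromℚ 0ℚ + x) x λ n → ℚ.+-identityˡ (seq x n)) ,
                           (λ x → pointwise (x + fromℚ 0ℚ) x λ n → ℚ.+-identityʳ (seq x n))
              }
            ; inverse = (λ x → pointwise (- x + x) (fromℚ 0ℚ) λ n → ℚ.+-inverseˡ (seq x n)) ,
                        (λ x → pointwise (x - x) (fromℚ 0ℚ) λ n → ℚ.+-inverseʳ (seq x n))
            ; ⁻¹-cong = λ {x} {y} → neg-cong x y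
            }
          ; comm = λ x y → pointwise (x + y) (y + x) λ n → ℚ.+-comm (seq x n) (seq y n)
          }
        ; *-cong = λ {x} {x′} {y} {y′} → *-cong x x′ y y′
        ; *-assoc = λ x y z → pointwise (x * y * z) (x * (y * z)) λ n → ℚ.*-assoc (seq x n) (seq y n) (seq z n)
        ; *-identity = (λ x → pointwise (fromℚ 1ℚ * x) x λ n → ℚ.*-identityˡ (seq x n)) ,
                       (λ x → pointwise (x * fromℚ 1ℚ) x λ n → ℚ.*-identityʳ (seq x n))
        ; distrib = (λ x y z → pointwise (x * (y + z)) (x * y + x * z) λ n →
                      ℚ.*-distribˡ-+ (seq x n) (seq y n) (seq z n)) ,
                    (λ x y z → pointwise ((y + z) * x) (y * x + z * x) λ n →
                      ℚ.*-distribʳ-+ (seq x n) (seq y n) (seq z n))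
        }
      ; *-comm = *-comm
      }
    }

  settle : ∀ x y ε → 0ℚ ℚ.< ε →
    ∃[ M ] ∀ n → M ℕ.≤ n → Near ε (seq x M) (seq x n) × Near ε (seq y M) (seq y n)
  settle x y ε 0<ε =
    let N₁ , close₁ = cauchy x ε 0<ε
        N₂ , close₂ = cauchy y ε 0<ε
        M = N₁ ⊔ N₂
    in M , λ n M≤n →
      near (close₁ M n (ℕ.m≤m⊔n N₁ N₂) (ℕ.m⊔n≤o⇒m≤o N₁ N₂ M≤n)) ,
      near (close₂ M n (ℕ.m≤n⊔m N₁ N₂) (ℕ.m⊔n≤o⇒n≤o N₁ N₂ M≤n))

  -- x < y may be checked at a single index beyond which both sequences stay put.
  settled-< : ∀ x y ε → 0ℚ ℚ.< ε → ∀ {M} →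
    (∀ n → M ℕ.≤ n → Near ε (seq x M) (seq x n) × Near ε (seq y M) (seq y n)) →
    seq x M ℚ.+ ε ℚ.+ ε ℚ.+ ε ℚ.< seq y M → x < y
  settled-< x y ε 0<ε {M} settled gap = ε , 0<ε , M , λ n M≤n →
    let within _ p , within q _ = settled n M≤n
    in <-by (ℚ.+-mono-< (<⇒0< gap) (ℚ.+-mono-< (<⇒0< p) (<⇒0< q)))
      (solve 5 (λ x y x′ y′ ε → y :- (x :+ ε :+ ε :+ ε) :+ (x :+ ε :- x′ :+ (y′ :+ ε :- y)) :=
        y′ :- (x′ :+ ε)) ≡.refl (seq x M) (seq y M) (seq x n) (seq y n) ε)

  <-resp : ∀ x x′ y y′ → x ≈ x′ → y ≈ y′ → x < y → x′ < y′
  <-resp x x′ y y′ x≈x′ y≈y′ (ε , 0<ε , x<y) = ε ℚ.* ½ , half 0<ε ,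
    eventually-map (λ n (p , within _ x′<x , within y<y′ _) →
      <-by (ℚ.+-mono-< (<⇒0< p) (ℚ.+-mono-< (<⇒0< x′<x) (<⇒0< y<y′)))
        (solve 5 (λ x x′ y y′ ε →
          y :- (x :+ ε) :+ (x :+ ε :* con (ℤ.+ 1 ℚ./ 8) :- x′ :+ (y′ :+ ε :* con (ℤ.+ 3 ℚ./ 8) :- y)) :=
          y′ :- (x′ :+ ε :* con ½)) ≡.refl (seq x n) (seq x′ n) (seq y n) (seq y′ n) ε))
    (x<y & ≈⇒∼ x x′ x≈x′ _ (eighth 0<ε) & ≈⇒∼ y y′ y≈y′ _ (*-pos 0<ε (ι-pos (ℤ.+ 3 ℚ./ 8))))

  <-irrefl : ∀ x → ¬ x < x
  <-irrefl x (ε , 0<ε , N , p) = <⇒≤ 0<ε (<-by (<⇒0< (p N ℕ.≤-refl))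
    (solve 2 (λ x ε → x :- (x :+ ε) := :0 :- ε) ≡.refl (seq x N) ε))

  <-trans : ∀ x y z → x < y → y < z → x < z
  <-trans x y z (ε , 0<ε , x<y) (δ , 0<δ , y<z) = ε , 0<ε , eventually-map (λ n (p , q) →
    <-by (ℚ.+-mono-< (<⇒0< p) (ℚ.+-mono-< (<⇒0< q) 0<δ))
      (solve 5 (λ x y z ε δ → y :- (x :+ ε) :+ (z :- (y :+ δ) :+ δ) := z :- (x :+ ε)) ≡.refl
        (seq x n) (seq y n) (seq z n) ε δ)) (x<y & y<z)

  -- One rational comparison at a settled index decides. With `ε = 8 η`, a gap above `3 η` between
  -- `x` and `z` survives later fluctuations below `η`; otherwise `z` stays within `5 η` above `x`,
  -- hence more than `η` below `y`.
  <-cotrans : ∀ x y z → x < y → x < z ⊎ z < y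
  <-cotrans x y z (ε , 0<ε , N , x<y) = compare (settle x z η 0<η)
    where
    η = ε ℚ.* (ℤ.+ 1 ℚ./ 8)
    0<η = eighth 0<ε
    :η : ∀ {n} → Polynomial n → Polynomial n
    :η ε = ε :* con (ℤ.+ 1 ℚ./ 8)
    arith : ∀ {x z x′ y′ z′} → x′ ℚ.+ ε ℚ.< y′ → x ℚ.< x′ ℚ.+ η → z′ ℚ.< z ℚ.+ η →
            ¬ x ℚ.+ η ℚ.+ η ℚ.+ η ℚ.< z → z′ ℚ.+ η ℚ.< y′
    arith {x} {z} {x′} {y′} {z′} r p q ¬gap = <-by
      (+-pos-≥0 (ℚ.+-mono-< (<⇒0< p) (ℚ.+-mono-< (<⇒0< q) (ℚ.+-mono-< (<⇒0< r) (*-pos 0<ε (ι-pos (ℤ.+ 2 ℚ./ 8))))))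
        (≤⇒0≤ ¬gap))
      (solve 6 (λ x z x′ y′ z′ ε →
        x′ :+ :η ε :- x :+ (z :+ :η ε :- z′ :+ (y′ :- (x′ :+ ε) :+ ε :* con (ℤ.+ 2 ℚ./ 8)))
          :+ (x :+ :η ε :+ :η ε :+ :η ε :- z) := y′ :- (z′ :+ :η ε)) ≡.refl x z x′ y′ z′ ε)
    compare : (∃[ M ] ∀ n → M ℕ.≤ n → Near η (seq x M) (seq x n) × Near η (seq z M) (seq z n)) →
              x < z ⊎ z < y
    compare (M , settled) = decide (seq x M ℚ.+ η ℚ.+ η ℚ.+ η ℚ.<? seq z M)
      where
      decide : Dec (seq x M ℚ.+ η ℚ.+ η ℚ.+ η ℚ.< seq z M) → x < z ⊎ z < y
      decide (yes gap) = inj₁ (settled-< x z η 0<η settled gap)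
      decide (no ¬gap) = inj₂ (η , 0<η , M ⊔ N , λ n M⊔N≤n →
        let within p _ , within _ q = settled n (ℕ.m⊔n≤o⇒m≤o M N M⊔N≤n)
        in arith {x′ = seq x n} (x<y n (ℕ.m⊔n≤o⇒n≤o M N M⊔N≤n)) p q ¬gap)

  <-tight : ∀ x y → ¬ x < y → ¬ y < x → x ≈ y
  <-tight x y x≮y y≮x = ∼⇒≈ x y close
    where
    :η : ∀ {n} → Polynomial n → Polynomial n
    :η ε = ε :* con (ℤ.+ 1 ℚ./ 8)
    close : seq x ∼ seq y
    close ε 0<ε = M , λ n M≤n → both n (settled n M≤n)
      where
      η = ε ℚ.* (ℤ.+ 1 ℚ./ 8)
      0<η = eighth 0<ε
      M = proj₁ (settle x y η 0<η)
      settled = proj₂ (settle x y η 0<η)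
      one-sided : ∀ {a b a′ b′} → a′ ℚ.< a ℚ.+ η → b ℚ.< b′ ℚ.+ η →
                  ¬ b ℚ.+ η ℚ.+ η ℚ.+ η ℚ.< a → a′ ℚ.< b′ ℚ.+ ε
      one-sided {a} {b} {a′} {b′} p q r = <-by
        (+-pos-≥0 (ℚ.+-mono-< (<⇒0< p) (ℚ.+-mono-< (<⇒0< q) (*-pos 0<ε (ι-pos (ℤ.+ 3 ℚ./ 8))))) (≤⇒0≤ r))
        (solve 5 (λ a b a′ b′ ε → a :+ :η ε :- a′ :+ (b′ :+ :η ε :- b :+ ε :* con (ℤ.+ 3 ℚ./ 8))
          :+ (b :+ :η ε :+ :η ε :+ :η ε :- a) := b′ :+ ε :- a′) ≡.refl a b a′ b′ ε)
      both : ∀ n → Near η (seq x M) (seq x n) × Near η (seq y M) (seq y n) → Near ε (seq x n) (seq y n)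
      both n (within x<x′ x′<x , within y<y′ y′<y) = within
        (one-sided {b′ = seq y n} x′<x y<y′ (λ gap →
          y≮x (settled-< y x η 0<η (λ n M≤n → proj₂ (settled n M≤n) , proj₁ (settled n M≤n)) gap)))
        (one-sided {b′ = seq x n} y′<y x<x′ (λ gap → x≮y (settled-< x y η 0<η settled gap)))

  +-monoˡ-< : ∀ x y z → x < y → x + z < y + z
  +-monoˡ-< x y z (ε , 0<ε , x<y) = ε , 0<ε , eventually-map (λ n p → <-by (<⇒0< p)
    (solve 4 (λ x y z ε → y :- (x :+ ε) := y :+ z :- (x :+ z :+ ε)) ≡.refl (seq x n) (seq y n) (seq z n) ε)) x<y

  0<⇒eventually : ∀ x → ((ε , _) : fromℚ 0ℚ < x) → Eventually (λ n → ε ℚ.< seq x n)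
  0<⇒eventually x (ε , 0<ε , p) = eventually-map
    (λ n → ≡.subst (ℚ._< seq x n) (ℚ.+-identityˡ ε)) p

  eventually⇒0< : ∀ x ε → 0ℚ ℚ.< ε → Eventually (λ n → ε ℚ.< seq x n) → fromℚ 0ℚ < x
  eventually⇒0< x ε 0<ε p = ε , 0<ε , eventually-map
    (λ n → ≡.subst (ℚ._< seq x n) (≡.sym (ℚ.+-identityˡ ε))) p

  *-pos-ℝ : ∀ x y → fromℚ 0ℚ < x → fromℚ 0ℚ < y → fromℚ 0ℚ < x * y
  *-pos-ℝ x y 0<x@(ε , 0<ε , _) 0<y@(δ , 0<δ , _) = eventually⇒0< (x * y) (ε ℚ.* δ) (*-pos 0<ε 0<δ)
    (eventually-map (λ n (p , q) → <-by
      (ℚ.+-mono-< (*-pos (<⇒0< p) (ℚ.<-trans 0<δ q)) (*-pos 0<ε (<⇒0< q)))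
      (solve 4 (λ x y ε δ → (x :- ε) :* y :+ ε :* (y :- δ) := x :* y :- ε :* δ) ≡.refl (seq x n) (seq y n) ε δ))
      (0<⇒eventually x 0<x & 0<⇒eventually y 0<y))

  -- 1/a - 1/b = (b - a)/(ab), and ab exceeds ε².
  inv-near : ∀ {ε η a b} → 0ℚ ℚ.< ε → 0ℚ ℚ.< η → ε ℚ.< a → ε ℚ.< b → Near (η ℚ.* (ε ℚ.* ε)) a b →
             Near η (invℚ a) (invℚ b)
  inv-near {ε} {η} {a} {b} 0<ε 0<η ε<a ε<b (within a<b b<a) = within
    (below (invℚ-inverseʳ a 0<a) (invℚ-inverseʳ b 0<b) (invℚ-pos a 0<a) (invℚ-pos b 0<b) ε<a ε<b b<a)
    (below (invℚ-inverseʳ b 0<b) (invℚ-inverseʳ a 0<a) (invℚ-pos b 0<b) (invℚ-pos a 0<a) ε<b ε<a a<b)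
    where
    0<a = ℚ.<-trans 0<ε ε<a
    0<b = ℚ.<-trans 0<ε ε<b
    below : ∀ {a b i j} → a ℚ.* i ≡ 1ℚ → b ℚ.* j ≡ 1ℚ → 0ℚ ℚ.< i → 0ℚ ℚ.< j → ε ℚ.< a → ε ℚ.< b →
            b ℚ.< a ℚ.+ η ℚ.* (ε ℚ.* ε) → i ℚ.< j ℚ.+ η
    below {a} {b} {i} {j} ai bj 0<i 0<j ε<a ε<b b<a =
      <-by (ℚ.+-mono-< (*-pos (*-pos 0<i 0<j) (<⇒0< b<a))
        (*-pos 0<η (ℚ.+-mono-< (*-pos 0<i (<⇒0< ε<a)) (*-pos (*-pos 0<i 0<ε) (*-pos 0<j (<⇒0< ε<b))))))
        (combine₂ (j ℚ.+ η) (ℚ.- i ℚ.+ η ℚ.* i ℚ.* ε) ai bj (solve 6 (λ a b i j η ε →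
          i :* j :* (a :+ η :* (ε :* ε) :- b) :+ η :* (i :* (a :- ε) :+ i :* ε :* (j :* (b :- ε))) :- (j :+ η :- i) :=
          (j :+ η) :* (a :* i :- :1) :+ (:- i :+ η :* i :* ε) :* (b :* j :- :1)) ≡.refl a b i j η ε))

  inverse : ∀ x → fromℚ 0ℚ < x → ℝ
  inverse x 0<x = mkℝ (λ n → invℚ (seq x n)) inv-cauchy
    where
    ε = proj₁ 0<x
    0<ε = proj₁ (proj₂ 0<x)
    N₁ = proj₁ (0<⇒eventually x 0<x)
    ε<x = proj₂ (0<⇒eventually x 0<x)
    inv-cauchy : Cauchy (λ n → invℚ (seq x n))
    inv-cauchy η 0<η = N₁ ⊔ N₂ , λ m n ≤m ≤n → near⁻¹ (inv-near 0<ε 0<η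
      (ε<x m (ℕ.m⊔n≤o⇒m≤o N₁ N₂ ≤m)) (ε<x n (ℕ.m⊔n≤o⇒m≤o N₁ N₂ ≤n))
      (near (close m n (ℕ.m⊔n≤o⇒n≤o N₁ N₂ ≤m) (ℕ.m⊔n≤o⇒n≤o N₁ N₂ ≤n))))
      where
      settle₂ = cauchy x (η ℚ.* (ε ℚ.* ε)) (*-pos 0<η (*-pos 0<ε 0<ε))
      N₂ = proj₁ settle₂
      close = proj₂ settle₂

  inverseʳ : ∀ x (0<x : fromℚ 0ℚ < x) → x * inverse x 0<x ≈ fromℚ 1ℚ
  inverseʳ x 0<x@(ε , 0<ε , _) = ∼⇒≈ (x * inverse x 0<x) (fromℚ 1ℚ) λ η 0<η → eventually-map
    (λ n ε<x → near-refl 0<η (invℚ-inverseʳ (seq x n) (ℚ.<-trans 0<ε ε<x))) (0<⇒eventually x 0<x)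

  inverse-pos : ∀ x (0<x : fromℚ 0ℚ < x) → fromℚ 0ℚ < inverse x 0<x
  inverse-pos x 0<x@(ε , 0<ε , _) =
    let K , 0<K , x<K = eventually-bounded x
    in eventually⇒0< (inverse x 0<x) (invℚ K) (invℚ-pos K 0<K) (eventually-map
      (λ n (ε<x , ∣x∣<K) → smaller (seq x n) K (ℚ.<-trans 0<ε ε<x) 0<K (∣∣<-elimʳ ∣x∣<K))
      (0<⇒eventually x 0<x & x<K))
    where
    smaller : ∀ a K → 0ℚ ℚ.< a → 0ℚ ℚ.< K → a ℚ.< K → invℚ K ℚ.< invℚ a
    smaller a K 0<a 0<K a<K = <-by (*-pos (*-pos (invℚ-pos a 0<a) (invℚ-pos K 0<K)) (<⇒0< a<K))
      (combine₂ (ℚ.- invℚ K) (invℚ a) (invℚ-inverseʳ a 0<a) (invℚ-inverseʳ K 0<K)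
        (solve 4 (λ a K i j → i :* j :* (K :- a) :- (i :- j) :=
          (:- j) :* (a :* i :- :1) :+ i :* (K :* j :- :1)) ≡.refl a K (invℚ a) (invℚ K)))

  fromℚ-mono-< : ∀ {p q} → p ℚ.< q → fromℚ p < fromℚ q
  fromℚ-mono-< {p} {q} p<q = (q ℚ.- p) ℚ.* ½ , half (<⇒0< p<q) , 0 , λ _ _ → <-by (half (<⇒0< p<q))
    (solve 2 (λ p q → (q :- p) :* con ½ := q :- (p :+ (q :- p) :* con ½)) ≡.refl p q)

  archimedeanℝ : ∀ x → ∃[ n ] x < fromℕ n
  archimedeanℝ x =
    let K , 0<K , x<K = eventually-bounded x
        n , K<n = archimedeanℚ K
    in n , (ℤ.+ n ℚ./ 1) ℚ.- K , <⇒0< K<n , eventually-map (λ m ∣x∣<K →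
      <-by (<⇒0< (∣∣<-elimʳ ∣x∣<K))
        (solve 3 (λ x K n → K :- x := n :- (x :+ (n :- K))) ≡.refl (seq x m) K (ℤ.+ n ℚ./ 1))) x<K

  ℝ-field : OrderedField
  ℝ-field = record
    { commutativeRing = commutativeRing
    ; ι = fromℚ
    ; ι-+ = λ p q → pointwise (fromℚ (p ℚ.+ q)) (fromℚ p + fromℚ q) (λ _ → ≡.refl)
    ; ι-* = λ p q → pointwise (fromℚ (p ℚ.* q)) (fromℚ p * fromℚ q) (λ _ → ≡.refl)
    ; ι-‿ = λ p → pointwise (fromℚ (ℚ.- p)) (- fromℚ p) (λ _ → ≡.refl)
    ; ι-0 = pointwise (fromℚ 0ℚ) (fromℚ 0ℚ) (λ _ → ≡.refl)
    ; ι-1 = pointwise (fromℚ 1ℚ) (fromℚ 1ℚ) (λ _ → ≡.refl)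
    ; _<_ = _<_
    ; <-resp = λ {x} {x′} {y} {y′} → <-resp x x′ y y′
    ; <-irrefl = λ {x} → <-irrefl x
    ; <-trans = λ {x} {y} {z} → <-trans x y z
    ; <-cotrans = λ {x} {y} z → <-cotrans x y z
    ; <-tight = λ {x} {y} → <-tight x y
    ; +-monoˡ-< = λ {x} {y} z → +-monoˡ-< x y z
    ; *-pos = λ {x} {y} → *-pos-ℝ x y
    ; inv = inverse
    ; inv-inverseʳ = inverseʳ
    ; inv-pos = inverse-pos
    ; ι-mono-< = fromℚ-mono-<
    ; archimedean = archimedeanℝ
    }

-- Existence of roots by bisection over the rationals

module RootExistence where
  open RealProperties using (ℝ-field)
  module Q where
    open OrderedField ℚ-field public using (*-pos)
    open OrderedFieldProperties ℚ-field public
    open Branches ℚ-field public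
    open Bounds ℚ-field public
  module R where
    open OrderedField ℝ-field public
    open OrderedFieldProperties ℝ-field public
    open Branches ℝ-field public
    open Convergence ℝ-field public
  open Q using (solve; _:+_; _:*_; _:-_; _:=_; con; :1; :2; _≤_)

  -- Weak inequalities survive the passage to the limit, so brackets record their signs only weakly.
  pointwise-≤ : ∀ x y → (∀ n → seq x n ≤ seq y n) → x R.≤ y
  pointwise-≤ x y x≤y (ε , 0<ε , N , y<x) = x≤y N (Q.<-by
    (ℚ.+-mono-< (Q.<⇒0< (y<x N ℕ.≤-refl)) 0<ε)
    (solve 3 (λ x y ε → x :- (y :+ ε) :+ ε := x :- y) ≡.refl (seq x N) (seq y N) ε))

  point : ∀ x → 1ℚ ℚ.< x → Q.Point
  point x 1<x = record { t = x ; 1<t = 1<x }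

  -- Inverses of reals are computed termwise, hence so are values.
  seq-finite-arm : ∀ ν {μ n} (2<ν : R.𝟚 R.< ν) (2<μ : Q.𝟚 ℚ.< μ) → seq ν n ≡ μ → ∀ a →
                   seq (proj₁ (R.finite-arm {ν} 2<ν a)) n ≡ proj₁ (Q.finite-arm 2<μ a)
  seq-finite-arm ν 2<ν 2<μ e zero    = ≡.refl
  seq-finite-arm ν 2<ν 2<μ e (suc a) =
    ≡.cong₂ (λ x y → invℚ (x ℚ.- y)) e (seq-finite-arm ν 2<ν 2<μ e a)

  module _ (P : R.Point) (n : ℕ) (1<tₙ : 1ℚ ℚ.< seq (R.Point.t P) n) where
    private
      Pₙ : Q.Point
      Pₙ = point (seq (R.Point.t P) n) 1<tₙ

    seq-arms : ∀ a → seq (proj₁ (R.Point.arms P a)) n ≡ proj₁ (Q.Point.arms Pₙ a)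
    seq-arms (fin a) = seq-finite-arm (R.Point.ν P) (R.Point.2<ν P) (Q.Point.2<ν Pₙ) ≡.refl a
    seq-arms ∞       = ≡.refl

    seq-∑ : ∀ k {f g} → (∀ i → seq (f i) n ≡ g i) → seq (R.∑ k f) n ≡ Q.∑ k g
    seq-∑ zero e    = ≡.refl
    seq-∑ (suc k) e = ≡.cong₂ ℚ._+_ (seq-∑ k e) (e k)

    seq-value : ∀ k h → seq (R.Val.value (R.Point.val P k h)) n ≡ Q.Val.value (Q.Point.val Pₙ k h)
    seq-value k h = ≡.cong₂ (λ x y → Q.Point.ν Pₙ ℚ.- x ℚ.- y) (seq-arms (h (k ℕ.+ k)))
      (seq-∑ k (λ i → ≡.cong₂ (λ x y → invℚ (Q.Point.ν Pₙ ℚ.- x ℚ.- y)) (seq-arms (h i)) (seq-arms (h (k ℕ.+ i)))))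

  module Bisection (g : ∀ x → 1ℚ ℚ.< x → ℚ) (lo hi : ℚ) where

    record Bracket : Set where
      field
        a b  : ℚ
        1<a  : 1ℚ ℚ.< a
        1<b  : 1ℚ ℚ.< b
        lo≤a : lo ≤ a
        a≤b  : a ≤ b
        b≤hi : b ≤ hi
        ga≤0 : g a 1<a ≤ 0ℚ
        0≤gb : 0ℚ ≤ g b 1<b

      m : ℚ
      m = (a ℚ.+ b) ℚ.* ½

      a≤m : a ≤ m
      a≤m = Q.≤-by (Q.*-≥0 (Q.≤⇒0≤ a≤b) (Q.<⇒≤ (Q.ι-pos ½)))
        (solve 2 (λ a b → (b :- a) :* con ½ := (a :+ b) :* con ½ :- a) ≡.refl a b)

      m≤b : m ≤ b
      m≤b = Q.≤-by (Q.*-≥0 (Q.≤⇒0≤ a≤b) (Q.<⇒≤ (Q.ι-pos ½)))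
        (solve 2 (λ a b → (b :- a) :* con ½ := b :- (a :+ b) :* con ½) ≡.refl a b)

      1<m : 1ℚ ℚ.< m
      1<m = Q.<-≤-trans 1<a a≤m

      width : ℚ
      width = b ℚ.- a

    open Bracket

    choose : (B : Bracket) → Dec (0ℚ ℚ.< g (m B) (1<m B)) → Bracket
    choose B (yes 0<gm) = record
      { a = a B ; b = m B ; 1<a = 1<a B ; 1<b = 1<m B ; lo≤a = lo≤a B ; a≤b = a≤m B
      ; b≤hi = Q.≤-trans (m≤b B) (b≤hi B) ; ga≤0 = ga≤0 B ; 0≤gb = Q.<⇒≤ 0<gm }
    choose B (no 0≮gm) = record
      { a = m B ; b = b B ; 1<a = 1<m B ; 1<b = 1<b B ; lo≤a = Q.≤-trans (lo≤a B) (a≤m B) ; a≤b = m≤b B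
      ; b≤hi = b≤hi B ; ga≤0 = 0≮gm ; 0≤gb = 0≤gb B }

    choose-a : ∀ B d → a B ≤ a (choose B d)
    choose-a B (yes _) = Q.≤-refl
    choose-a B (no _)  = a≤m B

    choose-b : ∀ B d → b (choose B d) ≤ b B
    choose-b B (yes _) = m≤b B
    choose-b B (no _)  = Q.≤-refl

    choose-width : ∀ B d → width (choose B d) ≡ width B ℚ.* ½
    choose-width B (yes _) = solve 2 (λ a b → (a :+ b) :* con ½ :- a := (b :- a) :* con ½) ≡.refl (a B) (b B)
    choose-width B (no _)  = solve 2 (λ a b → b :- (a :+ b) :* con ½ := (b :- a) :* con ½) ≡.refl (a B) (b B)

    module _ (B₀ : Bracket) where
      B : ℕ → Bracket
      sign? : ∀ n → Dec (0ℚ ℚ.< g (m (B n)) (1<m (B n)))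
      B zero    = B₀
      B (suc n) = choose (B n) (sign? n)
      sign? n = 0ℚ ℚ.<? g (m (B n)) (1<m (B n))

      a-mono : ∀ N d → a (B N) ≤ a (B (d ℕ.+ N))
      a-mono N zero    = Q.≤-refl
      a-mono N (suc d) = Q.≤-trans (a-mono N d) (choose-a (B (d ℕ.+ N)) (sign? (d ℕ.+ N)))

      b-mono : ∀ N d → b (B (d ℕ.+ N)) ≤ b (B N)
      b-mono N zero    = Q.≤-refl
      b-mono N (suc d) = Q.≤-trans (choose-b (B (d ℕ.+ N)) (sign? (d ℕ.+ N))) (b-mono N d)

      0≤width : ∀ n → 0ℚ ≤ width (B n)
      0≤width n = Q.≤⇒0≤ (a≤b (B n))

      -- The width halves at each step; the weaker harmonic bound is the form that `O[1/n]⇒small`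
      -- accepts, and it holds because halving shrinks by at least the factor (n + 1)/(n + 2).
      width-bound : ∀ n → Q.fromNat (suc n) ℚ.* width (B n) ≤ width B₀
      width-bound zero    = Q.≈⇒≤ (ℚ.*-identityˡ (width B₀))
      width-bound (suc n) = Q.≤-trans
        (Q.≤-by (Q.*-≥0 (Q.*-≥0 (Q.fromNat-≥0 n) (0≤width n)) (Q.<⇒≤ (Q.ι-pos ½)))
          (eq {N = Q.fromNat n} (choose-width (B n) (sign? n)) (Q.fromNat-suc n) (Q.fromNat-suc (suc n))))
        (width-bound n)
        where
        eq : ∀ {w w′ N N₁ N₂} → w′ ≡ w ℚ.* ½ → N₁ ≡ N ℚ.+ 1ℚ → N₂ ≡ N₁ ℚ.+ 1ℚ →
             N ℚ.* w ℚ.* ½ ≡ N₁ ℚ.* w ℚ.- N₂ ℚ.* w′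
        eq {w} {N = N} ≡.refl ≡.refl ≡.refl = solve 2 (λ w N → N :* w :* con ½ :=
          (N :+ :1) :* w :- (N :+ :1 :+ :1) :* (w :* con ½)) ≡.refl w N

      width→0 : ∀ ε → 0ℚ ℚ.< ε → ∃[ N ] width (B N) ℚ.< ε
      width→0 ε 0<ε = let N , small = Q.O[1/n]⇒small (width B₀) ε 0<ε in N , small (width-bound N)

      a-mono′ : ∀ {N n} → N ℕ.≤ n → a (B N) ≤ a (B n)
      a-mono′ {N} {n} N≤n = ≡.subst (λ n → a (B N) ≤ a (B n)) (ℕ.m∸n+n≡m N≤n) (a-mono N (n ℕ.∸ N))

      b-mono′ : ∀ {N n} → N ℕ.≤ n → b (B n) ≤ b (B N)
      b-mono′ {N} {n} N≤n = ≡.subst (λ n → b (B n) ≤ b (B N)) (ℕ.m∸n+n≡m N≤n) (b-mono N (n ℕ.∸ N))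

      trapped : ∀ {l u x y ε} → u ℚ.- l ℚ.< ε → l ≤ x → y ≤ u → y ℚ.< x ℚ.+ ε
      trapped {l} {u} {x} {y} {ε} p q r = Q.<-by (Q.+-pos-≥0 (Q.<⇒0< p) (Q.+-≥0 (Q.≤⇒0≤ q) (Q.≤⇒0≤ r)))
        (solve 5 (λ l u x y ε → ε :- (u :- l) :+ (x :- l :+ (u :- y)) := x :+ ε :- y) ≡.refl l u x y ε)

      a≤b[N] : ∀ {N n} → N ℕ.≤ n → a (B n) ≤ b (B N)
      a≤b[N] {n = n} N≤n = Q.≤-trans (a≤b (B n)) (b-mono′ N≤n)

      a[N]≤b : ∀ {N n} → N ℕ.≤ n → a (B N) ≤ b (B n)
      a[N]≤b {n = n} N≤n = Q.≤-trans (a-mono′ N≤n) (a≤b (B n))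

      open RealProperties using (Near; within; near⁻¹)

      -- Both ends are kept as separate reals: the function is known to be at most 0 along the left
      -- ends and at least 0 along the right ends, and `squeeze` needs one sequence for each sign.
      lower upper : ℝ
      lower = mkℝ (λ n → a (B n)) λ ε 0<ε →
        let N , w<ε = width→0 ε 0<ε
        in N , λ m n N≤m N≤n → near⁻¹ (within
             (trapped w<ε (a-mono′ N≤n) (a≤b[N] N≤m)) (trapped w<ε (a-mono′ N≤m) (a≤b[N] N≤n)))
      upper = mkℝ (λ n → b (B n)) λ ε 0<ε →
        let N , w<ε = width→0 ε 0<ε
        in N , λ m n N≤m N≤n → near⁻¹ (within
             (trapped w<ε (a[N]≤b N≤n) (b-mono′ N≤m)) (trapped w<ε (a[N]≤b N≤m) (b-mono′ N≤n)))

      lower≈upper : lower Real.≈ upper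
      lower≈upper ε 0<ε =
        let N , w<ε = width→0 ε 0<ε
        in N , λ n N≤n → near⁻¹ (within
             (trapped w<ε (a[N]≤b N≤n) (a≤b[N] N≤n)) (trapped w<ε (a-mono′ N≤n) (b-mono′ N≤n)))

  module _ (k : ℕ) (0<k : 0 ℕ.< k) (h : ℕ → Length) (deep : ∀ i → i ℕ.< k ℕ.+ k → AtLeast 16 (h i)) where
    private
      g : ∀ x → 1ℚ ℚ.< x → ℚ
      g x 1<x = Q.Val.value (Q.Point.val (point x 1<x) k h)

      lo hi : ℚ
      -- The least limiting root has t² equal to the golden ratio, so t is about 1.272 (k = 1
      -- without a central arm); 6/5 leaves room for branch arms of length at least 16.
      lo = ℤ.+ 6 ℚ./ 5
      hi = Q.fromNat (suc k)

      1<lo : 1ℚ ℚ.< lo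
      1<lo = from-yes (1ℚ ℚ.<? lo)

      lo≤hi : lo ≤ hi
      lo≤hi = Q.≤-trans (Q.<⇒≤ (from-yes (lo ℚ.<? ℤ.+ 2 ℚ./ 1))) (Q.fromNat-mono-≤ {2} {suc k} (ℕ.s≤s 0<k))

      1<hi : 1ℚ ℚ.< hi
      1<hi = Q.<-≤-trans 1<lo lo≤hi

      open Bisection g lo hi

      B₀ : Bracket
      B₀ = record
        { a = lo ; b = hi ; 1<a = 1<lo ; 1<b = 1<hi ; lo≤a = Q.≤-refl ; a≤b = lo≤hi ; b≤hi = Q.≤-refl
        ; ga≤0 = Q.AtPoint.value-≤0 (point lo 1<lo) (Q.Point.val (point lo 1<lo) k h) ≡.refl 0<k deep
        ; 0≤gb = Q.AtPoint.value-≥0 (point hi 1<hi) (Q.Point.val (point hi 1<hi) k h) Q.≤-refl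
        }

      lo≤lower : fromℚ lo R.≤ lower B₀
      lo≤lower = pointwise-≤ (fromℚ lo) (lower B₀) (λ n → Bracket.lo≤a (B B₀ n))

      1<lower : R.𝟙 R.< lower B₀
      1<lower = R.<-≤-trans {R.𝟙} {fromℚ lo} {lower B₀} (R.ι-mono-< 1<lo) lo≤lower

      P P′ : R.Point
      P = record { t = lower B₀ ; 1<t = 1<lower }
      P′ = record { t = upper B₀ ; 1<t = R.<-respʳ {R.𝟙} {lower B₀} {upper B₀} (lower≈upper B₀) 1<lower }

      value≤0 : R.Val.value (R.Point.val P k h) R.≤ R.𝟘
      value≤0 = pointwise-≤ (R.Val.value (R.Point.val P k h)) (fromℚ 0ℚ) (λ n → ≡.subst (_≤ 0ℚ)
        (≡.sym (seq-value P n (Bracket.1<a (B B₀ n)) k h)) (Bracket.ga≤0 (B B₀ n)))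

      0≤value : R.𝟘 R.≤ R.Val.value (R.Point.val P′ k h)
      0≤value = pointwise-≤ (fromℚ 0ℚ) (R.Val.value (R.Point.val P′ k h)) (λ n → ≡.subst (0ℚ ≤_)
        (≡.sym (seq-value P′ n (Bracket.1<b (B B₀ n)) k h)) (Bracket.0≤gb (B B₀ n)))

    root-exists : ∃[ P ] fromℚ (ℤ.+ 6 ℚ./ 5) R.≤ R.Point.t P × R.Point.t P R.≤ fromℕ (suc k) ×
                  R.Val.value (R.Point.val P k h) R.≈ R.𝟘
    root-exists = P , lo≤lower ,
      pointwise-≤ (lower B₀) (fromℚ hi) (λ n → Q.≤-trans (Bracket.a≤b (B B₀ n)) (Bracket.b≤hi (B B₀ n))) ,
      R.squeeze P P′ (lower≈upper B₀) (R.Point.val P k h) (R.Point.val P′ k h) value≤0 0≤value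

-- From a root to τ = t²: maximality, limiting values, neighbours

module SalemNumber (𝔽 : OrderedField) where
  open OrderedField 𝔽
  open OrderedFieldProperties 𝔽
  open Branches 𝔽
  open Bounds 𝔽
  open Convergence 𝔽
  open Val

  Val-resp : ∀ {k h h′ ν} → (∀ i → h i ≡ h′ i) → Val k h ν → Val k h′ ν
  Val-resp {ν = ν} h≡h′ V = record
    { r = r V ; arm = λ i → ≡.subst (λ a → ArmVal ν a (r V i)) (h≡h′ i) (arm V i)
    ; m = m V ; m-pos = m-pos V ; m-inv = m-inv V }

  -ν<-2 : ∀ {ν} → 𝟚 < ν → - ν < - 𝟚
  -ν<-2 {ν} 2<ν = <-by (<⇒0< 2<ν) (solve 1 (λ ν → ν :- :2 := :- :2 :- (:- ν)) refl ν)

  module _ (P : Point) where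
    open Point P

    -- (s − t)(s − q) = 0, so s ≤ t since q < t.
    largest-root : ∀ {y s w} → 𝟘 ≤ s → s * s ≈ y → s * w ≈ 𝟙 → s + w ≈ ν → y ≤ t * t
    largest-root {y} {s} {w} 0≤s ss≈y sw≈1 s+w≈ν t²<y = <-irrefl (<-respʳ
      (combine₃ (- 𝟙) s 𝟙 sw≈1 s+w≈ν tq≈1 (solve 4 (λ s w t q →
        (s :- t) :* (s :- q) :- :0 :=
        (:- :1) :* (s :* w :- :1) :+ s :* (s :+ w :- (t :+ q)) :+ :1 :* (t :* q :- :1)) refl s w t q))
      (*-pos (<⇒0< t<s) (<⇒0< (<-trans q<t t<s))))
      where
      t<s : t < s
      t<s = <-by (pos-cancelʳ {s - t} {t + s} (+-pos-≥0 0<t 0≤s) (<-respʳ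
        (combine₁ (- 𝟙) ss≈y (solve 3 (λ s t y → y :- t :* t :- (s :- t) :* (t :+ s) :=
          (:- :1) :* (s :* s :- y)) refl s t y)) (<⇒0< t²<y))) refl

    module _ k (t²-q²≈k : t * t - q * q ≈ fromNat k) where

      0≤t²+q² : 𝟘 ≤ t * t + q * q
      0≤t²+q² = +-≥0 (*-≥0 (<⇒≤ 0<t) (<⇒≤ 0<t)) (*-≥0 (<⇒≤ 0<q) (<⇒≤ 0<q))

      -- The square root of k² + 4 is already at hand as z + 1/z with z = t², because (z + 1/z)² =
      -- (z - 1/z)² + 4.
      t²+q²-squared : (t * t + q * q) * (t * t + q * q) ≈ fromNat (k ℕ.^ 2 ℕ.+ 4)
      t²+q²-squared = trans
        (combine₂ (t * t - q * q + fromNat k) (fromNat 4 * (t * q + 𝟙)) t²-q²≈k tq≈1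
          (solve 3 (λ t q K → (t :* t :+ q :* q) :* (t :* t :+ q :* q) :- (K :* (K :* :1) :+ :4) :=
            (t :* t :- q :* q :+ K) :* (t :* t :- q :* q :- K) :+ :4 :* (t :* q :+ :1) :* (t :* q :- :1))
            refl t q (fromNat k)))
        (sym (trans (fromNat-+ (k ℕ.^ 2) 4) (+-congʳ (trans (fromNat-* k (k ℕ.* 1)) (*-congˡ (fromNat-* k 1))))))
        where
        :4 : ∀ {n} → Polynomial n
        :4 = con (ℤ.+ 4 ℚ./ 1)

      half-sum : t * t ≈ (fromNat k + (t * t + q * q)) * ι ½
      half-sum = combine₁ (ι ½) t²-q²≈k (solve 3 (λ t q K →
        t :* t :- (K :+ (t :* t :+ q :* q)) :* con ½ := con ½ :* (t :* t :- q :* q :- K)) refl t q (fromNat k))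

  -- The bounds travel with the root: `6/5≤t` feeds the estimate in `approach`, and `t≤1+k` feeds
  -- the nonintegrality of `ν * ν`.
  record Root (k : ℕ) (h : ℕ → Length) : Set where
    field
      P     : Point
      V     : Val k h (Point.ν P)
      root  : value V ≈ 𝟘
      6/5≤t : ι (ℤ.+ 6 ℚ./ 5) ≤ Point.t P
      t≤1+k : Point.t P ≤ fromNat (suc k)
    open Point P public

    τ : Carrier
    τ = t * t

  module _ {k h} (ρ : Root k h) (0<k : 0 ℕ.< k) (deep : ∀ i → i ℕ.< k ℕ.+ k → AtLeast (depth k) (h i)) where
    open Root ρ

    nonintegral : (∀ i → Finite (h i)) → h (k ℕ.+ k) ≡ fin 0 ⊎ AtLeast (depth k) (h (k ℕ.+ k)) →
                  ¬ (∃[ i ] ν * ν ≈ ι (i ℚ./ 1))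
    nonintegral finite (inj₁ h[2k]≡0) = AtPoint.nonintegral₀ P V root 0<k finite deep t≤1+k
      (≡.subst (λ a → ArmVal ν a (r V (k ℕ.+ k))) h[2k]≡0 (arm V (k ℕ.+ k)))
    nonintegral finite (inj₂ deep₂ₖ)  = AtPoint.nonintegral₁ P V root 0<k finite deep t≤1+k deep₂ₖ

  module _ {k h} (ρ : Root k h) (h≡∞ : ∀ i → i ℕ.< k ℕ.+ k → h i ≡ ∞) where
    open Root ρ

    metallic-mean : h (k ℕ.+ k) ≡ fin 0 →
      ∃[ r ] 𝟘 ≤ r × r * r ≈ fromNat (k ℕ.^ 2 ℕ.+ 4) × τ ≈ (fromNat k + r) * ι ½
    metallic-mean h[2k]≡0 = t * t + q * q , 0≤t²+q² P k t²-q²≈k , t²+q²-squared P k t²-q²≈k , half-sum P k t²-q²≈k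
      where
      t²-q²≈k = no-central-arm P V root h≡∞ h[2k]≡0

    integer : h (k ℕ.+ k) ≡ ∞ → τ ≈ fromNat (k ℕ.+ 1)
    integer h[2k]≡∞ = trans (infinite-central-arm P V root h≡∞ h[2k]≡∞) (sym (fromNat-+ k 1))

  neighbours : ∀ {k h} (ρ : Root k h) {j} → h j ≡ ∞ → j ℕ.≤ k ℕ.+ k → ∀ ε → 𝟘 < ε →
    ∃[ N ] ∀ n → N ℕ.≤ n → (ρ′ : Root k (h [ j ≔ fin n ])) →
      Root.τ ρ′ ♯ Root.τ ρ × Root.τ ρ - ε < Root.τ ρ′ × Root.τ ρ′ < Root.τ ρ + ε
  neighbours {k} {h} ρ {j} h[j]≡∞ j≤2k ε 0<ε =
    let B , close = approach (Root.P ρ) (Root.V ρ) (Root.root ρ) h[j]≡∞ j≤2k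
        N , small = O[1/n]⇒small B ε 0<ε
    in N , λ n N≤n ρ′ →
      let τ′<τ , bound = close n (Root.P ρ′) (Root.V ρ′) (Root.6/5≤t ρ′) (Root.root ρ′)
      in inj₁ τ′<τ ,
         <-by (<⇒0< (small (≤-trans
           (*-monoʳ-≤ (≤⇒0≤ (<⇒≤ τ′<τ)) (fromNat-mono-≤ (ℕ.s≤s N≤n))) bound)))
           (solve 3 (λ x y ε → ε :- (x :- y) := y :- (x :- ε)) refl (Root.τ ρ) (Root.τ ρ′) ε) ,
         <-by (+-pos (<⇒0< τ′<τ) 0<ε)
           (solve 3 (λ x y ε → x :- y :+ ε := x :+ ε :- y) refl (Root.τ ρ) (Root.τ ρ′) ε)

-- Length assignments, Salem graphs and derived sets

[≔]-elim : ∀ {h j a i} (Q : Length → Set) → (i ≡ j → Q a) → (i ≢ j → Q (h i)) → Q ((h [ j ≔ a ]) i)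
[≔]-elim {h} {j} {a} {i} Q new old = by (i ℕ.≡ᵇ j) (ℕ.≡ᵇ⇒≡ i j) (ℕ.≡⇒≡ᵇ i j)
  where
  by : ∀ b → (T b → i ≡ j) → (i ≡ j → T b) → Q (if b then a else h i)
  by true  sound _    = new (sound tt)
  by false _ complete = old complete

-- With `j` equal to `k + k` the central arm has length 0, that is, it is absent; with one more it
-- is infinite. These are the two starting points of the theorem.
initially∞ : ℕ → ℕ → Length
initially∞ j i = if i ℕ.<ᵇ j then ∞ else fin 0

initially∞-elim : ∀ {j i} (Q : Length → Set) → (i ℕ.< j → Q ∞) → (j ℕ.≤ i → Q (fin 0)) → Q (initially∞ j i)
initially∞-elim {j} {i} Q below above = by (i ℕ.<ᵇ j) (ℕ.<ᵇ⇒< i j) ℕ.<⇒<ᵇ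
  where
  by : ∀ b → (T b → i ℕ.< j) → (i ℕ.< j → T b) → Q (if b then ∞ else fin 0)
  by true  sound _    = below (sound tt)
  by false _ complete = above (ℕ.≮⇒≥ complete)

AtLeast-≤ : ∀ {M N} → M ℕ.≤ N → ∀ a → AtLeast N a → AtLeast M a
AtLeast-≤ M≤N (fin a) = ℕ.≤-trans M≤N
AtLeast-≤ M≤N ∞       = λ _ → tt

module SalemGraphs where
  open RealProperties using (ℝ-field; pointwise; ≈-sym; ≈-trans)
  module R where
    open OrderedField ℝ-field public
    open OrderedFieldProperties ℝ-field public
    open Branches ℝ-field public
    open Elimination ℝ-field public
    open SalemNumber ℝ-field public

  private
    entry entryᴿ : ∀ {n} → Tree n → (Fin n → ℝ) → Fin n → Fin n → ℝ
    entry  Tr v i j = adjacencyMatrix (graph Tr) i j Real.* v j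
    entryᴿ Tr v i j = R.matrix Tr i j R.* v j

    sumᴿ : ∀ {n} → (Fin n → ℝ) → ℝ
    sumᴿ = RawMonoid.sum R.+-rawMonoid

    seq-sum : ∀ {n} (f g : Fin n → ℝ) → (∀ j l → seq (f j) l ≡ seq (g j) l) →
              ∀ l → seq (Real.sum f) l ≡ seq (sumᴿ g) l
    seq-sum {zero}  f g e l = ≡.refl
    seq-sum {suc n} f g e l =
      ≡.cong₂ ℚ._+_ (e zero l) (seq-sum (λ j → f (suc j)) (λ j → g (suc j)) (λ j → e (suc j)) l)

    seq-unit : ∀ b l → seq (if b then fromℕ 1 else fromℕ 0) l ≡ seq (if b then R.𝟙 else R.𝟘) l
    seq-unit true  l = ≡.refl
    seq-unit false l = ≡.refl

    seq-entry : ∀ {n} (Tr : Tree n) (v : Fin n → ℝ) i j l → seq (entry Tr v i j) l ≡ seq (entryᴿ Tr v i j) l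
    seq-entry Tr v i j l = ≡.cong (ℚ._* seq (v j) l) (seq-unit (adj Tr i j) l)

    seq-row : ∀ {n} (Tr : Tree n) (v : Fin n → ℝ) i l →
              seq (Real.sum (entry Tr v i)) l ≡ seq (sumᴿ (entryᴿ Tr v i)) l
    seq-row Tr v i = seq-sum (entry Tr v i) (entryᴿ Tr v i) (seq-entry Tr v i)

    row : ∀ {n} (Tr : Tree n) (v : Fin n → ℝ) i → Real.sum (entry Tr v i) Real.≈ sumᴿ (entryᴿ Tr v i)
    row Tr v i = pointwise (Real.sum (entry Tr v i)) (sumᴿ (entryᴿ Tr v i)) (seq-row Tr v i)

    row⁻¹ : ∀ {n} (Tr : Tree n) (v : Fin n → ℝ) i → sumᴿ (entryᴿ Tr v i) Real.≈ Real.sum (entry Tr v i)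
    row⁻¹ Tr v i = ≈-sym (Real.sum (entry Tr v i)) (sumᴿ (entryᴿ Tr v i)) (row Tr v i)

    rowᴿ : ∀ {n} (Tr : Tree n) θ v → R.Kernel Tr (λ _ → θ) v → ∀ i → sumᴿ (entryᴿ Tr v i) Real.≈ θ Real.* v i
    rowᴿ Tr θ v ker i = ker i

    row-kernel : ∀ {n} (Tr : Tree n) θ v → (∀ i → sumᴿ (entryᴿ Tr v i) Real.≈ θ Real.* v i) → R.Kernel Tr (λ _ → θ) v
    row-kernel Tr θ v rows i = rows i

  kernel⇒eigenspace : ∀ {n} (Tr : Tree n) θ v → R.Kernel Tr (λ _ → θ) v →
                      InEigenspace (adjacencyMatrix (graph Tr)) θ v
  kernel⇒eigenspace Tr θ v ker i = ≈-trans (Real.sum (entry Tr v i)) (sumᴿ (entryᴿ Tr v i)) (θ Real.* v i)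
    (row Tr v i) (rowᴿ Tr θ v ker i)

  eigenspace⇒kernel : ∀ {n} (Tr : Tree n) θ v → InEigenspace (adjacencyMatrix (graph Tr)) θ v →
                      R.Kernel Tr (λ _ → θ) v
  eigenspace⇒kernel Tr θ v eig = row-kernel Tr θ v (λ i →
    ≈-trans (sumᴿ (entryᴿ Tr v i)) (Real.sum (entry Tr v i)) (θ Real.* v i) (row⁻¹ Tr v i) (eig i))

  simple-eigenvalue : ∀ {n} (Tr : Tree n) θ → R.IsSimpleᵗ Tr θ → IsSimpleEigenvalue (adjacencyMatrix (graph Tr)) θ
  simple-eigenvalue Tr θ (v , (apart , ker) , span) = v , (apart , kernel⇒eigenspace Tr θ v ker) ,
    λ w eig → span w (eigenspace⇒kernel Tr θ w eig)

  only-eigenvalue : ∀ {n} (Tr : Tree n) {P : ℝ → Set} θ → P θ → R.IsSimpleᵗ Tr θ →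
    (∀ μ w → P μ → R.IsEigenvectorᵗ Tr μ w → μ Real.≈ θ) → IsOnlyEigenvalueIn (adjacencyMatrix (graph Tr)) P θ
  only-eigenvalue Tr θ Pθ simple unique = Pθ , simple-eigenvalue Tr θ simple ,
    λ μ Pμ (w , apart , eig) → unique μ w Pμ (apart , eigenspace⇒kernel Tr μ w eig)

  tau-largest : ∀ (P : R.Point) → IsLargest (SqrtReciprocalRoot (R.Point.ν P)) (R.Point.t P R.* R.Point.t P)
  tau-largest P = (t , (R.<⇒≤ {R.𝟘} {t} 0<t , R.refl {t R.* t}) , q , tq≈1 , R.refl {ν}) ,
    λ y (s , (0≤s , ss≈y) , w , sw≈1 , s+w≈ν) → R.largest-root P {y} {s} {w} 0≤s ss≈y sw≈1 s+w≈ν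
    where open R.Point P

  tree-tau : ∀ {n} (Tr : Tree n) (P : R.Point) → R.Spectrum Tr (R.Point.ν P) →
    ¬ IsInteger (R.Point.ν P R.* R.Point.ν P) → T-graph (R.Point.t P R.* R.Point.t P)
  tree-tau Tr P spectrum nonintegral = graph Tr , inj₂ (ν ,
    ( graph-bipartite Tr
    , only-eigenvalue Tr {Above2} ν above2 simple unique
    , only-eigenvalue Tr {Below-2} (Real.- ν) (R.-ν<-2 {ν} above2) (R.flip-simple Tr {ν} simple) unique⁻) ,
    nonintegral , tau-largest P)
    where
    open R.Point P using (ν)
    open R.Spectrum spectrum

  caterpillar-tau : ∀ k h (P : R.Point) (V : R.Val k (fin ∘ h) (R.Point.ν P)) → R.Val.value V R.≈ R.𝟘 →
    ¬ IsInteger (R.Point.ν P R.* R.Point.ν P) → T-graph (R.Point.t P R.* R.Point.t P)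
  caterpillar-tau k h P V root = tree-tau (Rooted.tree (caterpillar k h)) P
    (R.caterpillar-spectrum k h {R.Point.ν P} (R.Point.2<ν P) V root)

  root : ∀ k → 0 ℕ.< k → ∀ h → (∀ i → i ℕ.< k ℕ.+ k → AtLeast (depth k) (h i)) → R.Root k h
  root k 0<k h deep =
    let P , 6/5≤t , t≤1+k , root = RootExistence.root-exists k 0<k h
          (λ i i<2k → AtLeast-≤ (16≤depth k) (h i) (deep i i<2k))
    in record { P = P ; V = R.Point.val P k h ; root = root ; 6/5≤t = 6/5≤t ; t≤1+k = t≤1+k }

  finite-root-tau : ∀ {k h} (ρ : R.Root k h) → (∀ i → R.Finite (h i)) →
                    ¬ IsInteger (R.Root.ν ρ R.* R.Root.ν ρ) → T-graph (R.Root.τ ρ)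
  finite-root-tau {k} {h} ρ finite = caterpillar-tau k (λ i → proj₁ (finite i)) (R.Root.P ρ)
    (R.Val-resp (λ i → proj₂ (finite i)) (R.Root.V ρ)) (R.Root.root ρ)

  -- The invariant of an induction that spends one infinite arm for each derivation. Finite branch
  -- arms stay long and the central arm is absent or long, so that `nonintegral` applies once no
  -- infinite arm is left.
  record Admissible (k j : ℕ) (h : ℕ → Length) : Set where
    field
      infinite : ∀ i → i ℕ.< j → h i ≡ ∞
      finite   : ∀ i → j ℕ.≤ i → R.Finite (h i)
      deep     : ∀ i → i ℕ.< k ℕ.+ k → AtLeast (depth k) (h i)
      central  : h (k ℕ.+ k) ≡ fin 0 ⊎ AtLeast (depth k) (h (k ℕ.+ k))

  open Admissible

  shorten : ∀ {k j h n} → Admissible k (suc j) h → depth k ℕ.≤ n → Admissible k j (h [ j ≔ fin n ])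
  shorten {k} {j} {h} {n} adm depth≤n = record
    { infinite = λ i i<j → [≔]-elim {h} {j} {fin n} {i} (_≡ ∞) (λ i≡j → ⊥-elim (ℕ.<-irrefl i≡j i<j))
        (λ _ → infinite adm i (ℕ.m<n⇒m<1+n i<j))
    ; finite = λ i j≤i → [≔]-elim {h} {j} {fin n} {i} R.Finite (λ _ → n , ≡.refl)
        (λ i≢j → finite adm i (ℕ.≤∧≢⇒< j≤i (i≢j ∘ ≡.sym)))
    ; deep = λ i i<2k → [≔]-elim {h} {j} {fin n} {i} (AtLeast (depth k)) (λ _ → depth≤n) (λ _ → deep adm i i<2k)
    ; central = [≔]-elim {h} {j} {fin n} {k ℕ.+ k} (λ a → a ≡ fin 0 ⊎ AtLeast (depth k) a)
        (λ _ → inj₂ depth≤n) (λ _ → central adm)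
    }

  -- The last infinite arm, number `j`, is cut to a length beyond two thresholds: the one from
  -- `neighbours` puts the new root within `ε` of the old one and apart from it, and `depth k` keeps
  -- the lengths admissible, so that the induction hypothesis places the new root in the `j`-th
  -- derived set.
  derived-root : ∀ {k} → 0 ℕ.< k → ∀ j → j ℕ.≤ suc (k ℕ.+ k) → ∀ {h} → Admissible k j h →
                 (ρ : R.Root k h) → derived j T-graph (R.Root.τ ρ)
  derived-root 0<k zero _ adm ρ = finite-root-tau ρ (λ i → finite adm i ℕ.z≤n)
    (R.nonintegral ρ 0<k (deep adm) (λ i → finite adm i ℕ.z≤n) (central adm))
  derived-root {k} 0<k (suc j) 1+j≤1+2k {h} adm ρ ε 0<ε =
    R.Root.τ ρ′ , derived-root 0<k j (ℕ.m≤n⇒m≤1+n (ℕ.s≤s⁻¹ 1+j≤1+2k)) adm′ ρ′ ,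
    proj₂ near n (ℕ.m≤m⊔n (proj₁ near) (depth k)) ρ′
    where
    near = R.neighbours ρ {j} (infinite adm j ℕ.≤-refl) (ℕ.s≤s⁻¹ 1+j≤1+2k) ε 0<ε
    n : ℕ
    n = proj₁ near ⊔ depth k
    adm′ : Admissible k j (h [ j ≔ fin n ])
    adm′ = shorten adm (ℕ.m≤n⊔m (proj₁ near) (depth k))
    ρ′ : R.Root k (h [ j ≔ fin n ])
    ρ′ = root k 0<k (h [ j ≔ fin n ]) (deep adm′)

  initially∞-admissible : ∀ k j → k ℕ.+ k ℕ.≤ j → Admissible k j (initially∞ j)
  initially∞-admissible k j 2k≤j = record
    { infinite = λ i i<j → initially∞-elim {j} {i} (_≡ ∞) (λ _ → ≡.refl) (λ j≤i → ⊥-elim (ℕ.<⇒≱ i<j j≤i))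
    ; finite = λ i j≤i → initially∞-elim {j} {i} R.Finite (λ i<j → ⊥-elim (ℕ.<⇒≱ i<j j≤i)) (λ _ → 0 , ≡.refl)
    ; deep = λ i i<2k → initially∞-elim {j} {i} (AtLeast (depth k)) (λ _ → tt)
        (λ j≤i → ⊥-elim (ℕ.<⇒≱ (ℕ.<-≤-trans i<2k 2k≤j) j≤i))
    ; central = initially∞-elim {j} {k ℕ.+ k} (λ a → a ≡ fin 0 ⊎ AtLeast (depth k) a)
        (λ _ → inj₂ tt) (λ _ → inj₁ ≡.refl)
    }

  LimitPoint-resp : ∀ {S : ℝ → Set} x y → x R.≈ y → LimitPoint S x → LimitPoint S y
  LimitPoint-resp x y x≈y limit ε 0<ε =
    let z , Sz , z♯x , x-ε<z , z<x+ε = limit ε 0<ε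
    in z , Sz , R.♯-resp {z} {x} {y} x≈y z♯x ,
       R.<-respˡ {x R.- ε} {y R.- ε} {z} (R.+-congʳ {R.- ε} {x} {y} x≈y) x-ε<z ,
       R.<-respʳ {z} {x R.+ ε} {y R.+ ε} (R.+-congʳ {ε} {x} {y} x≈y) z<x+ε

  derived-S-graph : ∀ j → derived (suc j) T-graph ≡ derived j S-graph
  derived-S-graph zero    = ≡.refl
  derived-S-graph (suc j) = ≡.cong LimitPoint (derived-S-graph j)

  derived-resp : ∀ j x y → x R.≈ y → derived (suc j) T-graph x → derived j S-graph y
  derived-resp j x y x≈y d = ≡.subst (λ S → S y) (derived-S-graph j) (LimitPoint-resp x y x≈y d)

  module _ (k : ℕ) (0<k : 0 ℕ.< k) where
    private
      adm : ∀ j → k ℕ.+ k ℕ.≤ j → Admissible k j (initially∞ j)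
      adm = initially∞-admissible k
      ρ : ∀ j → k ℕ.+ k ℕ.≤ j → R.Root k (initially∞ j)
      ρ j 2k≤j = root k 0<k (initially∞ j) (deep (adm j 2k≤j))

    metallic : ∃[ r ] r IsSquareRootOf fromℕ (k ℕ.^ 2 ℕ.+ 4) ×
               derived (2 ℕ.* k ℕ.∸ 1) S-graph ((fromℕ k Real.+ r) Real.* fromℚ ½)
    metallic =
      let r , 0≤r , r²≈ , τ≈ = R.metallic-mean ρ₀ (infinite adm₀)
            (initially∞-elim {k ℕ.+ k} {k ℕ.+ k} (_≡ fin 0) (λ 2k<2k → ⊥-elim (ℕ.<-irrefl ≡.refl 2k<2k)) (λ _ → ≡.refl))
      in r , (0≤r , r²≈) ,
         derived-resp (2 ℕ.* k ℕ.∸ 1) (R.Root.τ ρ₀) ((fromℕ k Real.+ r) Real.* fromℚ ½) τ≈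
           (≡.subst (λ j → derived j T-graph (R.Root.τ ρ₀)) 2k≡
             (derived-root 0<k (k ℕ.+ k) (ℕ.n≤1+n _) adm₀ ρ₀))
      where
      adm₀ = adm (k ℕ.+ k) ℕ.≤-refl
      ρ₀ = ρ (k ℕ.+ k) ℕ.≤-refl
      -- `0<k` ensures that the truncated subtraction really subtracts 1.
      2k≡ : k ℕ.+ k ≡ suc (2 ℕ.* k ℕ.∸ 1)
      2k≡ = ≡.trans (≡.cong (k ℕ.+_) (≡.sym (ℕ.+-identityʳ k)))
        (≡.sym (ℕ.m+[n∸m]≡n {1} (ℕ.≤-trans 0<k (ℕ.m≤m+n k (k ℕ.+ 0)))))

    integral : derived (2 ℕ.* k) S-graph (fromℕ (k ℕ.+ 1))
    integral = derived-resp (2 ℕ.* k) (R.Root.τ ρ₁) (fromℕ (k ℕ.+ 1))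
      (R.integer ρ₁ (λ i i<2k → infinite adm₁ i (ℕ.m<n⇒m<1+n i<2k)) (infinite adm₁ (k ℕ.+ k) ℕ.≤-refl))
      (≡.subst (λ j → derived j T-graph (R.Root.τ ρ₁)) (≡.cong (λ m → suc (k ℕ.+ m)) (≡.sym (ℕ.+-identityʳ k)))
        (derived-root 0<k (suc (k ℕ.+ k)) ℕ.≤-refl adm₁ ρ₁))
      where
      adm₁ = adm (suc (k ℕ.+ k)) (ℕ.n≤1+n _)
      ρ₁ = ρ (suc (k ℕ.+ k)) (ℕ.n≤1+n _)

open import Data.Nat using (NonZero; _+_; _*_; _∸_; _^_)
open import Relation.Unary using (_∈_)

theorem17 : (k : ℕ) → .{{_ : NonZero k}} →
    (∃[ r ] r IsSquareRootOf fromℕ (k ^ 2 + 4) ×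
            (fromℕ k Real.+ r) Real.* fromℚ ½ ∈ derived (2 * k ∸ 1) S-graph)
    × fromℕ (k + 1) ∈ derived (2 * k) S-graph
theorem17 k = SalemGraphs.metallic k 0<k , SalemGraphs.integral k 0<k
  where
  0<k : 0 ℕ.< k
  0<k = ℕ.>-nonZero⁻¹ k
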